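{- Let $V$ be a model of set theory, $\kappa$ an infinite ordinal, $X\in V$ an infinite set, $\mathscr{L}\in V$ a relational language, and let $\mu_0,\mu_1\in V$ be distinct ergodic invariant measures on $[\mathrm{Str}^\kappa_{\mathscr{L}}(X)]^V$. If $G$ is a $\mu_0$-random generic filter over $V$, then $G$ is not a $\mu_1$-random generic filter over $V$.
   Context: A model of set theory is a transitive model of ZFC. Structures and measures: $\mathrm{Str}_{\mathscr{L}}(X)$ is the set of $\mathscr{L}$-structures with underlying set $X$. An $\mathscr{L}$-literal is an atomic formula or a (possibly iterated) negation of one. $\sigma_\kappa(\mathrm{Str}_{\mathscr{L}}(X))$ is the smallest family of subsets of $\mathrm{Str}_{\mathscr{L}}(X)$ closed under complements and under unions of size $\le\kappa$ and containing all sets $\{\mathcal{M}:\mathcal{M}\models\varphi(\bar a)\}$ for $\varphi$ a literal and $\bar a$ a tuple from $X$. $\mathrm{Str}^\kappa_{\mathscr{L}}(X)$ is $\mathrm{Str}_{\mathscr{L}}(X)$ with this family of measurable sets. A probability $\kappa$-measure on it is a probability measure $\mu$ with $\mu(\bigcup_{i\in\kappa}A_i)=\sum_{i\in\kappa}\mu(A_i)$ for pairwise disjoint measurable $A_i$. $\mathrm{Sym}(X)$ acts by $g\mathcal{M}\models R(g(a_0),\dots)$ iff $\mathcal{M}\models R(a_0,\dots)$; $\mu$ is invariant if $\mu(g[A])=\mu(A)$ for all $g\in\mathrm{Sym}(X)$ and measurable $A$. "Invariant measure" means invariant probability $\kappa$-measure. It is ergodic if every measurable $A$ with $\mu(g[A]\triangle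 A)=0$ for all $g\in\mathrm{Sym}(X)$ satisfies $\mu(A)\in\{0,1\}$. Codes: the set $\mathbb{B}^\kappa_{\mathscr{L}:X}$ of $\kappa$-Borel codes is the smallest set containing the basic codes $\langle 0,\varphi,\bar a\rangle$ ($\varphi$ a finite conjunction of $\mathscr{L}$-literals, $\bar a$ a tuple from $X$) and closed under formal negation $\neg\gamma$ and formal $\bigvee\Gamma$, $\bigwedge\Gamma$ for $\Gamma=\{\gamma_i\}_{i\in\kappa}$. The interpretation $\mathrm{Int}(\gamma)\subseteq\mathrm{Str}_{\mathscr{L}}(X)$ interprets basic codes as $\{\mathcal{M}:\mathcal{M}\models\varphi(\bar a)\}$ and $\neg,\bigvee,\bigwedge$ as complement, union, intersection. $\mu(\gamma)=\mu(\mathrm{Int}(\gamma))$. Forcing: $\gamma\preceq_\mu\zeta$ means $\mu(\gamma\wedge\neg\zeta)=0$, and $\mathcal{O}^+(\mu)=(\{\gamma\in\mathbb{B}^\kappa_{\mathscr{L}:X}:\mu(\gamma)>0\},\preceq_\mu)$, a pre-order (smaller is stronger), computed in $V$. A $\mu$-random generic filter over $V$ is a filter on $\mathcal{O}^+(\mu)$ generic over $V$. -}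

module Defs where

open import Level using (Level) renaming (suc to lsuc)
open import Data.Empty using (⊥)
open import Data.Fin.Base using (Fin)
open import Data.List.Base using (List; []; _∷_)
open import Data.List.Relation.Unary.All using (All)
open import Data.List.Relation.Unary.AllPairs using (AllPairs)
open import Data.Nat.Base using (ℕ; zero; suc)
open import Data.Product using (Σ; ∃; ∃!; _×_; _,_; proj₁; proj₂)
open import Data.Sum.Base using (_⊎_)
open import Data.Vec.Base as Vec using (Vec; lookup)
open import Function.Bundles using (_⇔_)
open import Relation.Nullary.Negation.Core using (¬_)
open import Relation.Binary.Structures using (IsTotalOrder)
open import Algebra.Structures using (IsCommutativeRing)

------------------------------------------------------------------------
-- The ambient universe of sets (Aczel's iterative sets, with equality
-- given by bisimulation).

data 𝕍 (ℓ : Level) : Set (lsuc ℓ) where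
  sup : (A : Set ℓ) → (A → 𝕍 ℓ) → 𝕍 ℓ

module _ {ℓ : Level} where

  infix 4 _≈ᵁ_ _∈ᵁ_

  _≈ᵁ_ : 𝕍 ℓ → 𝕍 ℓ → Set ℓ
  sup A f ≈ᵁ sup B g =
    (∀ a → ∃ λ b → f a ≈ᵁ g b) × (∀ b → ∃ λ a → f a ≈ᵁ g b)

  _∈ᵁ_ : 𝕍 ℓ → 𝕍 ℓ → Set ℓ
  x ∈ᵁ sup B g = ∃ λ b → x ≈ᵁ g b

------------------------------------------------------------------------
-- First-order formulas of set theory, with n free variables (de Bruijn).

infix 8 _∈′_ _≈′_
infixr 7 _∧′_
infixr 6 _∨′_
infixr 5 _⇒′_

data Formula (n : ℕ) : Set where
  _∈′_ _≈′_      : Fin n → Fin n → Formula n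
  ⊥′             : Formula n
  _∧′_ _∨′_ _⇒′_ : Formula n → Formula n → Formula n
  ∀′ ∃′          : Formula (suc n) → Formula n

------------------------------------------------------------------------
-- Everything below is relativised to a class V of sets: "∀ x" and "∃ x"
-- over Ob V are quantifiers bounded by V, so a notion defined below is
-- that notion as computed in V.  Notions that set theory writes as
-- partial operations are rendered by their graphs; the last argument is
-- then the value (for example, Pair a b p says p = ⟨a , b⟩).

module Relativised {ℓ : Level} (V : 𝕍 ℓ → Set (lsuc ℓ)) where

  Ob : Set (lsuc ℓ)
  Ob = Σ (𝕍 ℓ) V

  infix 4 _≈_ _≉_ _∈_ _∉_ _⊆_

  _≈_ _≉_ _∈_ _∉_ : Ob → Ob → Set ℓ
  x ≈ y = proj₁ x ≈ᵁ proj₁ y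
  x ≉ y = ¬ x ≈ y
  x ∈ y = proj₁ x ∈ᵁ proj₁ y
  x ∉ y = ¬ x ∈ y

  _⊆_ : Ob → Ob → Set (lsuc ℓ)
  x ⊆ y = ∀ z → z ∈ x → z ∈ y

  ⟦_⟧ : ∀ {n} → Formula n → Vec Ob n → Set (lsuc ℓ)
  ⟦ i ∈′ j ⟧ ρ = Level.Lift (lsuc ℓ) (lookup ρ i ∈ lookup ρ j)
  ⟦ i ≈′ j ⟧ ρ = Level.Lift (lsuc ℓ) (lookup ρ i ≈ lookup ρ j)
  ⟦ ⊥′     ⟧ ρ = Level.Lift (lsuc ℓ) ⊥
  ⟦ φ ∧′ ψ ⟧ ρ = ⟦ φ ⟧ ρ × ⟦ ψ ⟧ ρ
  ⟦ φ ∨′ ψ ⟧ ρ = ⟦ φ ⟧ ρ ⊎ ⟦ ψ ⟧ ρ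
  ⟦ φ ⇒′ ψ ⟧ ρ = ⟦ φ ⟧ ρ → ⟦ ψ ⟧ ρ
  ⟦ ∀′ φ   ⟧ ρ = ∀ x → ⟦ φ ⟧ (x Vec.∷ ρ)
  ⟦ ∃′ φ   ⟧ ρ = ∃ λ x → ⟦ φ ⟧ (x Vec.∷ ρ)

  Empty : Ob → Set (lsuc ℓ)
  Empty e = ∀ x → x ∉ e

  Succ : Ob → Ob → Set (lsuc ℓ)
  Succ x y = ∀ z → z ∈ y ⇔ (z ∈ x ⊎ z ≈ x)

  Inductive : Ob → Set (lsuc ℓ)
  Inductive w = (∀ e → Empty e → e ∈ w)
              × (∀ x y → x ∈ w → Succ x y → y ∈ w)

  record IsTransitiveModelOfZFC : Set (lsuc ℓ) where
    field
      transitive     : ∀ x y → V x → y ∈ᵁ x → V y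
      extensionality : ∀ x y → (∀ z → z ∈ x ⇔ z ∈ y) → x ≈ y
      foundation     : ∀ a → (∃ λ x → x ∈ a) →
                       ∃ λ x → x ∈ a × (∀ z → z ∈ x → z ∉ a)
      pairing        : ∀ a b → ∃ λ p → ∀ z → z ∈ p ⇔ (z ≈ a ⊎ z ≈ b)
      union          : ∀ a → ∃ λ u → ∀ z → z ∈ u ⇔ (∃ λ x → x ∈ a × z ∈ x)
      power          : ∀ a → ∃ λ p → ∀ z → z ∈ p ⇔ z ⊆ a
      infinity       : ∃ λ w → Inductive w
      separation     : ∀ {n} (φ : Formula (suc n)) (ρ : Vec Ob n) →
                       ∀ a → ∃ λ b → ∀ x →
                       x ∈ b ⇔ (x ∈ a × ⟦ φ ⟧ (x Vec.∷ ρ))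
      replacement    : ∀ {n} (φ : Formula (suc (suc n))) (ρ : Vec Ob n) →
                       ∀ a →
                       (∀ x → x ∈ a →
                         ∃! _≈_ λ y → ⟦ φ ⟧ (x Vec.∷ y Vec.∷ ρ)) →
                       ∃ λ b → ∀ y →
                       y ∈ b ⇔ (∃ λ x → x ∈ a × ⟦ φ ⟧ (x Vec.∷ y Vec.∷ ρ))
      choice         : ∀ a → (∀ x → x ∈ a → ∃ λ z → z ∈ x) →
                       (∀ x y z → x ∈ a → y ∈ a → z ∈ x → z ∈ y → x ≈ y) →
                       ∃ λ c → ∀ x → x ∈ a → ∃! _≈_ λ z → z ∈ x × z ∈ c

  ----------------------------------------------------------------------
  -- Pairs, functions, ordinals

  UPair : Ob → Ob → Ob → Set (lsuc ℓ)
  UPair a b p = ∀ z → z ∈ p ⇔ (z ≈ a ⊎ z ≈ b)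

  Pair : Ob → Ob → Ob → Set (lsuc ℓ)
  Pair a b p = ∃ λ s → ∃ λ d → UPair a a s × UPair a b d × UPair s d p

  Triple : Ob → Ob → Ob → Ob → Set (lsuc ℓ)
  Triple a b c t = ∃ λ p → Pair b c p × Pair a p t

  _[_]≔_ : Ob → Ob → Ob → Set (lsuc ℓ)
  f [ a ]≔ b = ∃ λ p → Pair a b p × p ∈ f

  Functional : Ob → Set (lsuc ℓ)
  Functional f = ∀ a b c → f [ a ]≔ b → f [ a ]≔ c → b ≈ c

  record _∶_⟶_ (f A B : Ob) : Set (lsuc ℓ) where
    field
      graph      : ∀ p → p ∈ f → ∃ λ a → ∃ λ b → a ∈ A × b ∈ B × Pair a b p
      total      : ∀ a → a ∈ A → ∃ λ b → f [ a ]≔ b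
      functional : Functional f

  Injective : Ob → Set (lsuc ℓ)
  Injective f = ∀ a b c → f [ a ]≔ c → f [ b ]≔ c → a ≈ b

  IsBijection : Ob → Ob → Ob → Set (lsuc ℓ)
  IsBijection A B f =
    f ∶ A ⟶ B × Injective f × (∀ b → b ∈ B → ∃ λ a → f [ a ]≔ b)

  Range : Ob → Ob → Set (lsuc ℓ)
  Range f r = ∀ b → b ∈ r ⇔ (∃ λ a → f [ a ]≔ b)

  -- c = g ∘ f
  Composite : Ob → Ob → Ob → Set (lsuc ℓ)
  Composite g f c = ∀ p → p ∈ c ⇔
    (∃ λ a → ∃ λ b → ∃ λ d → f [ a ]≔ b × g [ b ]≔ d × Pair a d p)

  Complement : Ob → Ob → Ob → Set (lsuc ℓ)
  Complement S A B = ∀ z → z ∈ B ⇔ (z ∈ S × z ∉ A)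

  SymmetricDifference : Ob → Ob → Ob → Set (lsuc ℓ)
  SymmetricDifference A B D = ∀ z → z ∈ D ⇔ ((z ∈ A × z ∉ B) ⊎ (z ∈ B × z ∉ A))

  Union : Ob → Ob → Set (lsuc ℓ)
  Union C U = ∀ z → z ∈ U ⇔ (∃ λ A → A ∈ C × z ∈ A)

  -- |C| ≤ |A|
  _≼_ : Ob → Ob → Set (lsuc ℓ)
  C ≼ A = ∃ λ f → f ∶ C ⟶ A × Injective f

  Natural : Ob → Set (lsuc ℓ)
  Natural n = ∀ w → Inductive w → n ∈ w

  IsOmega : Ob → Set (lsuc ℓ)
  IsOmega ω = ∀ n → n ∈ ω ⇔ Natural n

  Infinite : Ob → Set (lsuc ℓ)
  Infinite A = ¬ (∃ λ n → Natural n × ∃ λ f → IsBijection n A f)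

  -- Well-foundedness of ∈ on an ordinal is the foundation axiom.
  IsOrdinal : Ob → Set (lsuc ℓ)
  IsOrdinal α = (∀ β → β ∈ α → β ⊆ α)
              × (∀ β γ → β ∈ α → γ ∈ α → β ∈ γ ⊎ β ≈ γ ⊎ γ ∈ β)

  Numeral : ℕ → Ob → Set (lsuc ℓ)
  Numeral zero    x = Empty x
  Numeral (suc k) x = ∃ λ y → Numeral k y × Succ y x

  -- t = ⟨k , x⟩; formal syntax is built from such tagged objects.
  Tag : ℕ → Ob → Ob → Set (lsuc ℓ)
  Tag k x t = ∃ λ c → Numeral k c × Pair c x t

  ----------------------------------------------------------------------
  -- Real numbers: a Dedekind-complete ordered field R in V, which is
  -- unique up to isomorphism in V.  The operations act on the elements
  -- of R, and their graphs (like that of the order) are sets in V.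

  record Reals : Set (lsuc ℓ) where
    field
      R add mul le : Ob

    El : Set (lsuc ℓ)
    El = Σ Ob (_∈ R)

    ⌊_⌋ : El → Ob
    ⌊_⌋ = proj₁

    infix 4 _≈ᴿ_ _≤ᴿ_ _<ᴿ_

    _≈ᴿ_ : El → El → Set ℓ
    x ≈ᴿ y = ⌊ x ⌋ ≈ ⌊ y ⌋

    _≤ᴿ_ : El → El → Set (lsuc ℓ)
    x ≤ᴿ y = ∃ λ p → Pair ⌊ x ⌋ ⌊ y ⌋ p × p ∈ le

    _<ᴿ_ : El → El → Set (lsuc ℓ)
    x <ᴿ y = x ≤ᴿ y × ¬ x ≈ᴿ y

    infixl 6 _+ᴿ_
    infixl 7 _*ᴿ_

    field
      _+ᴿ_ _*ᴿ_ : El → El → El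
      -ᴿ_       : El → El
      0ᴿ 1ᴿ     : El

      add-graph : ∀ x y z p → Pair ⌊ x ⌋ ⌊ y ⌋ p → add [ p ]≔ ⌊ z ⌋ ⇔ (x +ᴿ y ≈ᴿ z)
      mul-graph : ∀ x y z p → Pair ⌊ x ⌋ ⌊ y ⌋ p → mul [ p ]≔ ⌊ z ⌋ ⇔ (x *ᴿ y ≈ᴿ z)

      isCommutativeRing : IsCommutativeRing _≈ᴿ_ _+ᴿ_ _*ᴿ_ -ᴿ_ 0ᴿ 1ᴿ
      0≉1               : ¬ 0ᴿ ≈ᴿ 1ᴿ
      inverse           : ∀ x → ¬ x ≈ᴿ 0ᴿ → ∃ λ y → x *ᴿ y ≈ᴿ 1ᴿ
      isTotalOrder      : IsTotalOrder _≈ᴿ_ _≤ᴿ_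
      +-monoˡ           : ∀ x y z → x ≤ᴿ y → (x +ᴿ z) ≤ᴿ (y +ᴿ z)
      *-nonneg          : ∀ x y → 0ᴿ ≤ᴿ x → 0ᴿ ≤ᴿ y → 0ᴿ ≤ᴿ (x *ᴿ y)
      complete          : ∀ A → A ⊆ R → (∃ λ x → x ∈ A) →
                          (∃ λ (b : El) → ∀ (x : El) → ⌊ x ⌋ ∈ A → x ≤ᴿ b) →
                          ∃ λ (s : El) → (∀ (x : El) → ⌊ x ⌋ ∈ A → x ≤ᴿ s) ×
                            (∀ b → (∀ (x : El) → ⌊ x ⌋ ∈ A → x ≤ᴿ b) → s ≤ᴿ b)

    data FiniteSum (t : Ob → El → Set (lsuc ℓ)) : List Ob → El → Set (lsuc ℓ) where
      nil  : ∀ {s} → s ≈ᴿ 0ᴿ → FiniteSum t [] s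
      cons : ∀ {i is r s u} → t i r → FiniteSum t is s → u ≈ᴿ (r +ᴿ s) →
             FiniteSum t (i ∷ is) u

    -- u = Σ_{i ∈ I} t i for nonnegative terms: the supremum of the sums
    -- over finite subsets of I.  A transitive model has exactly the finite
    -- subsets of I that exist outside, so these are given by
    -- repetition-free lists.
    IsSum : Ob → (Ob → El → Set (lsuc ℓ)) → El → Set (lsuc ℓ)
    IsSum I t u = (∀ s → Partial s → s ≤ᴿ u)
                × (∀ v → (∀ s → Partial s → s ≤ᴿ v) → u ≤ᴿ v)
      where
      Partial : El → Set (lsuc ℓ)
      Partial s = ∃ λ is → All (_∈ I) is × AllPairs _≉_ is × FiniteSum t is s

  ----------------------------------------------------------------------
  -- Relational languages and structures.  A language is its arity
  -- function; an n-tuple from X is a function n ⟶ X.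

  IsLanguage : Ob → Set (lsuc ℓ)
  IsLanguage L = ∃ λ S → ∃ λ ω → IsOmega ω × L ∶ S ⟶ ω

  -- A structure with underlying set X sends each symbol R of arity n to a
  -- set of n-tuples from X.
  record IsStructure (X L M : Ob) : Set (lsuc ℓ) where
    field
      graph      : ∀ p → p ∈ M → ∃ λ R → ∃ λ n → ∃ λ P →
                   L [ R ]≔ n × (∀ a → a ∈ P → a ∶ n ⟶ X) × Pair R P p
      total      : ∀ R n → L [ R ]≔ n → ∃ λ P → M [ R ]≔ P
      functional : Functional M

  -- a belongs to the interpretation of R in M
  Realises : Ob → Ob → Ob → Set (lsuc ℓ)
  Realises M R a = ∃ λ P → M [ R ]≔ P × a ∈ P

  -- Atomic formulas v_i = v_j and R(v_{t(0)}, …, v_{t(k-1)}).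

  EqAtom : Ob → Ob → Ob → Set (lsuc ℓ)
  EqAtom i j φ = ∃ λ p → Pair i j p × Tag 0 p φ

  RelAtom : Ob → Ob → Ob → Set (lsuc ℓ)
  RelAtom R t φ = ∃ λ p → Pair R t p × Tag 1 p φ

  NegLiteral : Ob → Ob → Set (lsuc ℓ)
  NegLiteral = Tag 2

  record LiteralClosed (L n Λ : Ob) : Set (lsuc ℓ) where
    field
      equality : ∀ i j φ → i ∈ n → j ∈ n → EqAtom i j φ → φ ∈ Λ
      relation : ∀ R k t φ → L [ R ]≔ k → t ∶ k ⟶ n → RelAtom R t φ → φ ∈ Λ
      negation : ∀ φ ψ → φ ∈ Λ → NegLiteral φ ψ → ψ ∈ Λ

  -- φ is a literal in the variables v_0, …, v_{n-1}
  Literal : Ob → Ob → Ob → Set (lsuc ℓ)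
  Literal L n φ = ∀ Λ → LiteralClosed L n Λ → φ ∈ Λ

  -- Formal Borel codes

  BasicCode : Ob → Ob → Ob → Set (lsuc ℓ)
  BasicCode φ a γ = ∃ λ p → Pair φ a p × Tag 0 p γ

  NegCode ⋁Code ⋀Code : Ob → Ob → Set (lsuc ℓ)
  NegCode = Tag 1
  ⋁Code   = Tag 2
  ⋀Code   = Tag 3

  -- s is a finite sequence of literals in v_0, …, v_{n-1}, standing for
  -- their conjunction
  LiteralConjunction : Ob → Ob → Ob → Set (lsuc ℓ)
  LiteralConjunction L n s = ∃ λ k → ∃ λ Y → Natural k × s ∶ k ⟶ Y
                           × (∀ i φ → s [ i ]≔ φ → Literal L n φ)

  record CodeClosed (κ X L C : Ob) : Set (lsuc ℓ) where
    field
      basic    : ∀ n s a γ → Natural n → LiteralConjunction L n s →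
                 a ∶ n ⟶ X → BasicCode s a γ → γ ∈ C
      negation : ∀ γ δ → γ ∈ C → NegCode γ δ → δ ∈ C
      join     : ∀ f Γ δ → f ∶ κ ⟶ C → Range f Γ → ⋁Code Γ δ → δ ∈ C
      meet     : ∀ f Γ δ → f ∶ κ ⟶ C → Range f Γ → ⋀Code Γ δ → δ ∈ C

  ----------------------------------------------------------------------
  -- The objects determined by κ, X and L: the set Str of structures, the
  -- satisfaction relation for literals, the family 𝓑 of measurable sets,
  -- the set 𝔹 of codes, and the interpretation of codes.  Each is
  -- characterised uniquely in V, and exists there by ZFC.

  module _ (X L Str Sat : Ob) where

    _⊨_[_] : Ob → Ob → Ob → Set (lsuc ℓ)
    M ⊨ φ [ a ] = ∃ λ p → Triple φ a M p × p ∈ Sat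

    record IsSatisfaction : Set (lsuc ℓ) where
      field
        graph    : ∀ p → p ∈ Sat → ∃ λ n → ∃ λ φ → ∃ λ a → ∃ λ M →
                   Natural n × Literal L n φ × a ∶ n ⟶ X × M ∈ Str ×
                   Triple φ a M p
        equality : ∀ n a M i j φ → Natural n → a ∶ n ⟶ X → M ∈ Str →
                   i ∈ n → j ∈ n → EqAtom i j φ →
                   M ⊨ φ [ a ] ⇔ (∃ λ x → a [ i ]≔ x × a [ j ]≔ x)
        relation : ∀ n a M R k t φ → Natural n → a ∶ n ⟶ X → M ∈ Str →
                   L [ R ]≔ k → t ∶ k ⟶ n → RelAtom R t φ →
                   M ⊨ φ [ a ] ⇔ (∃ λ b → Composite a t b × Realises M R b)
        negation : ∀ n a M φ ψ → Natural n → a ∶ n ⟶ X → M ∈ Str →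
                   Literal L n φ → NegLiteral φ ψ →
                   M ⊨ ψ [ a ] ⇔ (¬ M ⊨ φ [ a ])

    record SigmaClosed (κ F : Ob) : Set (lsuc ℓ) where
      field
        subsets    : ∀ A → A ∈ F → A ⊆ Str
        literal    : ∀ n φ a A → Natural n → Literal L n φ → a ∶ n ⟶ X →
                     (∀ M → M ∈ A ⇔ (M ∈ Str × M ⊨ φ [ a ])) → A ∈ F
        complement : ∀ A B → A ∈ F → Complement Str A B → B ∈ F
        union      : ∀ C U → C ⊆ F → C ≼ κ → Union C U → U ∈ F

    record IsInterpretation (𝔹 Int : Ob) : Set (lsuc ℓ) where
      field
        function : ∃ λ P → (∀ A → A ∈ P ⇔ A ⊆ Str) × Int ∶ 𝔹 ⟶ P
        basic    : ∀ n s a γ A → Natural n → LiteralConjunction L n s →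
                   a ∶ n ⟶ X → BasicCode s a γ → Int [ γ ]≔ A →
                   ∀ M → M ∈ A ⇔ (M ∈ Str × (∀ i φ → s [ i ]≔ φ → M ⊨ φ [ a ]))
        negation : ∀ γ δ A B → NegCode γ δ → Int [ γ ]≔ A → Int [ δ ]≔ B →
                   Complement Str A B
        join     : ∀ Γ δ B → ⋁Code Γ δ → Int [ δ ]≔ B →
                   ∀ M → M ∈ B ⇔ (∃ λ γ → ∃ λ A → γ ∈ Γ × Int [ γ ]≔ A × M ∈ A)
        meet     : ∀ Γ δ B → ⋀Code Γ δ → Int [ δ ]≔ B →
                   ∀ M → M ∈ B ⇔
                   (M ∈ Str × (∀ γ A → γ ∈ Γ → Int [ γ ]≔ A → M ∈ A))

  record BorelStructures (κ X L : Ob) : Set (lsuc ℓ) where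
    field
      Str Sat 𝓑 𝔹 Int  : Ob
      structures       : ∀ M → M ∈ Str ⇔ IsStructure X L M
      satisfaction     : IsSatisfaction X L Str Sat
      measurable       : SigmaClosed X L Str Sat κ 𝓑
      measurable-least : ∀ F → SigmaClosed X L Str Sat κ F → 𝓑 ⊆ F
      codes            : CodeClosed κ X L 𝔹
      codes-least      : ∀ C → CodeClosed κ X L C → 𝔹 ⊆ C
      interpretation   : IsInterpretation X L Str Sat 𝔹 Int

  ----------------------------------------------------------------------
  -- Generic filters over V on the preorder of those x in V with P x.
  -- A filter is a set of the ambient universe and need not lie in V.

  module Forcing (P : Ob → Set (lsuc ℓ)) (_≼_ : Ob → Ob → Set (lsuc ℓ)) where

    Dense : Ob → Set (lsuc ℓ)
    Dense D = (∀ q → q ∈ D → P q) × (∀ p → P p → ∃ λ q → q ∈ D × q ≼ p)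

    record IsGenericFilter (G : 𝕍 ℓ) : Set (lsuc ℓ) where
      field
        conditions : ∀ x → x ∈ᵁ G → ∃ λ (p : Ob) → x ≈ᵁ proj₁ p × P p
        nonempty   : ∃ λ (p : Ob) → proj₁ p ∈ᵁ G
        upward     : ∀ (p q : Ob) → proj₁ p ∈ᵁ G → P q → p ≼ q → proj₁ q ∈ᵁ G
        directed   : ∀ (p q : Ob) → proj₁ p ∈ᵁ G → proj₁ q ∈ᵁ G →
                     ∃ λ (r : Ob) → proj₁ r ∈ᵁ G × r ≼ p × r ≼ q
        generic    : ∀ (D : Ob) → Dense D →
                     ∃ λ (p : Ob) → p ∈ D × proj₁ p ∈ᵁ G

  ----------------------------------------------------------------------
  -- Measures on Str

  module Measures (κ X L : Ob) (𝓢 : BorelStructures κ X L) (ℝ : Reals) where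
    open BorelStructures 𝓢
    open Reals ℝ

    Additive : Ob → Ob → Set (lsuc ℓ)
    Additive I μ =
      ∀ A U → A ∶ I ⟶ 𝓑 →
      (∀ i j B C → i ≉ j → A [ i ]≔ B → A [ j ]≔ C → ∀ M → ¬ (M ∈ B × M ∈ C)) →
      (∀ M → M ∈ U ⇔ (∃ λ i → ∃ λ B → A [ i ]≔ B × M ∈ B)) →
      ∃ λ (u : El) → μ [ U ]≔ ⌊ u ⌋
        × IsSum I (λ i r → ∃ λ B → A [ i ]≔ B × μ [ B ]≔ ⌊ r ⌋) u

    record IsProbabilityMeasure (μ : Ob) : Set (lsuc ℓ) where
      field
        function : μ ∶ 𝓑 ⟶ R
        nonneg   : ∀ A (r : El) → μ [ A ]≔ ⌊ r ⌋ → 0ᴿ ≤ᴿ r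
        empty    : ∀ E → Empty E → μ [ E ]≔ ⌊ 0ᴿ ⌋
        whole    : μ [ Str ]≔ ⌊ 1ᴿ ⌋
        additive : ∀ ω → IsOmega ω → Additive ω μ

    IsProbabilityκMeasure : Ob → Set (lsuc ℓ)
    IsProbabilityκMeasure μ = IsProbabilityMeasure μ × Additive κ μ

    -- N = gM
    Translate : Ob → Ob → Ob → Set (lsuc ℓ)
    Translate g M N = N ∈ Str ×
      (∀ R n a b → L [ R ]≔ n → a ∶ n ⟶ X → Composite g a b →
        Realises N R b ⇔ Realises M R a)

    -- B = g[A]
    TranslateSet : Ob → Ob → Ob → Set (lsuc ℓ)
    TranslateSet g A B = ∀ N → N ∈ B ⇔ (∃ λ M → M ∈ A × Translate g M N)

    IsInvariant : Ob → Set (lsuc ℓ)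
    IsInvariant μ = ∀ g A B r → IsBijection X X g → A ∈ 𝓑 →
      TranslateSet g A B → μ [ A ]≔ r → μ [ B ]≔ r

    IsErgodic : Ob → Set (lsuc ℓ)
    IsErgodic μ = ∀ A → A ∈ 𝓑 →
      (∀ g B D → IsBijection X X g → TranslateSet g A B →
        SymmetricDifference B A D → μ [ D ]≔ ⌊ 0ᴿ ⌋) →
      μ [ A ]≔ ⌊ 0ᴿ ⌋ ⊎ μ [ A ]≔ ⌊ 1ᴿ ⌋

    IsErgodicInvariantMeasure : Ob → Set (lsuc ℓ)
    IsErgodicInvariantMeasure μ =
      IsProbabilityκMeasure μ × IsInvariant μ × IsErgodic μ

    -- μ(γ) = r for a code γ
    CodeMeasure : Ob → Ob → El → Set (lsuc ℓ)
    CodeMeasure μ γ r = ∃ λ A → Int [ γ ]≔ A × μ [ A ]≔ ⌊ r ⌋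

    Positive : Ob → Ob → Set (lsuc ℓ)
    Positive μ γ = γ ∈ 𝔹 × ∃ λ r → CodeMeasure μ γ r × 0ᴿ <ᴿ r

    -- μ(γ ∧ ¬ζ) = 0, where γ ∧ ¬ζ is the code ⋀{γ , ¬ζ}
    Below : Ob → Ob → Ob → Set (lsuc ℓ)
    Below μ γ ζ = ∃ λ ν → ∃ λ Γ → ∃ λ δ →
      NegCode ζ ν × UPair γ ν Γ × ⋀Code Γ δ × CodeMeasure μ δ 0ᴿ

    -- G is a μ-random generic filter over V
    IsRandomGeneric : Ob → 𝕍 ℓ → Set (lsuc ℓ)
    IsRandomGeneric μ = Forcing.IsGenericFilter (Positive μ) (Below μ)

module Submission where

-- Distinct ergodic invariant measures μ and ν are mutually singular.  Call a
-- measurable set "below" if μ ≤ ν on all its measurable subsets.  Exhausting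
-- Str by such sets gives one, A, that is maximal modulo ν-null sets; its
-- translates are below too, so A is almost invariant for both measures and
-- both give it measure 0 or 1.  If μ(B) < ν(B), exhausting B by sets on which
-- ν ≤ μ leaves a below set of positive ν-measure, so ν(A) = 1; and μ(A) = 1
-- would give μ ≥ ν on B, by comparing complements.  Hence μ(A) = 0.
-- The ν-positive codes inside A are dense for ν, so a filter generic for both
-- measures would contain one of them, although it is μ-null.

-- All constructions take place inside V, where a subset exists only if a formula defines it,
-- whereas measures are handled as functions into an ordered group. Two bridges join these views:
-- each predicate used in separation carries a formula (`Definable`), and each fact about values
-- that a formula must mention, such as a comparison, is first turned into a set. Membership of V is
-- well-founded, so its ω consists of the standard numerals, and sequences may be indexed by ℕ as
-- long as their graphs lie in V (`Internal`). The exhaustion stands in for a Hahn decomposition of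
-- ν - μ. It uses only addition, order and halves; the factor two is the price of suprema that need
-- not be attained. Ergodicity of both measures is applied to the same set A, so A must be almost
-- invariant for both; this works because a ν-null below set is also μ-null. Distinctness yields a
-- failing inequality in one direction or the other, and the two cases differ by exchanging μ and ν.
-- Conditions are codes and not sets, so A needs a code before density can be argued.

open import Defs
open import Level using (Level; Lift; lift; lower; _⊔_) renaming (suc to lsuc)
open import Axiom.ExcludedMiddle using (ExcludedMiddle)
open import Data.Empty using (⊥)
open import Data.Fin.Base using (Fin; zero; suc; _↑ˡ_; _↑ʳ_)
open import Data.Nat.Base as ℕ using (ℕ; zero; suc; s≤s; z≤n)
import Data.Nat.Properties as ℕₚ
open import Data.Product using (Σ; ∃; ∃!; _×_; _,_; proj₁; proj₂)
open import Data.Sum.Base using (_⊎_; inj₁; inj₂; [_,_]′)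
open import Data.Unit.Polymorphic.Base using (⊤; tt)
open import Data.Vec.Base using (Vec; []; _∷_; _++_; lookup)
open import Data.Vec.Properties using (lookup-++ˡ; lookup-++ʳ)
open import Function.Base using (_∘_; id; case_of_)
open import Function.Bundles using (_⇔_; mk⇔; Equivalence)
open import Induction.WellFounded using (Acc; acc; WellFounded)
import Relation.Binary.Construct.On as On
open import Relation.Binary.PropositionalEquality.Core as ≡ using (_≡_; refl)
open import Relation.Nullary.Decidable.Core using (Dec; yes; no; map′; decidable-stable)
open import Relation.Nullary.Negation.Core using (¬_; contradiction)
open import Relation.Binary.Definitions using (tri<; tri≈; tri>)
open import Algebra.Bundles using (Ring)
import Algebra.Properties.Ring as RingProperties
open import Algebra.Structures using (IsAbelianGroup; IsCommutativeRing)
open import Data.List.Base using (List; []; _∷_)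
open import Data.List.Relation.Unary.All as All using (All; []; _∷_; zipWith)
open import Data.List.Relation.Unary.AllPairs using (AllPairs; []; _∷_)
open import Relation.Binary.Structures using (IsTotalOrder)
open Equivalence using (to; from)

-- Definable predicates

-- Membership and equality are variables here rather than the recursive
-- functions of Defs, so that Agda can infer sets from statements about them.
-- The set-theoretic notions repeated below become definitionally equal to
-- those of Defs when the module is applied to a class of sets.
module Language {ℓ : Level} (Ob : Set (lsuc ℓ)) (_≈_ _∈_ : Ob → Ob → Set ℓ) where

  Env : ℕ → Set (lsuc ℓ)
  Env zero    = ⊤
  Env (suc n) = Ob × Env n

  look : ∀ {n} → Fin n → Env n → Ob
  look zero    ρ = proj₁ ρ
  look (suc i) ρ = look i (proj₂ ρ)

  -- Terms are indexed by their values, so that weakening preserves values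
  -- definitionally.
  data Term {n} : (Env n → Ob) → Set (lsuc ℓ) where
    var : ∀ i → Term (look i)
    con : ∀ c → Term (λ _ → c)

  wk : ∀ {n f} → Term {n} f → Term {suc n} (λ ρ → f (proj₂ ρ))
  wk (var i) = var (suc i)
  wk (con c) = con c

  data Fm (n : ℕ) : Set (lsuc ℓ) where
    mem eq      : ∀ {f g} → Term {n} f → Term {n} g → Fm n
    bot         : Fm n
    and or imp  : Fm n → Fm n → Fm n
    all ex      : Fm (suc n) → Fm n

  Sat : ∀ {n} → Fm n → Env n → Set (lsuc ℓ)
  Sat (mem {f} {g} _ _) ρ = Lift (lsuc ℓ) (f ρ ∈ g ρ)
  Sat (eq {f} {g} _ _)  ρ = Lift (lsuc ℓ) (f ρ ≈ g ρ)
  Sat bot               ρ = Lift (lsuc ℓ) ⊥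
  Sat (and φ ψ)         ρ = Sat φ ρ × Sat ψ ρ
  Sat (or φ ψ)          ρ = Sat φ ρ ⊎ Sat ψ ρ
  Sat (imp φ ψ)         ρ = Sat φ ρ → Sat ψ ρ
  Sat (all φ)           ρ = ∀ x → Sat φ (x , ρ)
  Sat (ex φ)            ρ = ∃ λ x → Sat φ (x , ρ)

  -- The formula is tied to `P` by implications both ways and not by an identity of types, so `P`
  -- may live at any level and may be stated with records such as `⇔` or `Map`.
  record Definable {p n} (P : Env n → Set p) : Set (lsuc ℓ ⊔ p) where
    constructor definable
    field
      formula  : Fm n
      holds    : ∀ ρ → Sat formula ρ → P ρ
      captures : ∀ ρ → P ρ → Sat formula ρ

  open Definable public

  infix  4 _∈ᵈ_ _≈ᵈ_
  infix  3 ¬ᵈ_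
  infixr 1 _⇔ᵈ_

  _∈ᵈ_ : ∀ {n f g} → Term {n} f → Term {n} g → Definable (λ ρ → f ρ ∈ g ρ)
  s ∈ᵈ t = definable (mem s t) (λ _ → lower) (λ _ → lift)

  _≈ᵈ_ : ∀ {n f g} → Term {n} f → Term {n} g → Definable (λ ρ → f ρ ≈ g ρ)
  s ≈ᵈ t = definable (eq s t) (λ _ → lower) (λ _ → lift)

  ⊥ᵈ : ∀ {n} → Definable {n = n} (λ _ → ⊥)
  ⊥ᵈ = definable bot (λ _ → lower) (λ _ → lift)

  module _ {p q n} {P : Env n → Set p} {Q : Env n → Set q} where

    infixr 3 _×ᵈ_
    infixr 2 _⊎ᵈ_
    infixr 1 _→ᵈ_

    _×ᵈ_ : Definable P → Definable Q → Definable (λ ρ → P ρ × Q ρ)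
    d ×ᵈ e = definable (and (formula d) (formula e))
      (λ ρ (x , y) → holds d ρ x , holds e ρ y)
      (λ ρ (x , y) → captures d ρ x , captures e ρ y)

    _⊎ᵈ_ : Definable P → Definable Q → Definable (λ ρ → P ρ ⊎ Q ρ)
    d ⊎ᵈ e = definable (or (formula d) (formula e))
      (λ ρ → [ inj₁ ∘ holds d ρ , inj₂ ∘ holds e ρ ]′)
      (λ ρ → [ inj₁ ∘ captures d ρ , inj₂ ∘ captures e ρ ]′)

    _→ᵈ_ : Definable P → Definable Q → Definable (λ ρ → P ρ → Q ρ)
    d →ᵈ e = definable (imp (formula d) (formula e))
      (λ ρ h x → holds e ρ (h (captures d ρ x)))
      (λ ρ h x → captures e ρ (h (holds d ρ x)))

  _⇔ᵈ_ : ∀ {p q n} {P : Env n → Set p} {Q : Env n → Set q} →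
         Definable P → Definable Q → Definable (λ ρ → P ρ ⇔ Q ρ)
  d ⇔ᵈ e = definable (formula both)
    (λ ρ s → mk⇔ (proj₁ (holds both ρ s)) (proj₂ (holds both ρ s)))
    (λ ρ h → captures both ρ (to h , from h))
    where both = (d →ᵈ e) ×ᵈ (e →ᵈ d)

  -- Quantifying over terms makes one definability proof usable in every context: the subject may be
  -- a constant, or a variable under any number of binders.
  Definable₁ : ∀ {p} → (Ob → Set p) → Set (lsuc ℓ ⊔ p)
  Definable₁ P = ∀ {n f} → Term {n} f → Definable {n = n} (λ ρ → P (f ρ))

  Definable₂ : ∀ {p} → (Ob → Ob → Set p) → Set (lsuc ℓ ⊔ p)
  Definable₂ P = ∀ {n f g} → Term {n} f → Term {n} g → Definable {n = n} (λ ρ → P (f ρ) (g ρ))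

  ¬ᵈ_ : ∀ {p n} {P : Env n → Set p} → Definable P → Definable (λ ρ → ¬ P ρ)
  ¬ᵈ d = d →ᵈ ⊥ᵈ

  module _ {p n} {P : Env n → Ob → Set p} where

    ∀ᵈ : Definable {n = suc n} (λ ρ → P (proj₂ ρ) (proj₁ ρ)) →
         Definable (λ ρ → ∀ x → P ρ x)
    ∀ᵈ d = definable (all (formula d))
      (λ ρ h x → holds d (x , ρ) (h x)) (λ ρ h x → captures d (x , ρ) (h x))

    ∃ᵈ : Definable {n = suc n} (λ ρ → P (proj₂ ρ) (proj₁ ρ)) →
         Definable (λ ρ → ∃ (P ρ))
    ∃ᵈ d = definable (ex (formula d))
      (λ ρ (x , h) → x , holds d (x , ρ) h) (λ ρ (x , h) → x , captures d (x , ρ) h)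

  pattern v₀ = var zero
  pattern v₁ = var (suc zero)
  pattern v₂ = var (suc (suc zero))
  pattern v₃ = var (suc (suc (suc zero)))
  pattern v₄ = var (suc (suc (suc (suc zero))))

  -- Basic set-theoretic notions and their definability

  infix 4 _⊆_ _≉_ _∉_

  _≉_ _∉_ : Ob → Ob → Set ℓ
  x ≉ y = ¬ x ≈ y
  x ∉ y = ¬ x ∈ y

  _⊆_ : Ob → Ob → Set (lsuc ℓ)
  x ⊆ y = ∀ z → z ∈ x → z ∈ y

  Empty : Ob → Set (lsuc ℓ)
  Empty e = ∀ x → ¬ x ∈ e

  Succ : Ob → Ob → Set (lsuc ℓ)
  Succ x y = ∀ z → z ∈ y ⇔ (z ∈ x ⊎ z ≈ x)

  Inductive : Ob → Set (lsuc ℓ)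
  Inductive w = (∀ e → Empty e → e ∈ w) × (∀ x y → x ∈ w → Succ x y → y ∈ w)

  Natural : Ob → Set (lsuc ℓ)
  Natural n = ∀ w → Inductive w → n ∈ w

  UPair : Ob → Ob → Ob → Set (lsuc ℓ)
  UPair a b p = ∀ z → z ∈ p ⇔ (z ≈ a ⊎ z ≈ b)

  Pair : Ob → Ob → Ob → Set (lsuc ℓ)
  Pair a b p = ∃ λ s → ∃ λ d → UPair a a s × UPair a b d × UPair s d p

  _[_]≔_ : Ob → Ob → Ob → Set (lsuc ℓ)
  f [ a ]≔ b = ∃ λ p → Pair a b p × p ∈ f

  Composite : Ob → Ob → Ob → Set (lsuc ℓ)
  Composite g f c = ∀ p → p ∈ c ⇔
    (∃ λ a → ∃ λ b → ∃ λ d → (f [ a ]≔ b) × (g [ b ]≔ d) × Pair a d p)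

  Realises : Ob → Ob → Ob → Set (lsuc ℓ)
  Realises M R a = ∃ λ P → (M [ R ]≔ P) × a ∈ P

  record Map (f A B : Ob) : Set (lsuc ℓ) where
    field
      graph      : ∀ p → p ∈ f → ∃ λ a → ∃ λ b → a ∈ A × b ∈ B × Pair a b p
      total      : ∀ a → a ∈ A → ∃ λ b → f [ a ]≔ b
      functional : ∀ a b c → f [ a ]≔ b → f [ a ]≔ c → b ≈ c

  Range : Ob → Ob → Set (lsuc ℓ)
  Range f r = ∀ b → b ∈ r ⇔ (∃ λ a → f [ a ]≔ b)

  Union : Ob → Ob → Set (lsuc ℓ)
  Union C U = ∀ z → z ∈ U ⇔ (∃ λ A → A ∈ C × z ∈ A)

  Numeral : ℕ → Ob → Set (lsuc ℓ)
  Numeral zero    x = Empty x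
  Numeral (suc k) x = ∃ λ y → Numeral k y × Succ y x

  Tag : ℕ → Ob → Ob → Set (lsuc ℓ)
  Tag k x t = ∃ λ c → Numeral k c × Pair c x t

  IsInjective : Ob → Set (lsuc ℓ)
  IsInjective f = ∀ a b c → f [ a ]≔ c → f [ b ]≔ c → a ≈ b

  module _ {n : ℕ} where

    infix 4 _⊆ᵈ_

    _⊆ᵈ_ : ∀ {f g} → Term {n} f → Term {n} g → Definable (λ ρ → f ρ ⊆ g ρ)
    a ⊆ᵈ b = ∀ᵈ (v₀ ∈ᵈ wk a →ᵈ v₀ ∈ᵈ wk b)

    Emptyᵈ : ∀ {f} → Term {n} f → Definable (λ ρ → Empty (f ρ))
    Emptyᵈ e = ∀ᵈ (¬ᵈ (v₀ ∈ᵈ wk e))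

    Succᵈ : ∀ {f g} → Term {n} f → Term {n} g → Definable (λ ρ → Succ (f ρ) (g ρ))
    Succᵈ x y = ∀ᵈ (v₀ ∈ᵈ wk y ⇔ᵈ v₀ ∈ᵈ wk x ⊎ᵈ v₀ ≈ᵈ wk x)

    UPairᵈ : ∀ {f g h} → Term {n} f → Term {n} g → Term {n} h →
             Definable (λ ρ → UPair (f ρ) (g ρ) (h ρ))
    UPairᵈ a b p = ∀ᵈ (v₀ ∈ᵈ wk p ⇔ᵈ v₀ ≈ᵈ wk a ⊎ᵈ v₀ ≈ᵈ wk b)

  -- Inside one such block `n` is fixed, while the preceding predicates are now needed under further
  -- binders; hence the repeated blocks.
  module _ {n : ℕ} where

    Inductiveᵈ : ∀ {f} → Term {n} f → Definable (λ ρ → Inductive (f ρ))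
    Inductiveᵈ w = ∀ᵈ (Emptyᵈ v₀ →ᵈ v₀ ∈ᵈ wk w)
                 ×ᵈ ∀ᵈ (∀ᵈ (v₁ ∈ᵈ wk (wk w) →ᵈ Succᵈ v₁ v₀ →ᵈ v₀ ∈ᵈ wk (wk w)))

    Pairᵈ : ∀ {f g h} → Term {n} f → Term {n} g → Term {n} h →
            Definable (λ ρ → Pair (f ρ) (g ρ) (h ρ))
    Pairᵈ a b p = ∃ᵈ (∃ᵈ (UPairᵈ (wk (wk a)) (wk (wk a)) v₁
                ×ᵈ UPairᵈ (wk (wk a)) (wk (wk b)) v₀ ×ᵈ UPairᵈ v₁ v₀ (wk (wk p))))

  module _ {n : ℕ} where

    Naturalᵈ : ∀ {f} → Term {n} f → Definable (λ ρ → Natural (f ρ))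
    Naturalᵈ x = ∀ᵈ (Inductiveᵈ v₀ →ᵈ wk x ∈ᵈ v₀)

    infix 4 _[_]≔ᵈ_

    _[_]≔ᵈ_ : ∀ {f g h} → Term {n} f → Term {n} g → Term {n} h →
              Definable (λ ρ → f ρ [ g ρ ]≔ h ρ)
    f [ a ]≔ᵈ b = ∃ᵈ (Pairᵈ (wk a) (wk b) v₀ ×ᵈ v₀ ∈ᵈ wk f)

  module _ {n : ℕ} where

    Compositeᵈ : ∀ {f g h} → Term {n} f → Term {n} g → Term {n} h →
                 Definable (λ ρ → Composite (f ρ) (g ρ) (h ρ))
    Compositeᵈ g f c = ∀ᵈ (v₀ ∈ᵈ wk c ⇔ᵈ ∃ᵈ (∃ᵈ (∃ᵈ
      ( wk (wk (wk (wk f))) [ v₂ ]≔ᵈ v₁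
      ×ᵈ wk (wk (wk (wk g))) [ v₁ ]≔ᵈ v₀ ×ᵈ Pairᵈ v₂ v₀ v₃))))

    Realisesᵈ : ∀ {f g h} → Term {n} f → Term {n} g → Term {n} h →
                Definable (λ ρ → Realises (f ρ) (g ρ) (h ρ))
    Realisesᵈ M R a = ∃ᵈ (wk M [ wk R ]≔ᵈ v₀ ×ᵈ wk a ∈ᵈ v₀)

  -- Parameters of separation are the constants `con` of the formula, so a single free variable
  -- suffices. Foundation is stated as well-foundedness of membership, which permits recursion on
  -- `Acc`.
  record Axioms : Set (lsuc ℓ) where
    field
      ≈-refl      : ∀ {x} → x ≈ x
      ≈-sym       : ∀ {x y} → x ≈ y → y ≈ x
      ≈-trans     : ∀ {x y z} → x ≈ y → y ≈ z → x ≈ z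
      ∈-resp      : ∀ {x x′ y y′} → x ≈ x′ → y ≈ y′ → x ∈ y → x′ ∈ y′
      ∈-wf        : WellFounded _∈_
      ext         : ∀ {x y} → (∀ z → z ∈ x ⇔ z ∈ y) → x ≈ y
      pairing     : ∀ a b → ∃ λ p → ∀ z → z ∈ p ⇔ (z ≈ a ⊎ z ≈ b)
      union       : ∀ a → ∃ λ u → ∀ z → z ∈ u ⇔ (∃ λ x → x ∈ a × z ∈ x)
      power       : ∀ a → ∃ λ p → ∀ z → z ∈ p ⇔ z ⊆ a
      infinity    : ∃ λ w → Inductive w
      separation  : (φ : Fm 1) → ∀ a → ∃ λ b → ∀ x →
                    x ∈ b ⇔ (x ∈ a × Sat φ (x , tt))
      choice      : ∀ a → (∀ x → x ∈ a → ∃ λ z → z ∈ x) →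
                    (∀ x y z → x ∈ a → y ∈ a → z ∈ x → z ∈ y → x ≈ y) →
                    ∃ λ c → ∀ x → x ∈ a → ∃! _≈_ λ z → z ∈ x × z ∈ c

  -- Pairs, products, relations and choice in the model

  module Theory (em : ExcludedMiddle (lsuc ℓ)) (ax : Axioms) where
    open Axioms ax

    em₀ : ExcludedMiddle ℓ
    em₀ = map′ lower lift em

    infix 4 _≋_

    _≋_ : ∀ {n} → Env n → Env n → Set ℓ
    _≋_ {zero}  _ _ = ⊤
    _≋_ {suc n} ρ σ = proj₁ ρ ≈ proj₁ σ × proj₂ ρ ≋ proj₂ σ

    ≋-sym : ∀ {n} {ρ σ : Env n} → _≋_ {n} ρ σ → _≋_ {n} σ ρ
    ≋-sym {zero}  _       = tt
    ≋-sym {suc n} (p , q) = ≈-sym p , ≋-sym {n} q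

    Term-cong : ∀ {n} {f : Env n → Ob} {ρ σ : Env n} → Term {n} f → _≋_ {n} ρ σ → f ρ ≈ f σ
    Term-cong (var zero)    h = proj₁ h
    Term-cong (var (suc i)) h = Term-cong (var i) (proj₂ h)
    Term-cong (con c)       h = ≈-refl

    Sat-resp : ∀ {n} (φ : Fm n) {ρ σ : Env n} → _≋_ {n} ρ σ → Sat φ ρ → Sat φ σ
    Sat-resp (mem s t) h (lift x)  = lift (∈-resp (Term-cong s h) (Term-cong t h) x)
    Sat-resp (eq s t)  h (lift x)  =
      lift (≈-trans (≈-sym (Term-cong s h)) (≈-trans x (Term-cong t h)))
    Sat-resp bot       h (lift ())
    Sat-resp (and φ ψ) h (x , y)   = Sat-resp φ h x , Sat-resp ψ h y
    Sat-resp (or φ ψ)  h (inj₁ x)  = inj₁ (Sat-resp φ h x)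
    Sat-resp (or φ ψ)  h (inj₂ y)  = inj₂ (Sat-resp ψ h y)
    Sat-resp {n} (imp φ ψ) h f x       = Sat-resp ψ h (f (Sat-resp φ (≋-sym {n} h) x))
    Sat-resp (all φ)   h f x       = Sat-resp φ (≈-refl , h) (f x)
    Sat-resp (ex φ)    h (x , y)   = x , Sat-resp φ (≈-refl , h) y

    -- Formulas cannot distinguish equal sets (`Sat-resp`), so every definable notion can be
    -- transported along `≈` without an argument of its own.
    respects : ∀ {p n} {P : Env n → Set p} → Definable P →
               ∀ {ρ σ : Env n} → _≋_ {n} ρ σ → P ρ → P σ
    respects d {ρ} {σ} h x = holds d σ (Sat-resp (formula d) h (captures d ρ x))

    separate : ∀ {p} (P : Ob → Set p) → Definable₁ P →
               ∀ a → ∃ λ b → ∀ x → x ∈ b ⇔ (x ∈ a × P x)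
    separate P d a = let b , h = separation (formula (d v₀)) a in b , λ x → mk⇔
      (λ q → proj₁ (to (h x) q) , holds (d v₀) _ (proj₂ (to (h x) q)))
      (λ (q , r) → from (h x) (q , captures (d v₀) _ r))

    ⊆-antisym : ∀ {x y} → x ⊆ y → y ⊆ x → x ≈ y
    ⊆-antisym h k = ext λ z → mk⇔ (h z) (k z)

    ≈⇒⊆ : ∀ {x y} → x ≈ y → x ⊆ y
    ≈⇒⊆ h z = ∈-resp ≈-refl h

    ∈-irrefl : ∀ {x} → x ∉ x
    ∈-irrefl {x} = go (∈-wf x)
      where
      go : ∀ {x} → Acc _∈_ x → x ∉ x
      go (acc r) h = go (r h) h

    ∈-asym : ∀ {x y} → x ∈ y → y ∉ x
    ∈-asym {x} = go (∈-wf x)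
      where
      go : ∀ {x y} → Acc _∈_ x → x ∈ y → y ∉ x
      go (acc r) h k = go (r k) k h

    ∅ : Ob
    ∅ = proj₁ (separate (λ _ → ⊥) (λ _ → ⊥ᵈ) (proj₁ infinity))

    ∅-empty : Empty ∅
    ∅-empty x h = proj₂ (to (proj₂ (separate (λ _ → ⊥) (λ _ → ⊥ᵈ) (proj₁ infinity)) x) h)

    Empty⇒≈∅ : ∀ {e} → Empty e → e ≈ ∅
    Empty⇒≈∅ h = ⊆-antisym (λ z q → contradiction q (h z)) (λ z q → contradiction q (∅-empty z))

    ⦅_,_⦆ : Ob → Ob → Ob
    ⦅ a , b ⦆ = proj₁ (pairing a b)

    ⦅⦆-isUPair : ∀ a b → UPair a b ⦅ a , b ⦆
    ⦅⦆-isUPair a b = proj₂ (pairing a b)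

    UPair-unique : ∀ {a b p q} → UPair a b p → UPair a b q → p ≈ q
    UPair-unique h k = ⊆-antisym (λ z → from (k z) ∘ to (h z)) (λ z → from (h z) ∘ to (k z))

    ⟨_,_⟩ : Ob → Ob → Ob
    ⟨ a , b ⟩ = ⦅ ⦅ a , a ⦆ , ⦅ a , b ⦆ ⦆

    ⟨⟩-isPair : ∀ a b → Pair a b ⟨ a , b ⟩
    ⟨⟩-isPair a b = _ , _ , ⦅⦆-isUPair a a , ⦅⦆-isUPair a b , ⦅⦆-isUPair _ _

    Pair-unique : ∀ {a b p q} → Pair a b p → Pair a b q → p ≈ q
    Pair-unique {p = p} (s , d , hs , hd , hp) (s′ , d′ , hs′ , hd′ , hq) =
      UPair-unique hp
        (respects (UPairᵈ v₀ v₁ v₂)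
          (UPair-unique hs′ hs , UPair-unique hd′ hd , ≈-refl , tt) hq)

    Pair-resp : ∀ {a a′ b b′ p p′} → a ≈ a′ → b ≈ b′ → p ≈ p′ → Pair a b p → Pair a′ b′ p′
    Pair-resp h k l = respects (Pairᵈ v₀ v₁ v₂) (h , k , l , tt)

    Pair-injective : ∀ {a b c d p} → Pair a b p → Pair c d p → a ≈ c × b ≈ d
    Pair-injective {a} {b} {c} {d} {p} (s , t , hs , ht , hp) (s′ , t′ , hs′ , ht′ , hp′) =
      a≈c , second b∈ d∈
      where
      single : ∀ {x} → x ∈ s → x ≈ a
      single = [ id , id ]′ ∘ to (hs _)
      c∈s : c ∈ s
      c∈s with to (hp′ s) (from (hp s) (inj₁ ≈-refl))
      ... | inj₁ e = ∈-resp ≈-refl (≈-sym e) (from (hs′ c) (inj₁ ≈-refl))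
      ... | inj₂ e = ∈-resp ≈-refl (≈-sym e) (from (ht′ c) (inj₁ ≈-refl))
      a≈c : a ≈ c
      a≈c = ≈-sym (single c∈s)
      b∈ : b ≈ c ⊎ b ≈ d
      b∈ with to (hp′ t) (from (hp t) (inj₂ ≈-refl))
      ... | inj₁ e = inj₁ ([ id , id ]′ (to (hs′ b) (∈-resp ≈-refl e (from (ht b) (inj₂ ≈-refl)))))
      ... | inj₂ e = to (ht′ b) (∈-resp ≈-refl e (from (ht b) (inj₂ ≈-refl)))
      d∈ : d ≈ a ⊎ d ≈ b
      d∈ with to (hp t′) (from (hp′ t′) (inj₂ ≈-refl))
      ... | inj₁ e = inj₁ (single (∈-resp ≈-refl e (from (ht′ d) (inj₂ ≈-refl))))
      ... | inj₂ e = to (ht d) (∈-resp ≈-refl e (from (ht′ d) (inj₂ ≈-refl)))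
      second : b ≈ c ⊎ b ≈ d → d ≈ a ⊎ d ≈ b → b ≈ d
      second (inj₂ e) _        = e
      second (inj₁ _) (inj₂ e) = ≈-sym e
      -- Here both pairs may be degenerate; the equality of the first components links b to d.
      second (inj₁ e) (inj₁ k) = ≈-trans e (≈-trans (≈-sym a≈c) (≈-sym k))

    []≔-resp : ∀ {f f′ a a′ b b′} → f ≈ f′ → a ≈ a′ → b ≈ b′ → f [ a ]≔ b → f′ [ a′ ]≔ b′
    []≔-resp h k l = respects (v₀ [ v₁ ]≔ᵈ v₂) (h , k , l , tt)

    []≔⇒∈ : ∀ {f a b p} → Pair a b p → f [ a ]≔ b → p ∈ f
    []≔⇒∈ h (q , k , q∈f) = ∈-resp (Pair-unique k h) ≈-refl q∈f

    product : ∀ A B → ∃ λ c → ∀ p → p ∈ c ⇔ (∃ λ a → ∃ λ b → a ∈ A × b ∈ B × Pair a b p)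
    product A B = proj₁ prod , λ p → mk⇔ (proj₂ ∘ to (proj₂ prod p))
      λ (a , b , a∈ , b∈ , h) → from (proj₂ prod p) (pair∈ a∈ b∈ h , a , b , a∈ , b∈ , h)
      where
      A∪B = proj₁ (union ⦅ A , B ⦆)
      prod = separate (λ p → ∃ λ a → ∃ λ b → a ∈ A × b ∈ B × Pair a b p)
        (λ p → ∃ᵈ (∃ᵈ (v₁ ∈ᵈ con A ×ᵈ v₀ ∈ᵈ con B ×ᵈ Pairᵈ v₁ v₀ (wk (wk p)))))
        -- A Kuratowski pair of elements of `A∪B` is a set of subsets of it, hence an element of the
        -- double power set.
        (proj₁ (power (proj₁ (power A∪B))))
      left : ∀ {x} → x ∈ A → x ∈ A∪B
      left h = from (proj₂ (union ⦅ A , B ⦆) _) (A , from (⦅⦆-isUPair A B A) (inj₁ ≈-refl) , h)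
      right : ∀ {x} → x ∈ B → x ∈ A∪B
      right h = from (proj₂ (union ⦅ A , B ⦆) _) (B , from (⦅⦆-isUPair A B B) (inj₂ ≈-refl) , h)
      upair∈ : ∀ {a b x Z} → UPair a b x → a ∈ Z → b ∈ Z → x ∈ proj₁ (power Z)
      upair∈ {Z = Z} h a∈ b∈ = from (proj₂ (power Z) _) λ z z∈ →
        [ (λ e → ∈-resp (≈-sym e) ≈-refl a∈) , (λ e → ∈-resp (≈-sym e) ≈-refl b∈) ]′ (to (h z) z∈)
      pair∈ : ∀ {a b p} → a ∈ A → b ∈ B → Pair a b p → p ∈ proj₁ (power (proj₁ (power A∪B)))
      pair∈ a∈ b∈ (s , d , hs , hd , hp) =
        upair∈ hp (upair∈ hs (left a∈) (left a∈)) (upair∈ hd (left a∈) (right b∈))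

    infixr 21 _⊗_

    _⊗_ : Ob → Ob → Ob
    A ⊗ B = proj₁ (product A B)

    ∈⊗ : ∀ {A B} p → p ∈ A ⊗ B ⇔ (∃ λ a → ∃ λ b → a ∈ A × b ∈ B × Pair a b p)
    ∈⊗ {A} {B} = proj₂ (product A B)

    -- Functions of V are obtained as definable subsets of a product, so each construction below
    -- names its codomain beforehand.
    record Relation {p} (A B : Ob) (P : Ob → Ob → Set p) : Set (lsuc ℓ ⊔ p) where
      field
        graph-set  : Ob
        graph-pair : ∀ p → p ∈ graph-set → ∃ λ a → ∃ λ b → a ∈ A × b ∈ B × Pair a b p
        graph⇒     : ∀ {a b} → graph-set [ a ]≔ b → a ∈ A × b ∈ B × P a b
        graph⇐     : ∀ {a b} → a ∈ A → b ∈ B → P a b → graph-set [ a ]≔ b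

    open Relation public

    relation : ∀ {p} (P : Ob → Ob → Set p) A B → Definable₂ P → Relation A B P
    relation P A B d = record
      { graph-set  = f
      ; graph-pair = λ p h → to (∈⊗ p) (proj₁ (to (∈f p) h))
      ; graph⇒     = λ (p , h , p∈f) → case to (∈f p) p∈f of λ (p∈ , a , b , k , x) →
          case to (∈⊗ p) p∈ of λ (a′ , b′ , a′∈ , b′∈ , k′) →
            let e₁ , e₂ = Pair-injective k h ; e₁′ , e₂′ = Pair-injective k′ h in
            ∈-resp e₁′ ≈-refl a′∈ , ∈-resp e₂′ ≈-refl b′∈ , respects (d v₀ v₁) (e₁ , e₂ , tt) x
      ; graph⇐     = λ a∈ b∈ x → _ , ⟨⟩-isPair _ _ ,
          from (∈f _) (from (∈⊗ _) (_ , _ , a∈ , b∈ , ⟨⟩-isPair _ _) , _ , _ , ⟨⟩-isPair _ _ , x)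
      }
      where
      sep = separate (λ p → ∃ λ a → ∃ λ b → Pair a b p × P a b)
        (λ p → ∃ᵈ (∃ᵈ (Pairᵈ v₁ v₀ (wk (wk p)) ×ᵈ d v₁ v₀))) (A ⊗ B)
      f = proj₁ sep
      ∈f = proj₂ sep

    Map-∈ : ∀ {f A B a b} → Map f A B → f [ a ]≔ b → a ∈ A × b ∈ B
    Map-∈ m (p , h , p∈f) = case Map.graph m p p∈f of λ (_ , _ , a∈ , b∈ , k) →
      let e₁ , e₂ = Pair-injective k h in ∈-resp e₁ ≈-refl a∈ , ∈-resp e₂ ≈-refl b∈

    mapping : ∀ {p} {P : Ob → Ob → Set p} {A B} (r : Relation A B P) →
              (∀ {a} → a ∈ A → ∃ λ b → b ∈ B × P a b) →
              (∀ {a b c} → a ∈ A → b ∈ B → c ∈ B → P a b → P a c → b ≈ c) →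
              Map (graph-set r) A B
    mapping r t u = record
      { graph      = graph-pair r
      ; total      = λ a a∈ → case t a∈ of λ (b , b∈ , x) → b , graph⇐ r a∈ b∈ x
      ; functional = λ a b c h k → case (graph⇒ r h , graph⇒ r k) of
          λ ((a∈ , b∈ , x) , (_ , c∈ , y)) → u a∈ b∈ c∈ x y
      }

    -- The axiom of choice is stated for disjoint families. The sections of `r` may overlap, but the
    -- fibres of its graph do not, since a pair remembers its first component; a transversal of the
    -- fibres is the wanted function.
    choose : ∀ r I Y → (∀ i → i ∈ I → ∃ λ y → y ∈ Y × r [ i ]≔ y) →
             ∃ λ f → Map f I Y × (∀ i y → f [ i ]≔ y → r [ i ]≔ y)
    choose r I Y t = graph-set sel , mapping sel total functional ,
      λ i y h → proj₂ (proj₂ (graph⇒ g (proj₁ (proj₂ (proj₂ (graph⇒ sel h))))))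
      where
      g = relation (λ i y → r [ i ]≔ y) I Y (λ i y → con r [ i ]≔ᵈ y)
      G = graph-set g
      Fibre : Ob → Ob → Set (lsuc ℓ)
      Fibre i T = ∀ p → p ∈ T ⇔ (p ∈ G × (∃ λ y → Pair i y p))
      fibre : ∀ i → ∃ (Fibre i)
      fibre i = separate (λ p → ∃ λ y → Pair i y p) (λ p → ∃ᵈ (Pairᵈ (con i) v₀ (wk p))) G
      family = separate (λ T → ∃ λ i → i ∈ I × Fibre i T)
        (λ T → ∃ᵈ (v₀ ∈ᵈ con I ×ᵈ ∀ᵈ (v₀ ∈ᵈ wk (wk T) ⇔ᵈ v₀ ∈ᵈ con G ×ᵈ ∃ᵈ (Pairᵈ v₂ v₀ v₁))))
        (proj₁ (power G))
      nonempty : ∀ T → T ∈ proj₁ family → ∃ λ z → z ∈ T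
      nonempty T h = case to (proj₂ family T) h of λ (_ , i , i∈ , k) →
        case t i i∈ of λ (y , y∈ , x) → case graph⇐ g i∈ y∈ x of λ (p , h , p∈) →
          p , from (k p) (p∈ , y , h)
      disjoint : ∀ T T′ z → T ∈ proj₁ family → T′ ∈ proj₁ family → z ∈ T → z ∈ T′ → T ≈ T′
      disjoint T T′ z h h′ z∈ z∈′ =
        case to (proj₂ family T) h of λ (_ , i , _ , k) →
        case to (proj₂ family T′) h′ of λ (_ , i′ , _ , k′) →
        case proj₂ (to (k z) z∈) of λ (_ , q) →
        case proj₂ (to (k′ z) z∈′) of λ (_ , q′) →
        let e = proj₁ (Pair-injective q q′) in ⊆-antisym
          (λ w w∈ → from (k′ w) (case to (k w) w∈ of λ (w∈G , y , l) →
            w∈G , y , Pair-resp e ≈-refl ≈-refl l))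
          (λ w w∈ → from (k w) (case to (k′ w) w∈ of λ (w∈G , y , l) →
            w∈G , y , Pair-resp (≈-sym e) ≈-refl ≈-refl l))
      chosen = choice (proj₁ family) nonempty disjoint
      c = proj₁ chosen
      at : ∀ {i} → i ∈ I → ∃! _≈_ λ z → z ∈ proj₁ (fibre i) × z ∈ c
      at {i} i∈ = proj₂ chosen (proj₁ (fibre i)) (from (proj₂ family _)
        (from (proj₂ (power G) _) (λ z z∈ → proj₁ (to (proj₂ (fibre i) z) z∈)) ,
         i , i∈ , proj₂ (fibre i)))
      sel = relation (λ i y → G [ i ]≔ y × c [ i ]≔ y) I Y
        (λ i y → con G [ i ]≔ᵈ y ×ᵈ con c [ i ]≔ᵈ y)
      total : ∀ {i} → i ∈ I → ∃ λ y → y ∈ Y × G [ i ]≔ y × c [ i ]≔ y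
      total {i} i∈ = case at i∈ of λ (z , (z∈ , z∈c) , _) →
        case to (proj₂ (fibre i) z) z∈ of λ (z∈G , y , h) →
          y , proj₁ (proj₂ (graph⇒ g (z , h , z∈G))) , (z , h , z∈G) , (z , h , z∈c)
      functional : ∀ {i y y′} → i ∈ I → y ∈ Y → y′ ∈ Y → G [ i ]≔ y × c [ i ]≔ y →
                   G [ i ]≔ y′ × c [ i ]≔ y′ → y ≈ y′
      functional {i} {y} {y′} i∈ _ _ (a , a′) (b , b′) = case at i∈ of λ (z , _ , unique) →
        proj₂ (Pair-injective (Pair-resp ≈-refl ≈-refl
          (≈-trans (≈-sym (unique (in-fibre a , []≔⇒∈ (⟨⟩-isPair _ _) a′)))
                   (unique (in-fibre b , []≔⇒∈ (⟨⟩-isPair _ _) b′)))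
          (⟨⟩-isPair i y)) (⟨⟩-isPair i y′))
        where
        in-fibre : ∀ {y} → G [ i ]≔ y → ⟨ i , y ⟩ ∈ proj₁ (fibre i)
        in-fibre h = from (proj₂ (fibre i) _) ([]≔⇒∈ (⟨⟩-isPair _ _) h , _ , ⟨⟩-isPair _ _)

    -- Natural numbers and sequences

    succ : Ob → Ob
    succ x = proj₁ (union ⦅ x , ⦅ x , x ⦆ ⦆)

    succ-isSucc : ∀ x → Succ x (succ x)
    succ-isSucc x z = mk⇔
      (λ h → case to (proj₂ (union _) z) h of λ (u , u∈ , z∈) →
        [ (λ e → inj₁ (∈-resp ≈-refl e z∈))
        , (λ e → inj₂ ([ id , id ]′ (to (⦅⦆-isUPair x x z) (∈-resp ≈-refl e z∈)))) ]′
        (to (⦅⦆-isUPair _ _ u) u∈))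
      [ (λ h → from (proj₂ (union _) z) (x , from (⦅⦆-isUPair _ _ x) (inj₁ ≈-refl) , h))
      , (λ e → from (proj₂ (union _) z) (⦅ x , x ⦆ , from (⦅⦆-isUPair _ _ _) (inj₂ ≈-refl) ,
                                          from (⦅⦆-isUPair x x z) (inj₁ e))) ]′

    Succ-∈ : ∀ {x y} → Succ x y → x ∈ y
    Succ-∈ {x} h = from (h x) (inj₂ ≈-refl)

    Succ-unique : ∀ {x y z} → Succ x y → Succ x z → y ≈ z
    Succ-unique h k = ⊆-antisym (λ w → from (k w) ∘ to (h w)) (λ w → from (h w) ∘ to (k w))

    Succ-resp : ∀ {x x′ y y′} → x ≈ x′ → y ≈ y′ → Succ x y → Succ x′ y′
    Succ-resp h k = respects (Succᵈ v₀ v₁) (h , k , tt)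

    Succ-injective : ∀ {x y z} → Succ x z → Succ y z → x ≈ y
    Succ-injective {x} {y} h k with to (k x) (Succ-∈ h) | to (h y) (Succ-∈ k)
    ... | inj₂ e   | _        = e
    ... | inj₁ _   | inj₂ e   = ≈-sym e
    ... | inj₁ x∈y | inj₁ y∈x = contradiction y∈x (∈-asym x∈y)

    num : ℕ → Ob
    num zero    = ∅
    num (suc k) = succ (num k)

    num-natural : ∀ k → Natural (num k)
    num-natural zero    w h = proj₁ h _ ∅-empty
    num-natural (suc k) w h = proj₂ h _ _ (num-natural k w h) (succ-isSucc _)

    omega : ∃ λ ω → ∀ n → n ∈ ω ⇔ Natural n
    omega = proj₁ sep , λ n → mk⇔ (proj₂ ∘ to (proj₂ sep n))
      (λ h → from (proj₂ sep n) (h _ (proj₂ infinity) , h))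
      where sep = separate Natural Naturalᵈ (proj₁ infinity)

    ω : Ob
    ω = proj₁ omega

    num∈ω : ∀ k → num k ∈ ω
    num∈ω k = from (proj₂ omega _) (num-natural k)

    Succ∈ω : ∀ {m n} → m ∈ ω → Succ m n → n ∈ ω
    Succ∈ω h k = from (proj₂ omega _) λ w i → proj₂ i _ _ (to (proj₂ omega _) h w i) k

    -- No element of ω is nonstandard: a nonempty one has a predecessor in ω, because the elements
    -- that are empty or successors form an inductive set, and well-foundedness of `∈` ends the
    -- descent at `∅`.
    ∈ω⇒num : ∀ {n} → n ∈ ω → ∃ λ k → n ≈ num k
    ∈ω⇒num {n} = go (∈-wf n)
      where
      sep = separate (λ n → Empty n ⊎ ∃ λ m → m ∈ ω × Succ m n)
        (λ n → Emptyᵈ n ⊎ᵈ ∃ᵈ (v₀ ∈ᵈ con ω ×ᵈ Succᵈ v₀ (wk n))) ω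
      sep-inductive : Inductive (proj₁ sep)
      sep-inductive = (λ e h → from (proj₂ sep e)
          (∈-resp (≈-sym (Empty⇒≈∅ h)) ≈-refl (num∈ω zero) , inj₁ h))
        , λ x y h k → let x∈ = proj₁ (to (proj₂ sep x) h) in
            from (proj₂ sep y) (Succ∈ω x∈ k , inj₂ (x , x∈ , k))
      go : ∀ {n} → Acc _∈_ n → n ∈ ω → ∃ λ k → n ≈ num k
      go {n} (acc r) h with proj₂ (to (proj₂ sep n) (to (proj₂ omega n) h _ sep-inductive))
      ... | inj₁ e            = zero , Empty⇒≈∅ e
      ... | inj₂ (m , m∈ , k) = case go (r (Succ-∈ k)) m∈ of λ (j , e) →
        suc j , Succ-unique (Succ-resp e ≈-refl k) (succ-isSucc _)

    num-< : ∀ {j k} → j ℕ.< k → num j ∈ num k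
    num-< {j} {suc k} (s≤s h) with ℕₚ.m≤n⇒m<n∨m≡n h
    ... | inj₁ j<k  = from (succ-isSucc _ _) (inj₁ (num-< j<k))
    ... | inj₂ refl = Succ-∈ (succ-isSucc _)

    ∈num : ∀ {k x} → x ∈ num k → ∃ λ j → j ℕ.< k × x ≈ num j
    ∈num {zero}  h = contradiction h (∅-empty _)
    ∈num {suc k} h with to (succ-isSucc _ _) h
    ... | inj₁ x∈ = case ∈num x∈ of λ (j , j<k , e) → j , ℕₚ.m<n⇒m<1+n j<k , e
    ... | inj₂ e  = k , ℕₚ.≤-refl , e

    num-injective : ∀ {j k} → num j ≈ num k → j ≡ k
    num-injective {j} {k} h with ℕₚ.<-cmp j k
    ... | tri< j<k _ _ = contradiction (∈-resp h ≈-refl (num-< j<k)) ∈-irrefl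
    ... | tri≈ _ e _   = e
    ... | tri> _ _ k<j = contradiction (∈-resp (≈-sym h) ≈-refl (num-< k<j)) ∈-irrefl

    -- The graph is the least relation that contains the initial pair and is closed under the step,
    -- cut out of ω × Y by quantifying over all such relations in V. Uniqueness of values then
    -- follows along the numerals from the origin of each pair (`supported`).
    recursion : ∀ {Y y₀ F} → y₀ ∈ Y → Map F Y Y → ∃ λ e → Map e ω Y × e [ ∅ ]≔ y₀ ×
                (∀ {n n′ y y′} → e [ n ]≔ y → Succ n n′ → F [ y ]≔ y′ → e [ n′ ]≔ y′)
    recursion {Y} {y₀} {F} y₀∈ F-map =
      e , mapping r total functional , proj₁ e-closed , proj₂ e-closed _ _ _ _
      where
      Closed : Ob → Set (lsuc ℓ)
      Closed S = S [ ∅ ]≔ y₀ ×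
        (∀ n n′ y y′ → S [ n ]≔ y → Succ n n′ → F [ y ]≔ y′ → S [ n′ ]≔ y′)
      Inside : Ob → Ob → Set (lsuc ℓ)
      Inside n y = ∀ S → Closed S → S [ n ]≔ y
      r = relation Inside ω Y λ n y →
        ∀ᵈ ( (v₀ [ con ∅ ]≔ᵈ con y₀ ×ᵈ ∀ᵈ (∀ᵈ (∀ᵈ (∀ᵈ
             (v₄ [ v₃ ]≔ᵈ v₁ →ᵈ Succᵈ v₃ v₂ →ᵈ con F [ v₁ ]≔ᵈ v₀ →ᵈ v₄ [ v₂ ]≔ᵈ v₀)))))
           →ᵈ v₀ [ wk n ]≔ᵈ wk y)
      e = graph-set r
      e-closed : Closed e
      e-closed = graph⇐ r (num∈ω 0) y₀∈ (λ _ → proj₁) ,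
        λ n n′ y y′ h k l → case graph⇒ r h of λ (n∈ , y∈ , x) →
          graph⇐ r (Succ∈ω n∈ k) (proj₂ (Map-∈ F-map l))
            (λ S c → proj₂ c n n′ y y′ (x S c) k l)
      Supported : Ob → Ob → Set (lsuc ℓ)
      Supported n y = (n ≈ ∅ × y ≈ y₀) ⊎ (∃ λ m → ∃ λ x → e [ m ]≔ x × Succ m n × F [ x ]≔ y)
      -- An unsupported pair could be removed from e, which would stay closed.
      supported : ∀ {n y} → e [ n ]≔ y → Supported n y
      supported {n} {y} h with em {Supported n y}
      ... | yes s = s
      ... | no ¬s = contradiction (≈-refl , ≈-refl)
              (proj₂ (proj₂ (proj₂ (graph⇒ q (proj₂ (proj₂ (graph⇒ r h)) _ q-closed)))))
        where
        q = relation (λ a b → e [ a ]≔ b × ¬ (a ≈ n × b ≈ y)) ω Y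
          (λ a b → con e [ a ]≔ᵈ b ×ᵈ (¬ᵈ (a ≈ᵈ con n ×ᵈ b ≈ᵈ con y)))
        q-closed : Closed (graph-set q)
        q-closed = graph⇐ q (num∈ω 0) y₀∈
            (proj₁ e-closed , λ (a , b) → ¬s (inj₁ (≈-sym a , ≈-sym b))) ,
          λ m m′ x x′ h′ k l → let h = proj₁ (proj₂ (proj₂ (graph⇒ q h′)))
                                   g = proj₂ e-closed m m′ x x′ h k l
                                   m′∈ , x′∈ , _ = graph⇒ r g in
            graph⇐ q m′∈ x′∈ (g , λ (a , b) →
              ¬s (inj₂ (m , x , h , Succ-resp ≈-refl a k , []≔-resp ≈-refl ≈-refl b l)))
      unique : ∀ k {y y′} → e [ num k ]≔ y → e [ num k ]≔ y′ → y ≈ y′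
      unique zero h h′ with supported h | supported h′
      ... | inj₁ (_ , a) | inj₁ (_ , b) = ≈-trans a (≈-sym b)
      ... | inj₂ (m , _ , _ , s , _) | _ = contradiction (Succ-∈ s) (∅-empty m)
      ... | _ | inj₂ (m , _ , _ , s , _) = contradiction (Succ-∈ s) (∅-empty m)
      unique (suc k) h h′ with supported h | supported h′
      ... | inj₁ (a , _) | _ = contradiction (≈⇒⊆ a _ (Succ-∈ (succ-isSucc _))) (∅-empty _)
      ... | _ | inj₁ (a , _) = contradiction (≈⇒⊆ a _ (Succ-∈ (succ-isSucc _))) (∅-empty _)
      ... | inj₂ (m , x , a , s , b) | inj₂ (m′ , x′ , a′ , s′ , b′) =
        Map.functional F-map _ _ _ b ([]≔-resp ≈-refl (≈-sym x≈x′) ≈-refl b′)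
        where
        x≈x′ : x ≈ x′
        x≈x′ = unique k ([]≔-resp ≈-refl (Succ-injective s (succ-isSucc _)) ≈-refl a)
                        ([]≔-resp ≈-refl (Succ-injective s′ (succ-isSucc _)) ≈-refl a′)
      defined : ∀ k → ∃ λ y → e [ num k ]≔ y
      defined zero    = y₀ , proj₁ e-closed
      defined (suc k) = case defined k of λ (y , h) →
        case Map.total F-map y (proj₁ (proj₂ (graph⇒ r h))) of λ (y′ , l) →
          y′ , proj₂ e-closed _ _ _ _ h (succ-isSucc _) l
      total : ∀ {n} → n ∈ ω → ∃ λ y → y ∈ Y × Inside n y
      total n∈ = case ∈ω⇒num n∈ of λ (k , n≈) → case defined k of λ (y , h) →
        let _ , y∈ , x = graph⇒ r ([]≔-resp ≈-refl (≈-sym n≈) ≈-refl h) in y , y∈ , x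
      functional : ∀ {n y y′} → n ∈ ω → y ∈ Y → y′ ∈ Y → Inside n y → Inside n y′ → y ≈ y′
      functional n∈ y∈ y′∈ x x′ = case ∈ω⇒num n∈ of λ (k , n≈) →
        unique k ([]≔-resp ≈-refl n≈ ≈-refl (graph⇐ r n∈ y∈ x))
                 ([]≔-resp ≈-refl n≈ ≈-refl (graph⇐ r n∈ y′∈ x′))

    -- A sequence of sets indexed by ℕ is visible to V only when its graph is a set of V; countable
    -- unions and countable additivity are available for such sequences alone.
    Internal : (ℕ → Ob) → Ob → Set (lsuc ℓ)
    Internal s Y = ∃ λ f → Map f ω Y × (∀ k → f [ num k ]≔ s k)

    -- It is enough to control `P` at the numerals: they exhaust ω, and `P` is definable and so
    -- respects equality.
    internal : ∀ {p} (P : Ob → Ob → Set p) {s : ℕ → Ob} {Y} → Definable₂ P → (∀ k → s k ∈ Y) →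
               (∀ k → P (num k) (s k)) → (∀ k {y} → P (num k) y → y ≈ s k) → Internal s Y
    internal P {s} {Y} d s∈ h u = graph-set r ,
      mapping r
        (λ n∈ → case ∈ω⇒num n∈ of λ (k , e) →
          s k , s∈ k , respects (d v₀ v₁) (≈-sym e , ≈-refl , tt) (h k))
        (λ n∈ _ _ x y → case ∈ω⇒num n∈ of λ (k , e) →
          ≈-trans (u k (respects (d v₀ v₁) (e , ≈-refl , tt) x))
                  (≈-sym (u k (respects (d v₀ v₁) (e , ≈-refl , tt) y)))) ,
      λ k → graph⇐ r (num∈ω k) (s∈ k) (h k)
      where r = relation P ω Y d

    -- Choice first thins `r` to a function on `Y`; iterating that function by recursion gives the
    -- sequence together with its graph.
    dependent-choice : ∀ r {Y y₀} → y₀ ∈ Y → (∀ y → y ∈ Y → ∃ λ y′ → y′ ∈ Y × r [ y ]≔ y′) →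
                       ∃ λ s → Internal s Y × s 0 ≈ y₀ × (∀ k → r [ s k ]≔ s (suc k))
    dependent-choice r {Y} {y₀} y₀∈ t =
      case choose r Y Y t of λ (F , F-map , F⇒r) →
      case recursion y₀∈ F-map of λ (e , e-map , e₀ , e-step) →
      let s : ℕ → Ob
          s k = proj₁ (Map.total e-map (num k) (num∈ω k))
          s-at : ∀ k → e [ num k ]≔ s k
          s-at k = proj₂ (Map.total e-map (num k) (num∈ω k))
          F-at : ∀ k → F [ s k ]≔ s (suc k)
          F-at k = case Map.total F-map (s k) (proj₂ (Map-∈ e-map (s-at k))) of λ (y , l) →
            []≔-resp ≈-refl ≈-refl
              (Map.functional e-map _ _ _ (e-step (s-at k) (succ-isSucc _) l) (s-at (suc k))) l
      in s , (e , e-map , s-at) , Map.functional e-map _ _ _ (s-at 0) e₀ , λ k → F⇒r _ _ (F-at k)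

-- Values of measures

-- Comparing and exhausting measures takes only an ordered abelian group with halves. Suprema are
-- asked of each measure separately, because they exist only for families that are sets of V.
record Values (a b c : Level) : Set (lsuc (a ⊔ b ⊔ c)) where
  infix  4 _≈_ _≤_
  infixl 6 _+_
  field
    Value          : Set a
    _≈_            : Value → Value → Set b
    _≤_            : Value → Value → Set c
    _+_            : Value → Value → Value
    -_             : Value → Value
    0# 1#          : Value
    isAbelianGroup : IsAbelianGroup _≈_ _+_ 0# -_
    isTotalOrder   : IsTotalOrder _≈_ _≤_
    +-monoˡ        : ∀ x y z → x ≤ y → (x + z) ≤ (y + z)
    half           : ∀ x → ∃ λ h → h + h ≈ x

  open IsAbelianGroup isAbelianGroup public
    using (assoc; comm; identityˡ; identityʳ; inverseʳ; ∙-cong; ∙-congˡ; ∙-congʳ)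
    renaming (refl to ≈-refl; sym to ≈-sym; trans to ≈-trans)
  open IsTotalOrder isTotalOrder public
    using (antisym; total; ≤-respˡ-≈; ≤-respʳ-≈)
    renaming (refl to ≤-refl; reflexive to ≤-reflexive; trans to ≤-trans)

  +-mono : ∀ {w x y z} → w ≤ x → y ≤ z → (w + y) ≤ (x + z)
  +-mono {w} {x} {y} {z} h k = ≤-trans (+-monoˡ w x y h)
    (≤-respˡ-≈ (comm y x) (≤-respʳ-≈ (comm z x) (+-monoˡ y z x k)))

  +-undo : ∀ x z → (x + z) + (- z) ≈ x
  +-undo x z = ≈-trans (assoc x z (- z)) (≈-trans (∙-congˡ (inverseʳ z)) (identityʳ x))

  +-cancelʳ-≤ : ∀ {x y} z → (x + z) ≤ (y + z) → x ≤ y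
  +-cancelʳ-≤ {x} {y} z h = ≤-respˡ-≈ (+-undo x z) (≤-respʳ-≈ (+-undo y z) (+-monoˡ _ _ (- z) h))

  +-cancelˡ-≤ : ∀ {x y} z → (z + x) ≤ (z + y) → x ≤ y
  +-cancelˡ-≤ z h = +-cancelʳ-≤ z (≤-respˡ-≈ (comm z _) (≤-respʳ-≈ (comm z _) h))

  +-cancelʳ-≈ : ∀ {x y} z → x + z ≈ y + z → x ≈ y
  +-cancelʳ-≈ z h = antisym (+-cancelʳ-≤ z (≤-reflexive h)) (+-cancelʳ-≤ z (≤-reflexive (≈-sym h)))

  x≤x+y : ∀ {x y} → 0# ≤ y → x ≤ (x + y)
  x≤x+y h = ≤-respˡ-≈ (identityʳ _) (+-mono ≤-refl h)

  ≰⇒≥ : ∀ {x y} → ¬ (x ≤ y) → y ≤ x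
  ≰⇒≥ {x} {y} h with total x y
  ... | inj₁ k = contradiction k h
  ... | inj₂ k = k

  -- If `x ≤ y` fails, then `y ≤ x`, so x + x ≤ y + y ≤ x + y, and x cancels.
  double-≤⇒≤ : ∀ {x y} → (x + x) ≤ (y + y) → ¬ ¬ (x ≤ y)
  double-≤⇒≤ {x} {y} h x≰y = x≰y (+-cancelˡ-≤ x (≤-trans h (+-mono (≰⇒≥ x≰y) ≤-refl)))

  sum : (ℕ → Value) → ℕ → Value
  sum f zero    = 0#
  sum f (suc n) = sum f n + f n

  sum-mono : ∀ {f g} → (∀ k → f k ≤ g k) → ∀ n → sum f n ≤ sum g n
  sum-mono h zero    = ≤-refl
  sum-mono h (suc n) = +-mono (sum-mono h n) (h n)

  sum-cong : ∀ {f g} n → (∀ {k} → k ℕ.< n → f k ≈ g k) → sum f n ≈ sum g n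
  sum-cong zero    h = ≈-refl
  sum-cong (suc n) h = ∙-cong (sum-cong n λ k<n → h (ℕₚ.m<n⇒m<1+n k<n)) (h ℕₚ.≤-refl)

  -- Zeroing a term instead of deleting it keeps the range of indices fixed, so that `finiteSum-≤`
  -- can use up the terms of an initial segment in whatever order a list visits them.
  without : ℕ → (ℕ → Value) → ℕ → Value
  without k f j with j ℕₚ.≟ k
  ... | yes _ = 0#
  ... | no _  = f j

  without-≡ : ∀ k f → without k f k ≈ 0#
  without-≡ k f with k ℕₚ.≟ k
  ... | yes _  = ≈-refl
  ... | no k≢k = contradiction refl k≢k

  without-≢ : ∀ {k f j} → ¬ j ≡ k → without k f j ≈ f j
  without-≢ {k} {f} {j} j≢k with j ℕₚ.≟ k
  ... | yes j≡k = contradiction j≡k j≢k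
  ... | no _    = ≈-refl

  without-nonneg : ∀ {k f} → (∀ j → 0# ≤ f j) → ∀ j → 0# ≤ without k f j
  without-nonneg {k} h j with j ℕₚ.≟ k
  ... | yes _ = ≤-refl
  ... | no _  = h j

  sum-without : ∀ {f k n} → k ℕ.< n → sum f n ≈ f k + sum (without k f) n
  sum-without {f} {k} {suc n} (s≤s k≤n) with ℕₚ.m≤n⇒m<n∨m≡n k≤n
  ... | inj₁ k<n  = ≈-trans (∙-congʳ (sum-without k<n)) (≈-trans (assoc _ _ _)
    (∙-congˡ (∙-congˡ (≈-sym (without-≢ λ n≡k → ℕₚ.<⇒≢ k<n (≡.sym n≡k))))))
  ... | inj₂ refl = ≈-trans (comm _ _) (∙-congˡ (≈-trans
    (sum-cong n λ j<n → ≈-sym (without-≢ (ℕₚ.<⇒≢ j<n)))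
    (≈-trans (≈-sym (identityʳ _)) (∙-congˡ (≈-sym (without-≡ n f))))))

  sum-nonneg : ∀ {f} → (∀ k → 0# ≤ f k) → ∀ n → 0# ≤ sum f n
  sum-nonneg h zero    = ≤-refl
  sum-nonneg h (suc n) = ≤-trans (sum-nonneg h n) (x≤x+y (h n))

  record Lub {i} {I : Set i} (f : I → Value) (s : Value) : Set (a ⊔ c ⊔ i) where
    constructor lub
    field
      upper : ∀ i → f i ≤ s
      below : ∀ {t} → (∀ i → f i ≤ t) → s ≤ t

-- Measures

module MeasureTheory {ℓ : Level} (Ob : Set (lsuc ℓ)) (_≈_ _∈_ : Ob → Ob → Set ℓ)
                     (em : ExcludedMiddle (lsuc ℓ)) (ax : Language.Axioms Ob _≈_ _∈_) where

  open Language Ob _≈_ _∈_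
  open Axioms ax
  open Theory em ax

  -- Set operations and sequences of sets

  infixl 22 _∖_
  infixl 23 _∩_
  infixl 21 _∪_

  difference : ∀ A B → ∃ λ C → ∀ z → z ∈ C ⇔ (z ∈ A × z ∉ B)
  difference A B = separate (_∉ B) (λ z → ¬ᵈ (z ∈ᵈ con B)) A

  _∖_ : Ob → Ob → Ob
  A ∖ B = proj₁ (difference A B)

  ∈∖ : ∀ {A B z} → z ∈ A ∖ B ⇔ (z ∈ A × z ∉ B)
  ∈∖ = proj₂ (difference _ _) _

  ∖-resp : ∀ {A A′ B B′} → A ≈ A′ → B ≈ B′ → A ∖ B ≈ A′ ∖ B′
  ∖-resp h k = ext λ z → mk⇔
    (λ q → let a , b = to ∈∖ q in from ∈∖ (∈-resp ≈-refl h a , b ∘ ∈-resp ≈-refl (≈-sym k)))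
    (λ q → let a , b = to ∈∖ q in from ∈∖ (∈-resp ≈-refl (≈-sym h) a , b ∘ ∈-resp ≈-refl k))

  intersection : ∀ A B → ∃ λ C → ∀ z → z ∈ C ⇔ (z ∈ A × z ∈ B)
  intersection A B = separate (_∈ B) (λ z → z ∈ᵈ con B) A

  _∩_ : Ob → Ob → Ob
  A ∩ B = proj₁ (intersection A B)

  ∈∩ : ∀ {A B z} → z ∈ A ∩ B ⇔ (z ∈ A × z ∈ B)
  ∈∩ = proj₂ (intersection _ _) _

  _∪_ : Ob → Ob → Ob
  A ∪ B = proj₁ (union ⦅ A , B ⦆)

  ∈∪ : ∀ {A B z} → z ∈ A ∪ B ⇔ (z ∈ A ⊎ z ∈ B)
  ∈∪ {A} {B} {z} = mk⇔
    (λ h → case to (proj₂ (union _) z) h of λ (x , x∈ , z∈) →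
      [ (λ e → inj₁ (∈-resp ≈-refl e z∈)) , (λ e → inj₂ (∈-resp ≈-refl e z∈)) ]′
      (to (⦅⦆-isUPair A B x) x∈))
    [ (λ h → from (proj₂ (union _) z) (A , from (⦅⦆-isUPair A B A) (inj₁ ≈-refl) , h))
    , (λ h → from (proj₂ (union _) z) (B , from (⦅⦆-isUPair A B B) (inj₂ ≈-refl) , h)) ]′

  ∩⊆ˡ : ∀ {A B} → A ∩ B ⊆ A
  ∩⊆ˡ _ = proj₁ ∘ to ∈∩

  ∩⊆ʳ : ∀ {A B} → A ∩ B ⊆ B
  ∩⊆ʳ _ = proj₂ ∘ to ∈∩

  ∖⊆ : ∀ {A B} → A ∖ B ⊆ A
  ∖⊆ _ = proj₁ ∘ to ∈∖

  ⋃[_]≔_ : (ℕ → Ob) → Ob → Set (lsuc ℓ)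
  ⋃[ c ]≔ U = ∀ M → M ∈ U ⇔ (∃ λ k → M ∈ c k)

  Disjoint : (ℕ → Ob) → Set (lsuc ℓ)
  Disjoint c = ∀ {j k} → j ℕ.< k → ∀ M → M ∈ c j → M ∉ c k

  internal-∈ : ∀ {c Y} → Internal c Y → ∀ k → c k ∈ Y
  internal-∈ (_ , m , h) k = proj₂ (Map-∈ m (h k))

  -- Padding with `∅` makes binary unions and finite additivity instances of the countable ones.
  pair-sequence : Ob → Ob → ℕ → Ob
  pair-sequence A B zero          = A
  pair-sequence A B (suc zero)    = B
  pair-sequence A B (suc (suc k)) = ∅

  pair-internal : ∀ {A B Y} → A ∈ Y → B ∈ Y → ∅ ∈ Y → Internal (pair-sequence A B) Y
  pair-internal {A} {B} A∈ B∈ ∅∈ = internal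
    (λ n y → (n ≈ num 0 × y ≈ A) ⊎ (n ≈ num 1 × y ≈ B) ⊎ (n ≉ num 0 × n ≉ num 1 × y ≈ ∅))
    (λ n y → (n ≈ᵈ con (num 0) ×ᵈ y ≈ᵈ con A) ⊎ᵈ (n ≈ᵈ con (num 1) ×ᵈ y ≈ᵈ con B)
      ⊎ᵈ ((¬ᵈ (n ≈ᵈ con (num 0))) ×ᵈ (¬ᵈ (n ≈ᵈ con (num 1))) ×ᵈ y ≈ᵈ con ∅))
    (λ { zero → A∈ ; (suc zero) → B∈ ; (suc (suc _)) → ∅∈ })
    (λ { zero → inj₁ (≈-refl , ≈-refl) ; (suc zero) → inj₂ (inj₁ (≈-refl , ≈-refl))
       ; (suc (suc k)) → inj₂ (inj₂ ((λ e → case num-injective {suc (suc k)} {0} e of λ ())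
                                   , (λ e → case num-injective {suc (suc k)} {1} e of λ ()) , ≈-refl)) })
    λ { zero (inj₁ (_ , e)) → e
      ; zero (inj₂ (inj₁ (e , _))) → case num-injective {0} {1} e of λ ()
      ; zero (inj₂ (inj₂ (e , _))) → contradiction ≈-refl e
      ; (suc zero) (inj₁ (e , _)) → case num-injective {1} {0} e of λ ()
      ; (suc zero) (inj₂ (inj₁ (_ , e))) → e
      ; (suc zero) (inj₂ (inj₂ (_ , e , _))) → contradiction ≈-refl e
      ; (suc (suc k)) (inj₁ (e , _)) → case num-injective {suc (suc k)} {0} e of λ ()
      ; (suc (suc k)) (inj₂ (inj₁ (e , _))) → case num-injective {suc (suc k)} {1} e of λ ()
      ; (suc (suc k)) (inj₂ (inj₂ (_ , _ , e))) → e }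

  -- Measurable spaces

  record MeasurableSpace (Str 𝓑 : Ob) : Set (lsuc ℓ) where
    field
      subset       : ∀ {A} → A ∈ 𝓑 → A ⊆ Str
      ∅-measurable : ∅ ∈ 𝓑
      ∁-measurable : ∀ {A} → A ∈ 𝓑 → Str ∖ A ∈ 𝓑
      ⋃-measurable : ∀ {c} → Internal c 𝓑 → ∃ λ U → U ∈ 𝓑 × ⋃[ c ]≔ U

    measurable-resp : ∀ {A B} → A ≈ B → A ∈ 𝓑 → B ∈ 𝓑
    measurable-resp e = ∈-resp e ≈-refl

    Str-measurable : Str ∈ 𝓑
    Str-measurable = measurable-resp
      (⊆-antisym ∖⊆ λ z h → from ∈∖ (h , ∅-empty z)) (∁-measurable ∅-measurable)

    pair-⋃ : ∀ {A B} → ⋃[ pair-sequence A B ]≔ (A ∪ B)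
    pair-⋃ M = mk⇔
      (λ h → [ (λ h → 0 , h) , (λ h → 1 , h) ]′ (to ∈∪ h))
      λ { (0 , h) → from ∈∪ (inj₁ h) ; (1 , h) → from ∈∪ (inj₂ h)
        ; (suc (suc _) , h) → contradiction h (∅-empty M) }

    ∪-measurable : ∀ {A B} → A ∈ 𝓑 → B ∈ 𝓑 → A ∪ B ∈ 𝓑
    ∪-measurable a b = case ⋃-measurable (pair-internal a b ∅-measurable) of λ (U , U∈ , h) →
      measurable-resp (ext λ z → mk⇔ (from (pair-⋃ z) ∘ to (h z)) (from (h z) ∘ to (pair-⋃ z))) U∈

    ∖-measurable : ∀ {A B} → A ∈ 𝓑 → B ∈ 𝓑 → A ∖ B ∈ 𝓑
    ∖-measurable {A} {B} a b = measurable-resp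
      (ext λ z → mk⇔
        (λ h → case to ∈∖ h of λ (z∈ , k) → from ∈∖
          (decidable-stable em₀ (λ z∉ → k (from ∈∪ (inj₁ (from ∈∖ (z∈ , z∉))))) ,
           λ z∈B → k (from ∈∪ (inj₂ z∈B))))
        (λ h → case to ∈∖ h of λ (z∈ , z∉) → from ∈∖ (subset a z z∈ ,
          λ k → [ (λ l → proj₂ (to ∈∖ l) z∈) , z∉ ]′ (to ∈∪ k))))
      (∁-measurable (∪-measurable (∁-measurable a) b))

    ∩-measurable : ∀ {A B} → A ∈ 𝓑 → B ∈ 𝓑 → A ∩ B ∈ 𝓑
    ∩-measurable a b = measurable-resp
      (ext λ z → mk⇔
        (λ h → case to ∈∖ h of λ (z∈ , k) → from ∈∩
          (z∈ , decidable-stable em₀ (λ z∉ → k (from ∈∖ (z∈ , z∉)))))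
        (λ h → case to ∈∩ h of λ (z∈ , z∈B) → from ∈∖ (z∈ , λ k → proj₂ (to ∈∖ k) z∈B)))
      (∖-measurable a (∖-measurable a b))

  -- Measures: finite additivity, monotonicity and exhaustion

  module _ {Str 𝓑 : Ob} (S : MeasurableSpace Str 𝓑) (𝓥 : Values (lsuc ℓ) ℓ (lsuc ℓ)) where
    open MeasurableSpace S
    open Values 𝓥 renaming
      (_≈_ to _≈ᵛ_; ≈-refl to ≈ᵛ-refl; ≈-sym to ≈ᵛ-sym; ≈-trans to ≈ᵛ-trans)

    record Measure : Set (lsuc ℓ) where
      field
        ⟪_⟫      : Ob → Value
        ⟪⟫-cong  : ∀ {A B} → A ≈ B → ⟪ A ⟫ ≈ᵛ ⟪ B ⟫
        nonneg   : ∀ {A} → A ∈ 𝓑 → 0# ≤ ⟪ A ⟫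
        null-∅   : ⟪ ∅ ⟫ ≈ᵛ 0#
        whole    : ⟪ Str ⟫ ≈ᵛ 1#
        additive : ∀ {c U} → Internal c 𝓑 → Disjoint c → ⋃[ c ]≔ U → Lub (sum (⟪_⟫ ∘ c)) ⟪ U ⟫
        -- The family `K` is an object of the model: the reals of V are complete only for sets of V.
        complete : ∀ {K} → K ⊆ 𝓑 → (∃ λ A → A ∈ K) → (∀ {A} → A ∈ K → ⟪ A ⟫ ≤ 1#) →
                   ∃ λ s → Lub {I = ∃ λ A → A ∈ K} (λ A → ⟪ proj₁ A ⟫) s
        -- The greedy choice of the exhaustion is made inside V, so its criterion has to be a set
        -- that formulas can mention.
        twice    : ∃ λ Q → ∀ C D → Q [ C ]≔ D ⇔ (C ∈ 𝓑 × D ∈ 𝓑 × ⟪ C ⟫ ≤ (⟪ D ⟫ + ⟪ D ⟫))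

      add : ∀ {A B} → A ∈ 𝓑 → B ∈ 𝓑 → (∀ M → M ∈ A → M ∉ B) → ⟪ A ∪ B ⟫ ≈ᵛ ⟪ A ⟫ + ⟪ B ⟫
      add {A} {B} a b disjoint = antisym (Lub.below total-lub partial)
          (≤-respˡ-≈ (∙-congʳ (identityˡ _)) (Lub.upper total-lub 2))
        where
        s = pair-sequence A B
        s-disjoint : Disjoint s
        s-disjoint {zero}        {suc zero}    _ M h k = disjoint M h k
        s-disjoint {j}           {suc (suc _)} _ M h k = ∅-empty M k
        s-disjoint {suc zero}    {suc zero}    (s≤s ())
        s-disjoint {suc (suc _)} {suc zero}    (s≤s ())
        total-lub = additive (pair-internal a b ∅-measurable) s-disjoint pair-⋃
        partial : ∀ n → sum (⟪_⟫ ∘ s) n ≤ (⟪ A ⟫ + ⟪ B ⟫)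
        partial zero                = ≤-trans (nonneg a) (x≤x+y (nonneg b))
        partial (suc zero)          = ≤-respˡ-≈ (≈ᵛ-sym (identityˡ _)) (x≤x+y (nonneg b))
        partial (suc (suc zero))    = ≤-reflexive (∙-congʳ (identityˡ _))
        partial (suc (suc (suc n))) = ≤-respˡ-≈
          (≈ᵛ-sym (≈ᵛ-trans (∙-congˡ null-∅) (identityʳ _))) (partial (suc (suc n)))

      split : ∀ {A B} → A ∈ 𝓑 → B ∈ 𝓑 → ⟪ A ⟫ ≈ᵛ ⟪ A ∩ B ⟫ + ⟪ A ∖ B ⟫
      split {A} {B} a b = ≈ᵛ-trans (⟪⟫-cong (ext λ z → mk⇔
          (λ h → from ∈∪ (case em₀ {z ∈ B} of λ
            { (yes k) → inj₁ (from ∈∩ (h , k)) ; (no k) → inj₂ (from ∈∖ (h , k)) }))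
          (λ h → [ ∩⊆ˡ z , ∖⊆ z ]′ (to ∈∪ h))))
        (add (∩-measurable a b) (∖-measurable a b)
          λ M h k → proj₂ (to ∈∖ k) (proj₂ (to ∈∩ h)))

      mono : ∀ {A B} → A ∈ 𝓑 → B ∈ 𝓑 → A ⊆ B → ⟪ A ⟫ ≤ ⟪ B ⟫
      mono {A} {B} a b h = ≤-respʳ-≈ (≈ᵛ-sym (split b a)) (≤-trans
        (≤-reflexive (⟪⟫-cong (⊆-antisym (λ z k → from ∈∩ (h z k , k)) ∩⊆ʳ)))
        (x≤x+y (nonneg (∖-measurable b a))))

      supremum : ∀ {K} → K ⊆ 𝓑 → (∃ λ A → A ∈ K) →
                 ∃ λ s → Lub {I = ∃ λ A → A ∈ K} (λ A → ⟪ proj₁ A ⟫) s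
      supremum K⊆ K∋ = complete K⊆ K∋ λ A∈ →
        ≤-respʳ-≈ whole (mono (K⊆ _ A∈) Str-measurable (subset (K⊆ _ A∈)))

      ≤0⇒null : ∀ {A} → A ∈ 𝓑 → ⟪ A ⟫ ≤ 0# → ⟪ A ⟫ ≈ᵛ 0#
      ≤0⇒null a h = antisym h (nonneg a)

      null-⊆ : ∀ {A B} → A ∈ 𝓑 → B ∈ 𝓑 → A ⊆ B → ⟪ B ⟫ ≈ᵛ 0# → ⟪ A ⟫ ≈ᵛ 0#
      null-⊆ a b h k = ≤0⇒null a (≤-respʳ-≈ k (mono a b h))

    -- Remove from E, again and again, a member of K whose measure is at least
    -- half of the largest possible.  By additivity these measures have no
    -- positive lower bound.
    module Exhaustion (μ : Measure) {K E : Ob} (K⊆ : K ⊆ 𝓑) (∅∈K : ∅ ∈ K) (E∈ : E ∈ 𝓑) where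
      open Measure μ

      Q = proj₁ twice

      -- A supremum over the members of `K` inside `F` need not be attained. Allowing a competitor
      -- up to twice the measure of `C`, which is what `Q` expresses, guarantees that a choice
      -- exists.
      Best : Ob → Ob → Set (lsuc ℓ)
      Best F C = C ∈ K × C ⊆ F × (∀ D → D ∈ K → D ⊆ F → Q [ D ]≔ C)

      best : ∀ {F} → F ∈ 𝓑 → ∃ (Best F)
      best {F} F∈ = case em {∃ λ C → C ∈ K′ × h ≤ ⟪ C ⟫} of λ
        { (yes (C , C∈ , h≤)) → C , K′⊆K C C∈ , ⊆F C C∈ , λ D D∈ D⊆ →
            dominate (K′⊆K C C∈) D∈ (≤-trans (at-most D∈ D⊆) (+-mono h≤ h≤))
        -- If no member reaches the half `h` of the supremum, then `h` bounds all of them, so h + h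
        -- ≤ h and h ≤ 0; in that case `∅` itself qualifies.
        ; (no none) → ∅ , ∅∈K , ∅⊆ , λ D D∈ D⊆ → dominate ∅∈K D∈
            (≤-trans (at-most D∈ D⊆) (+-mono (h≤∅ none) (h≤∅ none))) }
        where
        sep = separate (_⊆ F) (λ C → C ⊆ᵈ con F) K
        K′ = proj₁ sep
        K′⊆K : K′ ⊆ K
        K′⊆K C = proj₁ ∘ to (proj₂ sep C)
        ⊆F : ∀ C → C ∈ K′ → C ⊆ F
        ⊆F C = proj₂ ∘ to (proj₂ sep C)
        ∅⊆ : ∅ ⊆ F
        ∅⊆ z k = contradiction k (∅-empty z)
        ∅∈K′ = from (proj₂ sep ∅) (∅∈K , ∅⊆)
        top = supremum (λ C → K⊆ C ∘ K′⊆K C) (∅ , ∅∈K′)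
        h = proj₁ (half (proj₁ top))
        h+h≈ = proj₂ (half (proj₁ top))
        at-most : ∀ {D} → D ∈ K → D ⊆ F → ⟪ D ⟫ ≤ (h + h)
        at-most D∈ D⊆ = ≤-respʳ-≈ (≈ᵛ-sym h+h≈)
          (Lub.upper (proj₂ top) (_ , from (proj₂ sep _) (D∈ , D⊆)))
        dominate : ∀ {C D} → C ∈ K → D ∈ K → ⟪ D ⟫ ≤ (⟪ C ⟫ + ⟪ C ⟫) → Q [ D ]≔ C
        dominate C∈ D∈ l = from (proj₂ twice _ _) (K⊆ _ D∈ , K⊆ _ C∈ , l)
        h≤∅ : ¬ (∃ λ C → C ∈ K′ × h ≤ ⟪ C ⟫) → h ≤ ⟪ ∅ ⟫
        h≤∅ none = ≤-respʳ-≈ (≈ᵛ-sym null-∅) (+-cancelʳ-≤ h (≤-respʳ-≈ (≈ᵛ-sym (identityˡ h))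
          (≤-respˡ-≈ (≈ᵛ-sym h+h≈) (Lub.below (proj₂ top)
            λ (C , C∈) → ≰⇒≥ λ l → none (C , C∈ , l)))))

      -- Only the remainders are recorded, the removed set being the difference of consecutive ones;
      -- dependent choice can then run over a single sequence in `𝓑`.
      Step : Ob → Ob → Set (lsuc ℓ)
      Step F F′ = F′ ⊆ F × (∃ λ C → Best F C × (∀ z → z ∈ C ⇔ (z ∈ F × z ∉ F′)))

      removals : ∃ λ F → Internal F 𝓑 × F 0 ≈ E × (∀ k → Step (F k) (F (suc k)))
      removals = case dependent-choice (graph-set step) E∈ step-total of
        λ (F , F-internal , F₀≈E , h) →
          F , F-internal , F₀≈E , λ k → proj₂ (proj₂ (graph⇒ step (h k)))
        where
        step = relation Step 𝓑 𝓑 λ F F′ → F′ ⊆ᵈ F ×ᵈ ∃ᵈ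
          ( (v₀ ∈ᵈ con K ×ᵈ v₀ ⊆ᵈ wk F ×ᵈ
             ∀ᵈ (v₀ ∈ᵈ con K →ᵈ v₀ ⊆ᵈ wk (wk F) →ᵈ con Q [ v₀ ]≔ᵈ v₁))
          ×ᵈ ∀ᵈ (v₀ ∈ᵈ v₁ ⇔ᵈ v₀ ∈ᵈ wk (wk F) ×ᵈ (¬ᵈ (v₀ ∈ᵈ wk (wk F′)))))
        step-total : ∀ F → F ∈ 𝓑 → ∃ λ F′ → F′ ∈ 𝓑 × graph-set step [ F ]≔ F′
        step-total F F∈ = case best F∈ of λ (C , C-best) →
          let C⊆ = proj₁ (proj₂ C-best)
              F∖C∈ = ∖-measurable F∈ (K⊆ C (proj₁ C-best)) in
          F ∖ C , F∖C∈ , graph⇐ step F∈ F∖C∈ (∖⊆ , C , C-best , λ z → mk⇔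
            (λ k → C⊆ z k , λ l → proj₂ (to ∈∖ l) k)
            (λ (k , l) → decidable-stable em₀ λ z∉ → l (from ∈∖ (k , z∉))))

      Exhausting : (ℕ → Ob) → Set (lsuc ℓ)
      Exhausting c = Internal c 𝓑 × Disjoint c × (∀ k → c k ∈ K) × (∀ k → c k ⊆ E) ×
        (∀ {D} → D ∈ K → D ⊆ E → (∀ k M → M ∈ D → M ∉ c k) → ⟪ D ⟫ ≈ᵛ 0#)

      removed-exhausting : ∀ F → Internal F 𝓑 → F 0 ≈ E → (∀ k → Step (F k) (F (suc k))) →
                           Exhausting (λ k → F k ∖ F (suc k))
      removed-exhausting F F-internal F₀≈E F-step =
        c-internal , c-disjoint , c∈K , c⊆ , rest-null
        where
        c : ℕ → Ob
        c k = F k ∖ F (suc k)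
        c-best : ∀ k → Best (F k) (c k)
        c-best k = case F-step k of λ (_ , C , (C∈ , C⊆ , Q-at) , h) →
          let e : C ≈ c k
              e = ext λ z → mk⇔ (from ∈∖ ∘ to (h z)) (from (h z) ∘ to ∈∖) in
          ∈-resp e ≈-refl C∈ , ∖⊆ , λ D D∈ D⊆ → []≔-resp ≈-refl ≈-refl e (Q-at D D∈ D⊆)
        c∈K : ∀ k → c k ∈ K
        c∈K k = proj₁ (c-best k)
        F-anti : ∀ {j k} → j ℕ.≤ k → F k ⊆ F j
        F-anti {j} {zero}  z≤n = λ _ → id
        F-anti {j} {suc k} h with ℕₚ.m≤n⇒m<n∨m≡n h
        ... | inj₁ (s≤s j≤k) = λ z q → F-anti j≤k z (proj₁ (F-step k) z q)
        ... | inj₂ refl      = λ _ → id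
        c-disjoint : Disjoint c
        c-disjoint j<k M h l = proj₂ (to ∈∖ h) (F-anti j<k M (∖⊆ M l))
        c⊆ : ∀ k → c k ⊆ E
        c⊆ k z h = ≈⇒⊆ F₀≈E z (F-anti {0} {k} z≤n z (∖⊆ z h))
        c-internal : Internal c 𝓑
        c-internal = case F-internal of λ (f , f-map , f-at) → internal
          (λ n C → ∃ λ n′ → ∃ λ A → ∃ λ B → Succ n n′ × f [ n ]≔ A × f [ n′ ]≔ B ×
            (∀ z → z ∈ C ⇔ (z ∈ A × z ∉ B)))
          (λ n C → ∃ᵈ (∃ᵈ (∃ᵈ (Succᵈ (wk (wk (wk n))) v₂ ×ᵈ con f [ wk (wk (wk n)) ]≔ᵈ v₁
            ×ᵈ con f [ v₂ ]≔ᵈ v₀ ×ᵈ ∀ᵈ (v₀ ∈ᵈ wk (wk (wk (wk C))) ⇔ᵈ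
              v₀ ∈ᵈ v₂ ×ᵈ (¬ᵈ (v₀ ∈ᵈ v₁)))))))
          (λ k → K⊆ _ (c∈K k))
          (λ k → num (suc k) , F k , F (suc k) , succ-isSucc _ , f-at k , f-at (suc k) , λ z → ∈∖)
          (λ k (n′ , A , B , s , a , b , h) → ≈-trans
            (ext λ z → mk⇔ (from ∈∖ ∘ to (h z)) (from (h z) ∘ to ∈∖))
            (∖-resp (Map.functional f-map _ _ _ a (f-at k))
              (Map.functional f-map _ _ _ b ([]≔-resp ≈-refl
                (Succ-unique (succ-isSucc _) s) ≈-refl (f-at (suc k))))))
        rest-null : ∀ {D} → D ∈ K → D ⊆ E → (∀ k M → M ∈ D → M ∉ c k) → ⟪ D ⟫ ≈ᵛ 0#
        rest-null {D} D∈ D⊆E D∩c = ≤0⇒null (K⊆ _ D∈) D≤0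
          where
          D⊆F : ∀ k → D ⊆ F k
          D⊆F zero    z h = ≈⇒⊆ (≈-sym F₀≈E) z (D⊆E z h)
          D⊆F (suc k) z h = decidable-stable em₀ λ z∉ → D∩c k z h (from ∈∖ (D⊆F k z h , z∉))
          h = proj₁ (half ⟪ D ⟫)
          h+h≈ = proj₂ (half ⟪ D ⟫)
          -- `D` was still a competitor at every stage, so each removed set has at least half its
          -- measure.
          h≤c : ∀ k → h ≤ ⟪ c k ⟫
          h≤c k = decidable-stable em (double-≤⇒≤ (≤-respˡ-≈ (≈ᵛ-sym h+h≈)
            (proj₂ (proj₂ (to (proj₂ twice _ _) (proj₂ (proj₂ (c-best k)) D D∈ (D⊆F k)))))))
          total-lub : ∃ (Lub (sum (⟪_⟫ ∘ c)))
          total-lub = case ⋃-measurable c-internal of λ (U , _ , U-⋃) →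
            ⟪ U ⟫ , additive c-internal c-disjoint U-⋃
          -- Each partial sum plus `h` is at most the next one. Hence u - h still bounds all partial
          -- sums, and the least bound satisfies u ≤ u - h.
          h≤0 : h ≤ 0#
          h≤0 = case total-lub of λ (u , u-lub) → +-cancelˡ-≤ (u + (- h))
            (≤-respˡ-≈ (≈ᵛ-sym (≈ᵛ-trans (assoc u (- h) h)
                (≈ᵛ-trans (∙-congˡ (≈ᵛ-trans (comm (- h) h) (inverseʳ h))) (identityʳ u))))
              (≤-respʳ-≈ (≈ᵛ-sym (identityʳ _)) (Lub.below u-lub λ n →
                ≤-respˡ-≈ (+-undo _ h) (+-monoˡ _ _ (- h)
                  (≤-trans (+-mono ≤-refl (h≤c n)) (Lub.upper u-lub (suc n)))))))
          D≤0 : ⟪ D ⟫ ≤ 0#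
          D≤0 = ≤-respˡ-≈ h+h≈ (≤-respʳ-≈ (identityˡ 0#) (+-mono h≤0 h≤0))

      exhausting : ∃ Exhausting
      exhausting = case removals of λ (F , i , e , h) → _ , removed-exhausting F i e h

    -- Comparison of two measures and their mutual singularity

    module _ (μ : Measure) where
      open Measure μ

      complement-sum : ∀ {A} → A ∈ 𝓑 → ⟪ A ⟫ + ⟪ Str ∖ A ⟫ ≈ᵛ 1#
      complement-sum a = ≈ᵛ-trans
        (∙-congʳ (⟪⟫-cong (⊆-antisym (λ z h → from ∈∩ (subset a z h , h)) ∩⊆ʳ)))
        (≈ᵛ-trans (≈ᵛ-sym (split Str-measurable a)) whole)

      -- The two differences complete the same intersection to sets of equal measure, so they have
      -- equal measure; one of them being null suffices.
      symmetric-difference-null : ∀ {A B} → A ∈ 𝓑 → B ∈ 𝓑 → ⟪ B ⟫ ≈ᵛ ⟪ A ⟫ →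
                                  ⟪ B ∖ A ⟫ ≈ᵛ 0# → ⟪ (B ∖ A) ∪ (A ∖ B) ⟫ ≈ᵛ 0#
      symmetric-difference-null {A} {B} a b e n = ≈ᵛ-trans
        (add (∖-measurable b a) (∖-measurable a b)
          λ M h k → proj₂ (to ∈∖ h) (∖⊆ M k))
        (≈ᵛ-trans (∙-cong n (+-cancelʳ-≈ ⟪ A ∩ B ⟫ A∖B≈0)) (identityʳ _))
        where
        A∖B≈0 : ⟪ A ∖ B ⟫ + ⟪ A ∩ B ⟫ ≈ᵛ 0# + ⟪ A ∩ B ⟫
        A∖B≈0 = ≈ᵛ-trans (comm _ _) (≈ᵛ-trans (≈ᵛ-sym (split a b)) (≈ᵛ-trans (≈ᵛ-sym e)
          (≈ᵛ-trans (split b a) (≈ᵛ-trans (∙-cong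
            (⟪⟫-cong (ext λ z → mk⇔ (λ h → from ∈∩ (∩⊆ʳ z h , ∩⊆ˡ z h))
                                    (λ h → from ∈∩ (∩⊆ʳ z h , ∩⊆ˡ z h)))) n) (comm _ _)))))

    module Comparison (μ ν : Measure) where
      module μ = Measure μ
      module ν = Measure ν

      countable-mono : ∀ {c U} → Internal c 𝓑 → Disjoint c → ⋃[ c ]≔ U →
                       (∀ k → μ.⟪ c k ⟫ ≤ ν.⟪ c k ⟫) → μ.⟪ U ⟫ ≤ ν.⟪ U ⟫
      countable-mono i d u h = Lub.below (μ.additive i d u) λ n →
        ≤-trans (sum-mono h n) (Lub.upper (ν.additive i d u) n)

      -- An abstract measure is not an object of V, so the family on which the comparison holds is
      -- handed over as a set `N`, through which formulas can refer to it. For measures given by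
      -- graphs it is built by `compare`.
      Compares : Ob → Set (lsuc ℓ)
      Compares N = ∀ C → C ∈ N ⇔ (C ∈ 𝓑 × μ.⟪ C ⟫ ≤ ν.⟪ C ⟫)

      Below : Ob → Set (lsuc ℓ)
      Below A = A ∈ 𝓑 × (∀ D → D ∈ 𝓑 → D ⊆ A → μ.⟪ D ⟫ ≤ ν.⟪ D ⟫)

      Below-⊆ : ∀ {A B} → Below B → A ∈ 𝓑 → A ⊆ B → Below A
      Below-⊆ (_ , h) a A⊆B = a , λ D d D⊆A → h D d λ z → A⊆B z ∘ D⊆A z

    module _ (μ ν : Measure) where
      open Comparison μ ν
      private module Reverse = Comparison ν μ

      -- The exhaustion is taken with respect to μ. A set D in the remainder with ν D ≤ μ D is then
      -- μ-null, which gives μ D ≤ ν D all the same; every other D satisfies it by totality of the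
      -- order.
      positive-part : ∀ {N B} → Reverse.Compares N → B ∈ 𝓑 → ¬ ν.⟪ B ⟫ ≤ μ.⟪ B ⟫ →
                      ∃ λ P → Below P × P ⊆ B × ¬ ν.⟪ P ⟫ ≤ 0#
      positive-part {N} {B} compares b ν≰μ =
        case Exhaustion.exhausting μ N⊆ ∅∈N b of λ (c , c-internal , c-disjoint , c∈N , c⊆B , null) →
        case ⋃-measurable c-internal of λ (U , U∈ , U-⋃) →
        let
          P∈ = ∖-measurable b U∈
          below : ∀ D → D ∈ 𝓑 → D ⊆ B ∖ U → μ.⟪ D ⟫ ≤ ν.⟪ D ⟫
          below D d D⊆ = case em {ν.⟪ D ⟫ ≤ μ.⟪ D ⟫} of λ
            { (yes h) → ≤-respˡ-≈ (≈ᵛ-sym (null (from (compares D) (d , h)) (λ z → ∖⊆ z ∘ D⊆ z)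
                λ k M M∈ M∈c → proj₂ (to ∈∖ (D⊆ M M∈)) (from (U-⋃ M) (k , M∈c)))) (ν.nonneg d)
            ; (no h) → ≰⇒≥ h }
          U≤ : ν.⟪ U ⟫ ≤ μ.⟪ U ⟫
          U≤ = Reverse.countable-mono c-internal c-disjoint U-⋃
            λ k → proj₂ (to (compares (c k)) (c∈N k))
          U⊆B : U ⊆ B
          U⊆B z h = case to (U-⋃ z) h of λ (k , z∈) → c⊆B k z z∈
          -- Were the remainder ν-null, then ν B ≤ ν U ≤ μ U ≤ μ B, against the choice of `B`.
          ν≤μ : ν.⟪ B ∖ U ⟫ ≤ 0# → ν.⟪ B ⟫ ≤ μ.⟪ B ⟫
          ν≤μ h = ≤-respˡ-≈ (≈ᵛ-sym (ν.split b U∈)) (≤-respʳ-≈ (identityʳ _)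
            (+-mono (≤-trans (ν.mono (∩-measurable b U∈) U∈ ∩⊆ʳ)
              (≤-trans U≤ (μ.mono U∈ b U⊆B))) h))
        in B ∖ U , (P∈ , below) , ∖⊆ , ν≰μ ∘ ν≤μ
        where
        N⊆ : N ⊆ 𝓑
        N⊆ C = proj₁ ∘ to (compares C)
        ∅∈N : ∅ ∈ N
        ∅∈N = from (compares ∅) (∅-measurable , ≤-reflexive (≈ᵛ-trans ν.null-∅ (≈ᵛ-sym μ.null-∅)))

      restrict-internal : ∀ {c D} → D ∈ 𝓑 → Internal c 𝓑 → Internal (λ k → D ∩ c k) 𝓑
      restrict-internal {c} {D} d i@(f , f-map , f-at) = internal
        (λ n E → ∃ λ C → f [ n ]≔ C × (∀ z → z ∈ E ⇔ (z ∈ D × z ∈ C)))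
        (λ n E → ∃ᵈ (con f [ wk n ]≔ᵈ v₀ ×ᵈ
          ∀ᵈ (v₀ ∈ᵈ wk (wk E) ⇔ᵈ v₀ ∈ᵈ con D ×ᵈ v₀ ∈ᵈ v₁)))
        (λ k → ∩-measurable d (internal-∈ i k))
        (λ k → c k , f-at k , λ z → ∈∩)
        (λ k (C , C-at , h) → let e = Map.functional f-map _ _ _ C-at (f-at k) in ext λ z → mk⇔
          (λ l → let z∈D , z∈C = to (h z) l in from ∈∩ (z∈D , ∈-resp ≈-refl e z∈C))
          (λ l → from (h z) (∩⊆ˡ z l , ∈-resp ≈-refl (≈-sym e) (∩⊆ʳ z l))))

      -- Exhausting with respect to ν gives the stronger maximality: on a below set, ν-null implies
      -- μ-null.
      maximal-part : ∀ {N} → Compares N →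
        ∃ λ A → Below A × (∀ {D} → Below D → (∀ M → M ∈ D → M ∉ A) → ν.⟪ D ⟫ ≈ᵛ 0#)
      maximal-part {N} compares =
        -- Membership in `N` replaces the inequality of values, which makes being below a formula
        -- and the below sets a set `K` of V.
        case separate (λ A → ∀ D → D ∈ 𝓑 → D ⊆ A → D ∈ N)
          (λ A → ∀ᵈ (v₀ ∈ᵈ con 𝓑 →ᵈ v₀ ⊆ᵈ wk A →ᵈ v₀ ∈ᵈ con N)) 𝓑 of λ (K , K-spec) →
        let
          below⇒K : ∀ {A} → Below A → A ∈ K
          below⇒K (a , h) = from (K-spec _) (a , λ D d D⊆ → from (compares D) (d , h D d D⊆))
          K⇒below : ∀ {A} → A ∈ K → Below A
          K⇒below h = case to (K-spec _) h of λ (a , k) →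
            a , λ D d D⊆ → proj₂ (to (compares D) (k D d D⊆))
          ∅-below : Below ∅
          ∅-below = ∅-measurable , λ D d D⊆ → ≤-reflexive
            (≈ᵛ-trans (μ.null-⊆ d ∅-measurable D⊆ μ.null-∅)
              (≈ᵛ-sym (ν.null-⊆ d ∅-measurable D⊆ ν.null-∅)))
        in
        case Exhaustion.exhausting ν {K} (λ A → proj₁ ∘ to (K-spec A)) (below⇒K ∅-below)
          Str-measurable of λ (c , c-internal , c-disjoint , c∈K , _ , null) →
        case ⋃-measurable c-internal of λ (U , U∈ , U-⋃) →
        U ,
        -- A subset of the union is cut along the disjoint sets `c k`; the comparison holds on every
        -- piece and is summed by countable additivity.
        (U∈ , λ D d D⊆ → countable-mono (restrict-internal d c-internal)
          (λ j<k M h l → c-disjoint j<k M (∩⊆ʳ M h) (∩⊆ʳ M l))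
          (λ M → mk⇔ (λ h → case to (U-⋃ M) (D⊆ M h) of λ (k , M∈) → k , from ∈∩ (h , M∈))
                     (λ (k , h) → ∩⊆ˡ M h))
          (λ k → proj₂ (K⇒below (c∈K k)) _ (∩-measurable d (internal-∈ c-internal k)) ∩⊆ʳ)) ,
        λ {D} D-below disjoint → null (below⇒K D-below) (subset (proj₁ D-below))
          λ k M h l → disjoint M h (from (U-⋃ M) (k , l))

      -- On the complement of `B`, μ is carried by its part inside `A`, where μ ≤ ν. Both measures
      -- have total mass 1, so the inequality reverses on `B`.
      full-below⇒≥ : ∀ {A B} → Below A → μ.⟪ A ⟫ ≈ᵛ 1# → B ∈ 𝓑 → ν.⟪ B ⟫ ≤ μ.⟪ B ⟫
      full-below⇒≥ {A} {B} (a , below) e b = +-cancelʳ-≤ μ.⟪ Str ∖ B ⟫ (≤-respʳ-≈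
        (≈ᵛ-trans (complement-sum ν b) (≈ᵛ-sym (complement-sum μ b))) (+-mono ≤-refl μ∁≤ν∁))
        where
        ∁ = ∁-measurable b
        ∁A≈0 : μ.⟪ Str ∖ A ⟫ ≈ᵛ 0#
        ∁A≈0 = +-cancelʳ-≈ μ.⟪ A ⟫ (≈ᵛ-trans (comm _ _)
          (≈ᵛ-trans (complement-sum μ a) (≈ᵛ-trans (≈ᵛ-sym e) (≈ᵛ-sym (identityˡ _)))))
        μ∁≤ν∁ : μ.⟪ Str ∖ B ⟫ ≤ ν.⟪ Str ∖ B ⟫
        μ∁≤ν∁ = ≤-respˡ-≈ (≈ᵛ-sym (μ.split ∁ a)) (≤-respʳ-≈ (identityʳ _) (+-mono
          (≤-trans (below _ (∩-measurable ∁ a) ∩⊆ʳ) (ν.mono (∩-measurable ∁ a) ∁ ∩⊆ˡ))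
          (≤-reflexive (μ.null-⊆ (∖-measurable ∁ a) (∁-measurable a)
            (λ z h → from ∈∖ (∖⊆ z (∖⊆ z h) , proj₂ (to ∈∖ h))) ∁A≈0))))

      module _ {t} (Translation : Ob → Ob → Set t)
        (translate : ∀ {A B} → Translation A B → A ∈ 𝓑 →
          B ∈ 𝓑 × μ.⟪ B ⟫ ≈ᵛ μ.⟪ A ⟫ × ν.⟪ B ⟫ ≈ᵛ ν.⟪ A ⟫)
        (translate⁻¹ : ∀ {A B D} → Translation A B → A ∈ 𝓑 → D ∈ 𝓑 → D ⊆ B →
          ∃ λ C → C ∈ 𝓑 × C ⊆ A × μ.⟪ D ⟫ ≈ᵛ μ.⟪ C ⟫ × ν.⟪ D ⟫ ≈ᵛ ν.⟪ C ⟫) where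

        Ergodic : Measure → Set (lsuc ℓ ⊔ t)
        Ergodic λ′ = ∀ {A} → A ∈ 𝓑 → (∀ {B} → Translation A B → ⟪ (B ∖ A) ∪ (A ∖ B) ⟫ ≈ᵛ 0#) →
                     ⟪ A ⟫ ≈ᵛ 0# ⊎ ⟪ A ⟫ ≈ᵛ 1#
          where open Measure λ′

        -- Being below is a condition on all measurable subsets, so the subsets of the translate
        -- must be carried back into `A`; this is what `translate⁻¹` is for.
        Below-translate : ∀ {A B} → Translation A B → Below A → Below B
        Below-translate t (a , h) = proj₁ (translate t a) , λ D d D⊆ →
          case translate⁻¹ t a d D⊆ of λ (C , c , C⊆ , e , e′) →
            ≤-respˡ-≈ (≈ᵛ-sym e) (≤-respʳ-≈ (≈ᵛ-sym e′) (h C c C⊆))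

        -- The maximal part is almost invariant because being Below is
        -- preserved by translations.
        singular : ∀ {N N′ B} → Compares N → Reverse.Compares N′ → Ergodic μ → Ergodic ν →
                   B ∈ 𝓑 → ¬ ν.⟪ B ⟫ ≤ μ.⟪ B ⟫ →
                   ∃ λ A → A ∈ 𝓑 × μ.⟪ A ⟫ ≈ᵛ 0# × ν.⟪ A ⟫ ≈ᵛ 1#
        singular {B = B} compares compares′ μ-ergodic ν-ergodic b ν≰μ =
          case maximal-part compares of λ (A , A-below , maximal) →
          case positive-part compares′ b ν≰μ of λ (P , P-below , _ , P≰0) →
          let
            a = proj₁ A-below
            p = proj₁ P-below
            outside : ∀ {D} → Below D → ν.⟪ D ∖ A ⟫ ≈ᵛ 0#
            outside D-below = maximal (Below-⊆ D-below (∖-measurable (proj₁ D-below) a) ∖⊆)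
              λ M h → proj₂ (to ∈∖ h)
            ν-invariant : ∀ {B} → Translation A B → ν.⟪ (B ∖ A) ∪ (A ∖ B) ⟫ ≈ᵛ 0#
            ν-invariant t = case translate t a of λ (b , _ , e) →
              symmetric-difference-null ν a b e (outside (Below-translate t A-below))
            -- The part of the translate outside `A` is ν-null by maximality of `A`, and it lies in
            -- a below set, so it is μ-null as well.
            μ-invariant : ∀ {B} → Translation A B → μ.⟪ (B ∖ A) ∪ (A ∖ B) ⟫ ≈ᵛ 0#
            μ-invariant t = case translate t a of λ (b , e , _) →
              symmetric-difference-null μ a b e (μ.≤0⇒null (∖-measurable b a)
                (≤-respʳ-≈ (outside (Below-translate t A-below))
                  (proj₂ (Below-translate t A-below) _ (∖-measurable b a) ∖⊆)))
            -- By maximality `P` is contained in `A` up to a ν-null set, so a ν-null `A` would make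
            -- `P` ν-null.
            A≉0 : ¬ ν.⟪ A ⟫ ≈ᵛ 0#
            A≉0 e = P≰0 (≤-respˡ-≈ (≈ᵛ-sym (ν.split p a)) (≤-respʳ-≈ (identityʳ _)
              (+-mono (≤-respʳ-≈ e (ν.mono (∩-measurable p a) a ∩⊆ʳ))
                (≤-reflexive (outside P-below)))))
            A≉1 : ¬ μ.⟪ A ⟫ ≈ᵛ 1#
            A≉1 e = ν≰μ (full-below⇒≥ A-below e b)
          in
          A , a ,
          [ id , (λ e → contradiction e A≉1) ]′ (μ-ergodic a μ-invariant) ,
          [ (λ e → contradiction e A≉0) , id ]′ (ν-ergodic a ν-invariant)

-- Codes

module Coding {ℓ : Level} (Ob : Set (lsuc ℓ)) (_≈_ _∈_ : Ob → Ob → Set ℓ)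
              (em : ExcludedMiddle (lsuc ℓ)) (ax : Language.Axioms Ob _≈_ _∈_) where

  open Language Ob _≈_ _∈_
  open Axioms ax
  open Theory em ax
  open MeasureTheory Ob _≈_ _∈_ em ax

  num-numeral : ∀ k → Numeral k (num k)
  num-numeral zero    = ∅-empty
  num-numeral (suc k) = num k , num-numeral k , succ-isSucc _

  tag : ℕ → Ob → Ob
  tag k x = ⟨ num k , x ⟩

  tag-isTag : ∀ k x → Tag k x (tag k x)
  tag-isTag k x = num k , num-numeral k , ⟨⟩-isPair _ _

  ∅-map : ∀ {Y} → Map ∅ ∅ Y
  ∅-map = record
    { graph      = λ p h → contradiction h (∅-empty p)
    ; total      = λ a h → contradiction h (∅-empty a)
    ; functional = λ _ _ _ (p , _ , h) → contradiction h (∅-empty p)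
    }

  ∅[]≔ : ∀ {a b} → ¬ ∅ [ a ]≔ b
  ∅[]≔ (p , _ , h) = ∅-empty p h

  singleton-map : ∀ φ → ∃ λ s → Map s (num 1) ⦅ φ , φ ⦆ × s [ ∅ ]≔ φ ×
                  (∀ {i ψ} → s [ i ]≔ ψ → ψ ≈ φ)
  singleton-map φ = graph-set r ,
    mapping r (λ _ → φ , φ∈ , ≈-refl) (λ _ _ _ h k → ≈-trans h (≈-sym k)) ,
    graph⇐ r (num-< {0} {1} (s≤s z≤n)) φ∈ ≈-refl , λ h → proj₂ (proj₂ (graph⇒ r h))
    where
    r = relation (λ _ y → y ≈ φ) (num 1) ⦅ φ , φ ⦆ (λ _ y → y ≈ᵈ con φ)
    φ∈ = from (⦅⦆-isUPair φ φ φ) (inj₁ ≈-refl)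

  identity-map : ∀ {A B} → A ≈ B → ∃ λ f → Map f A B × IsInjective f ×
                 (∀ b → b ∈ B → ∃ λ a → f [ a ]≔ b)
  identity-map {A} {B} e = graph-set r ,
    mapping r (λ a∈ → _ , ≈⇒⊆ e _ a∈ , ≈-refl) (λ _ _ _ h k → ≈-trans (≈-sym h) k) ,
    (λ a b c h k → ≈-trans (proj₂ (proj₂ (graph⇒ r h))) (≈-sym (proj₂ (proj₂ (graph⇒ r k))))) ,
    λ b b∈ → b , graph⇐ r (≈⇒⊆ (≈-sym e) _ b∈) b∈ ≈-refl
    where r = relation _≈_ A B _≈ᵈ_

  -- Induction on k: when `num k` is a proper subset of κ, an ∈-minimal element of κ outside it has
  -- exactly the elements of `num k`, hence equals it. Later this makes pairs and countable families
  -- admissible as families indexed by κ.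
  infinite-ordinal⊇ω : ∀ {κ} → (∀ β → β ∈ κ → β ⊆ κ) →
                       (∀ β γ → β ∈ κ → γ ∈ κ → β ∈ γ ⊎ β ≈ γ ⊎ γ ∈ β) →
                       (∀ k → num k ≉ κ) → ∀ k → num k ∈ κ
  infinite-ordinal⊇ω {κ} transitive trichotomy κ-infinite = λ k → below (suc k) k ℕₚ.≤-refl
    where
    least-outside : ∀ k → num k ⊆ κ → ∀ {α} → Acc _∈_ α → α ∈ κ → α ∉ num k → num k ∈ κ
    least-outside k n⊆ {α} (acc r) α∈ α∉ with em {∃ λ β → β ∈ α × β ∉ num k}
    ... | yes (β , β∈ , β∉) = least-outside k n⊆ (r β∈) (transitive α α∈ β β∈) β∉
    ... | no none = ∈-resp (⊆-antisym
        (λ β β∈ → decidable-stable em₀ λ β∉ → none (β , β∈ , β∉)) n⊆α) ≈-refl α∈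
      where
      n⊆α : num k ⊆ α
      n⊆α β β∈ with trichotomy β α (n⊆ β β∈) α∈
      ... | inj₁ β∈α        = β∈α
      ... | inj₂ (inj₁ β≈α) = contradiction (∈-resp β≈α ≈-refl β∈) α∉
      ... | inj₂ (inj₂ α∈β) = case ∈num {k} β∈ of λ (j , j<k , e) →
        case ∈num {j} (∈-resp ≈-refl e α∈β) of λ (i , i<j , e′) →
        contradiction (∈-resp (≈-sym e′) ≈-refl (num-< (ℕₚ.<-trans i<j j<k))) α∉
    below : ∀ n k → k ℕ.< n → num k ∈ κ
    below (suc n) k (s≤s k≤n) = case em {∃ λ α → α ∈ κ × α ∉ num k} of λ
      { (yes (α , α∈ , α∉)) → least-outside k n⊆ (∈-wf α) α∈ α∉
      ; (no none) → contradiction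
          (⊆-antisym n⊆ λ α α∈ → decidable-stable em₀ λ α∉ → none (α , α∈ , α∉)) (κ-infinite k) }
      where
      n⊆ : num k ⊆ κ
      n⊆ β β∈ = case ∈num {k} β∈ of λ (j , j<k , e) →
        ∈-resp (≈-sym e) ≈-refl (below n j (ℕₚ.<-≤-trans j<k k≤n))

  least : ∀ {p} {P : ℕ → Set p} → ExcludedMiddle p → ∀ k → P k →
          ∃ λ n → P n × (∀ j → j ℕ.< n → ¬ P j)
  least {P = P} em′ k = go (suc k) k ℕₚ.≤-refl
    where
    go : ∀ m k → k ℕ.< m → P k → ∃ λ n → P n × (∀ j → j ℕ.< n → ¬ P j)
    go (suc m) k (s≤s k≤m) h with em′ {∃ λ j → j ℕ.< k × P j}
    ... | yes (j , j<k , h′) = go m j (ℕₚ.<-≤-trans j<k k≤m) h′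
    ... | no none = k , h , λ j j<k h′ → none (j , j<k , h′)

  -- Closure under unions is stated for families that inject into κ, while a sequence may repeat
  -- values; sending each value to its first index repairs this.
  countable-range : ∀ {c Y κ} → Internal c Y → (∀ k → num k ∈ κ) →
                    ∃ λ C → (∀ A → A ∈ C ⇔ (∃ λ k → A ≈ c k)) ×
                    ∃ λ j → Map j C κ × IsInjective j
  countable-range {c} {Y} {κ} (f , f-map , f-at) num∈κ =
    case separate (λ A → ∃ λ n → f [ n ]≔ A) (λ A → ∃ᵈ (con f [ v₀ ]≔ᵈ wk A)) Y of λ (C , C-spec) →
    let
      ∈C : ∀ A → A ∈ C ⇔ (∃ λ k → A ≈ c k)
      ∈C A = mk⇔
        (λ h → case proj₂ (to (C-spec A) h) of λ (n , l) →
          case ∈ω⇒num (proj₁ (Map-∈ f-map l)) of λ (k , e) →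
          k , Map.functional f-map _ _ _ l ([]≔-resp ≈-refl (≈-sym e) ≈-refl (f-at k)))
        (λ (k , e) → from (C-spec A) (∈-resp (≈-sym e) ≈-refl (proj₂ (Map-∈ f-map (f-at k))) ,
          num k , []≔-resp ≈-refl ≈-refl (≈-sym e) (f-at k)))
      r = relation First C κ λ A n → con f [ n ]≔ᵈ A ×ᵈ
            ∀ᵈ (v₀ ∈ᵈ wk n →ᵈ (¬ᵈ (con f [ v₀ ]≔ᵈ wk A)))
    in C , ∈C , graph-set r ,
      mapping r
        (λ {A} A∈ → case to (∈C A) A∈ of λ (k , e) →
          case least {P = λ k → f [ num k ]≔ A} em k
            ([]≔-resp ≈-refl ≈-refl (≈-sym e) (f-at k)) of λ (n , h , min) →
          num n , num∈κ n , h , λ m m∈ l → case ∈num m∈ of λ (j , j<n , e′) →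
            min j j<n ([]≔-resp ≈-refl e′ ≈-refl l))
        (λ _ _ _ → first-unique) ,
      λ A B n h k → Map.functional f-map _ _ _
        (proj₁ (proj₂ (proj₂ (graph⇒ r h)))) (proj₁ (proj₂ (proj₂ (graph⇒ r k))))
    where
    First : Ob → Ob → Set (lsuc ℓ)
    First A n = f [ n ]≔ A × (∀ m → m ∈ n → ¬ f [ m ]≔ A)
    first-unique : ∀ {A m n} → First A m → First A n → m ≈ n
    first-unique {A} {m} {n} (h , h-min) (k , k-min) =
      case ∈ω⇒num (proj₁ (Map-∈ f-map h)) of λ (i , e) →
      case ∈ω⇒num (proj₁ (Map-∈ f-map k)) of λ (j , e′) →
      case ℕₚ.<-cmp i j of λ
        { (tri< i<j _ _) → contradiction h (k-min m (∈-resp (≈-sym e) (≈-sym e′) (num-< i<j)))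
        ; (tri≈ _ refl _) → ≈-trans e (≈-sym e′)
        ; (tri> _ _ j<i) → contradiction k (h-min n (∈-resp (≈-sym e′) (≈-sym e) (num-< j<i))) }

  -- Formal meets take families indexed by all of κ, so `p` is placed at 0 and `q` fills every other
  -- index.
  pair-enumeration : ∀ {κ Y p q} → num 0 ∈ κ → num 1 ∈ κ → p ∈ Y → q ∈ Y →
                     ∃ λ f → Map f κ Y × Range f ⦅ p , q ⦆
  pair-enumeration {κ} {Y} {p} {q} 0∈ 1∈ p∈ q∈ = graph-set r ,
    mapping r
      (λ {α} _ → case em₀ {α ≈ num 0} of λ
        { (yes e) → p , p∈ , inj₁ (e , ≈-refl) ; (no e) → q , q∈ , inj₂ (e , ≈-refl) })
      (λ { _ _ _ (inj₁ (_ , a)) (inj₁ (_ , b)) → ≈-trans a (≈-sym b)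
         ; _ _ _ (inj₂ (_ , a)) (inj₂ (_ , b)) → ≈-trans a (≈-sym b)
         ; _ _ _ (inj₁ (a , _)) (inj₂ (b , _)) → contradiction a b
         ; _ _ _ (inj₂ (b , _)) (inj₁ (a , _)) → contradiction a b }) ,
    λ y → mk⇔
      (λ h → case to (⦅⦆-isUPair p q y) h of λ
        { (inj₁ e) → num 0 , graph⇐ r 0∈ (∈-resp (≈-sym e) ≈-refl p∈) (inj₁ (≈-refl , e))
        ; (inj₂ e) → num 1 , graph⇐ r 1∈ (∈-resp (≈-sym e) ≈-refl q∈)
            (inj₂ ((λ e′ → case num-injective {1} {0} e′ of λ ()) , e)) })
      (λ (α , h) → from (⦅⦆-isUPair p q y) (case proj₂ (proj₂ (graph⇒ r h)) of λ
        { (inj₁ (_ , e)) → inj₁ e ; (inj₂ (_ , e)) → inj₂ e }))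
    where
    r = relation (λ α y → (α ≈ num 0 × y ≈ p) ⊎ (α ≉ num 0 × y ≈ q)) κ Y
      λ α y → (α ≈ᵈ con (num 0) ×ᵈ y ≈ᵈ con p) ⊎ᵈ ((¬ᵈ (α ≈ᵈ con (num 0))) ×ᵈ y ≈ᵈ con q)

  -- Codes for complements, intersections and unions

  record Interpretation (κ Str 𝔹 Int : Ob) : Set (lsuc ℓ) where
    field
      num∈κ      : ∀ k → num k ∈ κ
      total      : ∀ γ → γ ∈ 𝔹 → ∃ λ A → Int [ γ ]≔ A
      functional : ∀ γ A B → Int [ γ ]≔ A → Int [ γ ]≔ B → A ≈ B
      subset     : ∀ {γ A} → Int [ γ ]≔ A → A ⊆ Str
      top        : ∃ λ γ → γ ∈ 𝔹 × Int [ γ ]≔ Str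
      neg∈       : ∀ γ δ → γ ∈ 𝔹 → Tag 1 γ δ → δ ∈ 𝔹
      join∈      : ∀ f Γ δ → Map f κ 𝔹 → Range f Γ → Tag 2 Γ δ → δ ∈ 𝔹
      meet∈      : ∀ f Γ δ → Map f κ 𝔹 → Range f Γ → Tag 3 Γ δ → δ ∈ 𝔹
      neg        : ∀ γ δ A B → Tag 1 γ δ → Int [ γ ]≔ A → Int [ δ ]≔ B →
                   ∀ M → M ∈ B ⇔ (M ∈ Str × M ∉ A)
      join       : ∀ Γ δ B → Tag 2 Γ δ → Int [ δ ]≔ B →
                   ∀ M → M ∈ B ⇔ (∃ λ γ → ∃ λ A → γ ∈ Γ × Int [ γ ]≔ A × M ∈ A)
      meet       : ∀ Γ δ B → Tag 3 Γ δ → Int [ δ ]≔ B →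
                   ∀ M → M ∈ B ⇔ (M ∈ Str × (∀ γ A → γ ∈ Γ → Int [ γ ]≔ A → M ∈ A))

    Coded : Ob → Set (lsuc ℓ)
    Coded A = ∃ λ γ → γ ∈ 𝔹 × Int [ γ ]≔ A

    coded-ext : ∀ {δ A B} → δ ∈ 𝔹 → Int [ δ ]≔ B → (∀ z → z ∈ B ⇔ z ∈ A) → Int [ δ ]≔ A
    coded-ext _ h e = []≔-resp ≈-refl ≈-refl (ext e) h

    neg-code : ∀ {γ A} → γ ∈ 𝔹 → Int [ γ ]≔ A → tag 1 γ ∈ 𝔹 × Int [ tag 1 γ ]≔ (Str ∖ A)
    neg-code {γ} {A} γ∈ h = δ∈ , (case total _ δ∈ of λ (B , k) →
      coded-ext δ∈ k λ z → mk⇔ (from ∈∖ ∘ to (spec k z)) (from (spec k z) ∘ to ∈∖))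
      where
      δ∈ = neg∈ γ (tag 1 γ) γ∈ (tag-isTag 1 γ)
      spec : ∀ {B} → Int [ tag 1 γ ]≔ B → ∀ z → z ∈ B ⇔ (z ∈ Str × z ∉ A)
      spec k = neg γ (tag 1 γ) A _ (tag-isTag 1 γ) h k

    meet-code : ∀ {p q A B} → p ∈ 𝔹 → q ∈ 𝔹 → Int [ p ]≔ A → Int [ q ]≔ B →
                tag 3 ⦅ p , q ⦆ ∈ 𝔹 × Int [ tag 3 ⦅ p , q ⦆ ]≔ (A ∩ B)
    meet-code {p} {q} {A} {B} p∈ q∈ h k =
      δ∈ , (case total _ δ∈ of λ (I , l) → coded-ext δ∈ l λ z → mk⇔
        (λ z∈ → case to (spec l z) z∈ of λ (_ , m) → from ∈∩
          ( m p A (from (⦅⦆-isUPair p q p) (inj₁ ≈-refl)) h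
          , m q B (from (⦅⦆-isUPair p q q) (inj₂ ≈-refl)) k))
        (λ z∈ → from (spec l z) (subset h z (∩⊆ˡ z z∈) , λ γ C γ∈ C-at →
          case to (⦅⦆-isUPair p q γ) γ∈ of λ
            { (inj₁ e) → ∈-resp ≈-refl
                (functional _ _ _ h ([]≔-resp ≈-refl e ≈-refl C-at)) (∩⊆ˡ z z∈)
            ; (inj₂ e) → ∈-resp ≈-refl
                (functional _ _ _ k ([]≔-resp ≈-refl e ≈-refl C-at)) (∩⊆ʳ z z∈) })))
      where
      Γ = ⦅ p , q ⦆
      δ = tag 3 Γ
      δ∈ : δ ∈ 𝔹
      δ∈ = case pair-enumeration (num∈κ 0) (num∈κ 1) p∈ q∈ of λ (f , f-map , f-range) →
        meet∈ f Γ δ f-map f-range (tag-isTag 3 Γ)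
      spec : ∀ {I} → Int [ δ ]≔ I → ∀ z →
             z ∈ I ⇔ (z ∈ Str × (∀ γ A → γ ∈ Γ → Int [ γ ]≔ A → z ∈ A))
      spec = meet Γ δ _ (tag-isTag 3 Γ)

    -- A set has many codes, so the family of codes must be chosen inside V. Indices outside the
    -- image of `j` receive the default `γ₀`.
    choose-codes : ∀ {C j γ₀} → (∀ A → A ∈ C → Coded A) → Map j C κ → IsInjective j → γ₀ ∈ 𝔹 →
                   ∃ λ f → Map f κ 𝔹 ×
                   (∀ A → A ∈ C → ∃ λ α → ∃ λ γ → f [ α ]≔ γ × Int [ γ ]≔ A) ×
                   (∀ α γ → f [ α ]≔ γ → γ ≈ γ₀ ⊎ (∃ λ A → A ∈ C × Int [ γ ]≔ A))
    choose-codes {C} {j} {γ₀} coded j-map j-injective γ₀∈ =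
      case choose (graph-set r) κ 𝔹 (λ α α∈ → case code-at α of λ (γ , γ∈ , h) →
        γ , γ∈ , graph⇐ r α∈ γ∈ h) of λ (f , f-map , f⇒r) →
      f , f-map ,
      (λ A A∈ → case Map.total j-map A A∈ of λ (α , h) →
        case Map.total f-map α (proj₂ (Map-∈ j-map h)) of λ (γ , k) →
        α , γ , k , (case proj₂ (proj₂ (graph⇒ r (f⇒r α γ k))) of λ
          { (inj₁ (B , _ , l , m)) → []≔-resp ≈-refl ≈-refl (j-injective _ _ _ l h) m
          ; (inj₂ (none , _)) → contradiction (A , A∈ , h) none })) ,
      λ α γ k → case proj₂ (proj₂ (graph⇒ r (f⇒r α γ k))) of λ
          { (inj₁ (A , A∈ , _ , m)) → inj₂ (A , A∈ , m) ; (inj₂ (_ , e)) → inj₁ e }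
      where
      CodeAt : Ob → Ob → Set (lsuc ℓ)
      CodeAt α γ = (∃ λ A → A ∈ C × j [ A ]≔ α × Int [ γ ]≔ A) ⊎
                   ((¬ (∃ λ A → A ∈ C × j [ A ]≔ α)) × γ ≈ γ₀)
      r = relation CodeAt κ 𝔹 λ α γ →
        ∃ᵈ (v₀ ∈ᵈ con C ×ᵈ con j [ v₀ ]≔ᵈ wk α ×ᵈ con Int [ wk γ ]≔ᵈ v₀)
        ⊎ᵈ ((¬ᵈ ∃ᵈ (v₀ ∈ᵈ con C ×ᵈ con j [ v₀ ]≔ᵈ wk α)) ×ᵈ γ ≈ᵈ con γ₀)
      code-at : ∀ α → ∃ λ γ → γ ∈ 𝔹 × CodeAt α γ
      code-at α = case em {∃ λ A → A ∈ C × j [ A ]≔ α} of λ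
        { (yes (A , A∈ , h)) → case coded A A∈ of λ (γ , γ∈ , k) → γ , γ∈ , inj₁ (A , A∈ , h , k)
        ; (no none) → γ₀ , γ₀∈ , inj₂ (none , ≈-refl) }

    coded-⋃ : ∀ {C j U} → (∀ A → A ∈ C → Coded A) → Map j C κ → IsInjective j → Union C U → Coded U
    coded-⋃ {C} {j} {U} coded j-map j-injective U-union =
      case top of λ (⊤ᶜ , ⊤∈ , ⊤-at) →
      -- The default is a code of the empty set, so the surplus indices add nothing to the union.
      case neg-code ⊤∈ ⊤-at of λ (⊥∈ , ⊥-at) →
      case choose-codes coded j-map j-injective ⊥∈ of λ (f , f-map , covers , only) →
      case separate (λ γ → ∃ λ α → f [ α ]≔ γ) (λ γ → ∃ᵈ (con f [ v₀ ]≔ᵈ wk γ)) 𝔹 of λ (Γ , Γ-spec) →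
      let
        range : Range f Γ
        range γ = mk⇔ (proj₂ ∘ to (Γ-spec γ))
          (λ (α , h) → from (Γ-spec γ) (proj₂ (Map-∈ f-map h) , α , h))
        δ∈ = join∈ f Γ (tag 2 Γ) f-map range (tag-isTag 2 Γ)
      in tag 2 Γ , δ∈ ,
        (case total _ δ∈ of λ (B , h) → coded-ext δ∈ h λ z →
          let spec = join Γ (tag 2 Γ) B (tag-isTag 2 Γ) h z in mk⇔
          (λ z∈ → case to spec z∈ of λ (γ , A , γ∈ , k , z∈A) →
            case to (range γ) γ∈ of λ (α , l) → case only α γ l of λ
              { (inj₁ e) → contradiction (subset k z z∈A) (proj₂ (to ∈∖ (∈-resp ≈-refl
                  (functional _ _ _ ([]≔-resp ≈-refl e ≈-refl k) ⊥-at) z∈A)))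
              ; (inj₂ (A′ , A′∈ , m)) → from (U-union z)
                  (A′ , A′∈ , ∈-resp ≈-refl (functional _ _ _ k m) z∈A) })
          (λ z∈ → case to (U-union z) z∈ of λ (A , A∈ , z∈A) →
            case covers A A∈ of λ (α , γ , l , k) →
            from spec (γ , A , from (range γ) (α , l) , k , z∈A)))

    -- The part of the forcing order that does not depend on the measure: the code of the difference
    -- is interpreted by an empty set, which is null for every measure.
    Below-code : Ob → Ob → Set (lsuc ℓ)
    Below-code γ ζ = ∃ λ ν → ∃ λ Γ → ∃ λ δ → Tag 1 ζ ν × UPair γ ν Γ × Tag 3 Γ δ ×
      (∃ λ E → Int [ δ ]≔ E × Empty E)

    restrict-code : ∀ {p δ I A} → p ∈ 𝔹 → δ ∈ 𝔹 → Int [ p ]≔ I → Int [ δ ]≔ A →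
                    ∃ λ q → q ∈ 𝔹 × Int [ q ]≔ (I ∩ A) × Below-code q p
    restrict-code {p} {δ} p∈ δ∈ h k =
      case meet-code p∈ δ∈ h k of λ (q∈ , q-at) →
      case neg-code p∈ h of λ (n∈ , n-at) →
      case meet-code q∈ n∈ q-at n-at of λ (_ , l) →
      _ , q∈ , q-at , _ , _ , _ , tag-isTag 1 p , ⦅⦆-isUPair _ _ , tag-isTag 3 _ , _ , l ,
      λ z z∈ → proj₂ (to ∈∖ (∩⊆ʳ z z∈)) (∩⊆ˡ z (∩⊆ˡ z z∈))

-- Translations

module Translations {ℓ : Level} (Ob : Set (lsuc ℓ)) (_≈_ _∈_ : Ob → Ob → Set ℓ)
                    (em : ExcludedMiddle (lsuc ℓ)) (ax : Language.Axioms Ob _≈_ _∈_) where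

  open Language Ob _≈_ _∈_
  open Axioms ax
  open Theory em ax

  Bijection : Ob → Ob → Ob → Set (lsuc ℓ)
  Bijection A B f = Map f A B × IsInjective f × (∀ b → b ∈ B → ∃ λ a → f [ a ]≔ b)

  MutuallyInverse : Ob → Ob → Set (lsuc ℓ)
  MutuallyInverse g h = ∀ x y → g [ x ]≔ y ⇔ h [ y ]≔ x

  inverse-bijection : ∀ {X g} → Bijection X X g → ∃ λ h → Bijection X X h × MutuallyInverse g h
  inverse-bijection {X} {g} (g-map , g-injective , g-surjective) =
    graph-set r , (mapping r
        (λ {b} b∈ → case g-surjective b b∈ of λ (a , h) → a , proj₁ (Map-∈ g-map h) , h)
        (λ _ _ _ → g-injective _ _ _) ,
      (λ a b c h k → Map.functional g-map _ _ _ (from (inv c a) h) (from (inv c b) k)) ,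
      λ a a∈ → case Map.total g-map a a∈ of λ (b , h) → b , to (inv a b) h) , inv
    where
    r = relation (λ y x → g [ x ]≔ y) X X (λ y x → con g [ x ]≔ᵈ y)
    inv : MutuallyInverse g (graph-set r)
    inv x y = mk⇔ (λ h → graph⇐ r (proj₂ (Map-∈ g-map h)) (proj₁ (Map-∈ g-map h)) h)
      (λ h → proj₂ (proj₂ (graph⇒ r h)))

  composite-app : ∀ {g f c i x} → Composite g f c → c [ i ]≔ x ⇔ (∃ λ y → f [ i ]≔ y × g [ y ]≔ x)
  composite-app spec = mk⇔
    (λ (p , h , p∈) → case to (spec p) p∈ of λ (j , y , z , k , l , m) →
      let e , e′ = Pair-injective m h in
      y , []≔-resp ≈-refl e ≈-refl k , []≔-resp ≈-refl ≈-refl e′ l)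
    (λ (y , k , l) → _ , ⟨⟩-isPair _ _ , from (spec _) (_ , y , _ , k , l , ⟨⟩-isPair _ _))

  compose : ∀ {f g A B C} → Map f A B → Map g B C → ∃ λ c → Map c A C × Composite g f c
  compose {f} {g} {A} {B} {C} f-map g-map = graph-set r ,
    mapping r
      (λ {a} a∈ → case Map.total f-map a a∈ of λ (b , h) →
        case Map.total g-map b (proj₂ (Map-∈ f-map h)) of λ (c , k) →
        c , proj₂ (Map-∈ g-map k) , b , h , k)
      (λ { _ _ _ (b , h , k) (b′ , h′ , k′) → Map.functional g-map _ _ _ k
        ([]≔-resp ≈-refl (Map.functional f-map _ _ _ h′ h) ≈-refl k′) }) ,
    λ p → mk⇔
      (λ p∈ → case graph-pair r p p∈ of λ (a , c , _ , _ , h) →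
        case proj₂ (proj₂ (graph⇒ r (p , h , p∈))) of λ (b , k , l) → a , b , c , k , l , h)
      (λ (a , b , c , h , k , l) → []≔⇒∈ l
        (graph⇐ r (proj₁ (Map-∈ f-map h)) (proj₂ (Map-∈ g-map k)) (b , h , k)))
    where
    r = relation (λ a c → ∃ λ b → f [ a ]≔ b × g [ b ]≔ c) A C
      λ a c → ∃ᵈ (con f [ wk a ]≔ᵈ v₀ ×ᵈ con g [ v₀ ]≔ᵈ wk c)

  composite-unique : ∀ {f g c d} → Composite g f c → Composite g f d → c ≈ d
  composite-unique h k = ⊆-antisym (λ p → from (k p) ∘ to (h p)) (λ p → from (h p) ∘ to (k p))

  module _ {X g h : Ob} (g-map : Map g X X) (h-map : Map h X X) (inv : MutuallyInverse g h)
           {n a b : Ob} (a-map : Map a n X) (b-spec : Composite h a b) where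

    composite-map : Map b n X
    composite-map = case compose a-map h-map of λ (c , c-map , c-spec) →
      let e : c ≈ b
          e = composite-unique c-spec b-spec in record
      { graph      = λ p p∈ → Map.graph c-map p (∈-resp ≈-refl (≈-sym e) p∈)
      ; total      = λ i i∈ → case Map.total c-map i i∈ of λ (x , k) →
                       x , []≔-resp e ≈-refl ≈-refl k
      ; functional = λ i x y k l → Map.functional c-map i x y
                       ([]≔-resp (≈-sym e) ≈-refl ≈-refl k) ([]≔-resp (≈-sym e) ≈-refl ≈-refl l)
      }

    composite-inverse : Composite g b a
    composite-inverse p = mk⇔
      (λ p∈ → case Map.graph a-map p p∈ of λ (i , x , _ , x∈ , k) →
        case Map.total h-map x x∈ of λ (y , l) →
        i , y , x , from (composite-app b-spec) (x , (p , k , p∈) , l) , from (inv y x) l , k)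
      (λ (i , y , x , k , l , m) → case to (composite-app b-spec) k of λ (x′ , k′ , l′) →
        []≔⇒∈ m ([]≔-resp ≈-refl ≈-refl (Map.functional g-map _ _ _ (from (inv y x′) l′) l) k′))

  module _ (X L Str : Ob)
    (structure : ∀ M → M ∈ Str →
      (∀ p → p ∈ M → ∃ λ R → ∃ λ n → ∃ λ P →
        L [ R ]≔ n × (∀ a → a ∈ P → Map a n X) × Pair R P p) ×
      (∀ R n → L [ R ]≔ n → ∃ λ P → M [ R ]≔ P) ×
      (∀ R P Q → M [ R ]≔ P → M [ R ]≔ Q → P ≈ Q)) where

    Agree : Ob → Ob → Set (lsuc ℓ)
    Agree M N = ∀ R n a → L [ R ]≔ n → Map a n X → Realises M R a ⇔ Realises N R a

    -- Symbols of the language are the same for both structures, and each is interpreted by a set of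
    -- tuples of its own arity; the realised tuples therefore determine the interpretation.
    Agree⇒⊆ : ∀ {M N} → M ∈ Str → N ∈ Str → Agree M N → M ⊆ N
    Agree⇒⊆ {M} {N} M∈ N∈ agree p p∈ =
      case structure M M∈ of λ (M-graph , _ , M-functional) →
      case structure N N∈ of λ (N-graph , N-total , N-functional) →
      case M-graph p p∈ of λ (R , n , P , R∈ , tuples , h) →
      case N-total R n R∈ of λ (Q , k) →
      []≔⇒∈ h ([]≔-resp ≈-refl ≈-refl (⊆-antisym
        (λ a a∈ → case k of λ (q , k′ , q∈) → case N-graph q q∈ of
          λ (R′ , n′ , Q′ , R′∈ , tuples′ , l) →
          let e , e′ = Pair-injective l k′
              a-map = tuples′ a (∈-resp ≈-refl (≈-sym e′) a∈) in
          case from (agree R n′ a ([]≔-resp ≈-refl e ≈-refl R′∈) a-map) (Q , k , a∈) of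
          λ (P′ , m , a∈P′) → ∈-resp ≈-refl (M-functional _ _ _ m (p , h , p∈)) a∈P′)
        (λ a a∈ → case to (agree R n a R∈ (tuples a a∈)) (P , (p , h , p∈) , a∈) of
          λ (Q′ , m , a∈Q′) → ∈-resp ≈-refl (N-functional _ _ _ m k) a∈Q′)) k)

    Agree⇒≈ : ∀ {M N} → M ∈ Str → N ∈ Str → Agree M N → M ≈ N
    Agree⇒≈ M∈ N∈ agree = ⊆-antisym (Agree⇒⊆ M∈ N∈ agree)
      (Agree⇒⊆ N∈ M∈ λ R n a R∈ h → mk⇔ (from (agree R n a R∈ h)) (to (agree R n a R∈ h)))

    Translate : Ob → Ob → Ob → Set (lsuc ℓ)
    Translate g M N = N ∈ Str × (∀ R n a b → L [ R ]≔ n → Map a n X → Composite g a b →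
      Realises N R b ⇔ Realises M R a)

    TranslateSet : Ob → Ob → Ob → Set (lsuc ℓ)
    TranslateSet g A B = ∀ N → N ∈ B ⇔ (∃ λ M → M ∈ A × Translate g M N)

    Mapᵈ : ∀ {n f g h} → Term {n} f → Term {n} g → Term {n} h →
           Definable (λ ρ → Map (f ρ) (g ρ) (h ρ))
    Mapᵈ f A B = definable (formula d)
      (λ ρ s → let x , y , z = holds d ρ s in record { graph = x ; total = y ; functional = z })
      (λ ρ m → captures d ρ (Map.graph m , Map.total m , Map.functional m))
      where
      d = ∀ᵈ (v₀ ∈ᵈ wk f →ᵈ ∃ᵈ (∃ᵈ (v₁ ∈ᵈ wk (wk (wk A)) ×ᵈ v₀ ∈ᵈ wk (wk (wk B)) ×ᵈ Pairᵈ v₁ v₀ v₂)))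
        ×ᵈ ∀ᵈ (v₀ ∈ᵈ wk A →ᵈ ∃ᵈ (wk (wk f) [ v₁ ]≔ᵈ v₀))
        ×ᵈ ∀ᵈ (∀ᵈ (∀ᵈ (wk (wk (wk f)) [ v₂ ]≔ᵈ v₁ →ᵈ wk (wk (wk f)) [ v₂ ]≔ᵈ v₀ →ᵈ v₁ ≈ᵈ v₀)))

    Translateᵈ : ∀ g → Definable₂ (Translate g)
    Translateᵈ g M N = N ∈ᵈ con Str ×ᵈ ∀ᵈ (∀ᵈ (∀ᵈ (∀ᵈ
      ( con L [ v₃ ]≔ᵈ v₂ →ᵈ Mapᵈ v₁ v₂ (con X) →ᵈ Compositeᵈ (con g) v₁ v₀ →ᵈ
        (Realisesᵈ (wk (wk (wk (wk N)))) v₃ v₀ ⇔ᵈ Realisesᵈ (wk (wk (wk (wk M)))) v₃ v₁)))))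

    module _ {g h : Ob} (g-map : Map g X X) (h-map : Map h X X) (inv : MutuallyInverse g h) where

      Translate-inverse : ∀ {M N} → M ∈ Str → Translate g M N → Translate h N M
      Translate-inverse M∈ (_ , t) = M∈ , λ R n a b R∈ a-map b-spec →
        let realises = t R n b a R∈ (composite-map g-map h-map inv a-map b-spec)
                         (composite-inverse g-map h-map inv a-map b-spec) in
        mk⇔ (from realises) (to realises)

      -- Translation is given by a relation, so uniqueness has to be proved: truth at a tuple a in
      -- `M` and in `M′` both amount to truth at its image under g in `N`.
      Translate-injective : ∀ {M M′ N} → M ∈ Str → M′ ∈ Str → Translate g M N → Translate h N M′ →
                            M ≈ M′
      Translate-injective M∈ M′∈ (_ , t) (_ , t′) = Agree⇒≈ M∈ M′∈ λ R n a R∈ a-map →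
        case compose a-map g-map of λ (b , b-map , b-spec) →
        let there = t R n a b R∈ a-map b-spec
            back  = t′ R n b a R∈ b-map (composite-inverse h-map g-map
                      (λ y x → mk⇔ (from (inv x y)) (to (inv x y))) a-map b-spec) in
        mk⇔ (from back ∘ from there) (to there ∘ to back)

    -- `C` consists of the structures in `A` whose translate lies in `D`. Presenting it as a
    -- translate of `D` by the inverse bijection is what later gives its measurability and its
    -- measure.
    translate-back : ∀ {g A B D} → Bijection X X g → A ⊆ Str → TranslateSet g A B → D ⊆ B →
                     ∃ λ h → ∃ λ C → Bijection X X h × C ⊆ A × TranslateSet h D C
    translate-back {g} {A} {B} {D} g-bij A⊆ spec D⊆ =
      case inverse-bijection g-bij of λ (h , h-bij , inv) →
      case separate (λ M → ∃ λ N → N ∈ D × Translate g M N)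
        (λ M → ∃ᵈ (v₀ ∈ᵈ con D ×ᵈ Translateᵈ g (wk M) v₀)) A of λ (C , C-spec) →
      h , C , h-bij , (λ M → proj₁ ∘ to (C-spec M)) , λ M → mk⇔
        (λ M∈ → case to (C-spec M) M∈ of λ (M∈A , N , N∈ , t) →
          N , N∈ , Translate-inverse (proj₁ g-bij) (proj₁ h-bij) inv (A⊆ M M∈A) t)
        (λ (N , N∈ , t) → case to (spec N) (D⊆ N N∈) of λ (M′ , M′∈ , t′) →
          let e = Translate-injective (proj₁ g-bij) (proj₁ h-bij) inv (A⊆ M′ M′∈) (proj₁ t) t′ t in
          from (C-spec M) (∈-resp e ≈-refl M′∈ , N , N∈ ,
            respects (Translateᵈ g v₀ v₁) (e , ≈-refl , tt) t′))

-- Real-valued measures given by their graphs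

module RealMeasures {ℓ : Level} (Ob : Set (lsuc ℓ)) (_≈_ _∈_ : Ob → Ob → Set ℓ)
                    (em : ExcludedMiddle (lsuc ℓ)) (ax : Language.Axioms Ob _≈_ _∈_) where

  open Language Ob _≈_ _∈_
  open Axioms ax
  open Theory em ax
  open MeasureTheory Ob _≈_ _∈_ em ax

  module _ {f : Ob} {c : ℕ → Ob} {Y : Ob} (f-map : Map f ω Y) (f-at : ∀ k → f [ num k ]≔ c k) where

    index : ∀ {i B} → f [ i ]≔ B → ∃ λ k → i ≈ num k × B ≈ c k
    index h = case ∈ω⇒num (proj₁ (Map-∈ f-map h)) of λ (k , e) →
      k , e , Map.functional f-map _ _ _ h ([]≔-resp ≈-refl (≈-sym e) ≈-refl (f-at k))

    Disjoint-values : Disjoint c → ∀ i j B C → i ≉ j → f [ i ]≔ B → f [ j ]≔ C →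
                      ∀ M → ¬ (M ∈ B × M ∈ C)
    Disjoint-values disjoint i j B C i≉j h k M (M∈B , M∈C) =
      case index h of λ (m , e , e′) → case index k of λ (n , l , l′) → case ℕₚ.<-cmp m n of λ
        { (tri< m<n _ _) → disjoint m<n M (≈⇒⊆ e′ M M∈B) (≈⇒⊆ l′ M M∈C)
        ; (tri≈ _ refl _) → i≉j (≈-trans e (≈-sym l))
        ; (tri> _ _ n<m) → disjoint n<m M (≈⇒⊆ l′ M M∈C) (≈⇒⊆ e′ M M∈B) }

    ⋃-values : ∀ {U} → ⋃[ c ]≔ U → ∀ M → M ∈ U ⇔ (∃ λ i → ∃ λ B → f [ i ]≔ B × M ∈ B)
    ⋃-values spec M = mk⇔
      (λ h → case to (spec M) h of λ (k , M∈) → num k , c k , f-at k , M∈)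
      (λ (i , B , h , M∈) → case index h of λ (k , _ , e) → from (spec M) (k , ≈⇒⊆ e M M∈))

    term-unique : ∀ {μ 𝓑 R i k B x y} → Map μ 𝓑 R → i ≈ num k → f [ i ]≔ B → μ [ B ]≔ x →
                  μ [ c k ]≔ y → x ≈ y
    term-unique μ-map e h k l = Map.functional μ-map _ _ _ k ([]≔-resp ≈-refl
      (Map.functional f-map _ _ _ (f-at _) ([]≔-resp ≈-refl e ≈-refl h)) ≈-refl l)

  Map-ext : ∀ {f g A B} → Map f A B → Map g A B → (∀ {a x y} → f [ a ]≔ x → g [ a ]≔ y → x ≈ y) →
            f ≈ g
  Map-ext f-map g-map agree = ⊆-antisym (half f-map g-map agree)
    (half g-map f-map λ h k → ≈-sym (agree k h))
    where
    half : ∀ {f g A B} → Map f A B → Map g A B → (∀ {a x y} → f [ a ]≔ x → g [ a ]≔ y → x ≈ y) → f ⊆ g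
    half f-map g-map agree p p∈ = case Map.graph f-map p p∈ of λ (a , x , a∈ , _ , h) →
      case Map.total g-map a a∈ of λ (y , k) →
      []≔⇒∈ h ([]≔-resp ≈-refl ≈-refl (≈-sym (agree (p , h , p∈) k)) k)

  countable-union : ∀ {c C U} → (∀ A → A ∈ C ⇔ (∃ λ k → A ≈ c k)) → Union C U → ⋃[ c ]≔ U
  countable-union C-spec U-spec M = mk⇔
    (λ h → case to (U-spec M) h of λ (A , A∈ , M∈) → case to (C-spec A) A∈ of λ (k , e) →
      k , ≈⇒⊆ e M M∈)
    (λ (k , M∈) → from (U-spec M) (_ , from (C-spec _) (k , ≈-refl) , M∈))

  -- The additive part of the reals of V with halves adjoined. The graphs `add` and `le` are kept
  -- because formulas can speak of addition and order only through sets.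
  record RealLine : Set (lsuc ℓ) where
    field
      R add le : Ob

    Real : Set (lsuc ℓ)
    Real = Σ Ob (_∈ R)

    infix  4 _≈ᴿ_ _≤ᴿ_
    infixl 6 _+ᴿ_

    _≈ᴿ_ : Real → Real → Set ℓ
    x ≈ᴿ y = proj₁ x ≈ proj₁ y

    _≤ᴿ_ : Real → Real → Set (lsuc ℓ)
    x ≤ᴿ y = ∃ λ p → Pair (proj₁ x) (proj₁ y) p × p ∈ le

    ≤ᴿ-resp : ∀ x x′ y y′ → x ≈ᴿ x′ → y ≈ᴿ y′ → x ≤ᴿ y → x′ ≤ᴿ y′
    ≤ᴿ-resp _ _ _ _ e e′ (p , h , p∈) = p , Pair-resp e e′ ≈-refl h , p∈

    field
      _+ᴿ_           : Real → Real → Real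
      -ᴿ_            : Real → Real
      0ᴿ 1ᴿ          : Real
      add-graph      : ∀ x y z p → Pair (proj₁ x) (proj₁ y) p →
                       add [ p ]≔ proj₁ z ⇔ (x +ᴿ y ≈ᴿ z)
      isAbelianGroup : IsAbelianGroup _≈ᴿ_ _+ᴿ_ 0ᴿ -ᴿ_
      isTotalOrder   : IsTotalOrder _≈ᴿ_ _≤ᴿ_
      +-monoˡ        : ∀ x y z → x ≤ᴿ y → (x +ᴿ z) ≤ᴿ (y +ᴿ z)
      half           : ∀ x → ∃ λ h → h +ᴿ h ≈ᴿ x
      complete       : ∀ A → A ⊆ R → (∃ λ x → x ∈ A) →
                       (∃ λ (b : Real) → ∀ (x : Real) → proj₁ x ∈ A → x ≤ᴿ b) →
                       ∃ λ (s : Real) → (∀ (x : Real) → proj₁ x ∈ A → x ≤ᴿ s) ×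
                         (∀ b → (∀ (x : Real) → proj₁ x ∈ A → x ≤ᴿ b) → s ≤ᴿ b)

    values : Values (lsuc ℓ) ℓ (lsuc ℓ)
    values = record
      { 1# = 1ᴿ ; isAbelianGroup = isAbelianGroup ; isTotalOrder = isTotalOrder
      ; +-monoˡ = +-monoˡ ; half = half }

  module _ {Str 𝓑 : Ob} (S : MeasurableSpace Str 𝓑) (ℝ : RealLine) where
    open MeasurableSpace S
    open RealLine ℝ
    open Values values using (Lub; lub; sum)

    -- Countable additivity is phrased with partial sums along ℕ; `measureGraph` derives it from
    -- suprema over finite subsets of ω.
    record MeasureGraph (μ : Ob) : Set (lsuc ℓ) where
      field
        function : Map μ 𝓑 R
        nonneg   : ∀ A (r : Real) → μ [ A ]≔ proj₁ r → 0ᴿ ≤ᴿ r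
        empty    : ∀ E → Empty E → μ [ E ]≔ proj₁ 0ᴿ
        whole    : μ [ Str ]≔ proj₁ 1ᴿ
        additive : ∀ {c U} (r : ℕ → Real) → Internal c 𝓑 → Disjoint c → ⋃[ c ]≔ U →
                   (∀ k → μ [ c k ]≔ proj₁ (r k)) → ∃ λ u → μ [ U ]≔ proj₁ u × Lub (sum r) u

      -- The value 0 outside 𝓑 is junk.
      value′ : ∀ A → Dec (A ∈ 𝓑) → Real
      value′ A (yes a) = let x , h = Map.total function A a in x , proj₂ (Map-∈ function h)
      value′ A (no _)  = 0ᴿ

      value : Ob → Real
      value A = value′ A em₀

      value-at : ∀ {A} → A ∈ 𝓑 → μ [ A ]≔ proj₁ (value A)
      value-at {A} a = go em₀
        where
        go : ∀ d → μ [ A ]≔ proj₁ (value′ A d)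
        go (yes a′) = proj₂ (Map.total function A a′)
        go (no a∉)  = contradiction a a∉

      value-unique : ∀ {A x} → μ [ A ]≔ x → proj₁ (value A) ≈ x
      value-unique h = Map.functional function _ _ _ (value-at (proj₁ (Map-∈ function h))) h

      value-cong : ∀ {A B} → A ≈ B → value A ≈ᴿ value B
      value-cong {A} {B} e with em₀ {A ∈ 𝓑} | em₀ {B ∈ 𝓑}
      ... | yes a | yes b = Map.functional function _ _ _ (proj₂ (Map.total function A a))
        ([]≔-resp ≈-refl (≈-sym e) ≈-refl (proj₂ (Map.total function B b)))
      ... | no _  | no _  = ≈-refl
      ... | yes a | no b  = contradiction (measurable-resp e a) b
      ... | no a  | yes b = contradiction (measurable-resp (≈-sym e) b) a

    open MeasureGraph using (value; value-at; value-unique)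

    compare : ∀ {μ ν} (m : MeasureGraph μ) (n : MeasureGraph ν) →
              ∃ λ N → ∀ C → C ∈ N ⇔ (C ∈ 𝓑 × value m C ≤ᴿ value n C)
    compare {μ} {ν} m n =
      case separate (λ C → ∃ λ x → ∃ λ y → ∃ λ p → μ [ C ]≔ x × ν [ C ]≔ y × Pair x y p × p ∈ le)
        (λ C → ∃ᵈ (∃ᵈ (∃ᵈ (con μ [ wk (wk (wk C)) ]≔ᵈ v₂ ×ᵈ con ν [ wk (wk (wk C)) ]≔ᵈ v₁
          ×ᵈ Pairᵈ v₂ v₁ v₀ ×ᵈ v₀ ∈ᵈ con le)))) 𝓑 of λ (N , N-spec) →
      N , λ C → mk⇔
        (λ h → case to (N-spec C) h of λ (C∈ , x , y , p , k , l , q , p∈) →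
          C∈ , p , Pair-resp (≈-sym (value-unique m k)) (≈-sym (value-unique n l)) ≈-refl q , p∈)
        (λ (C∈ , p , q , p∈) → from (N-spec C)
          (C∈ , _ , _ , p , value-at m C∈ , value-at n C∈ , q , p∈))

    doubles : ∀ {μ} (m : MeasureGraph μ) →
              ∃ λ Q → ∀ C D → Q [ C ]≔ D ⇔ (C ∈ 𝓑 × D ∈ 𝓑 × value m C ≤ᴿ (value m D +ᴿ value m D))
    doubles {μ} m = graph-set r , λ C D → mk⇔
      (λ h → case graph⇒ r h of λ (C∈ , D∈ , x , y , z , p , q , k , l , z∈ , i , a , j , q∈) →
        let i′ = Pair-resp (≈-sym (value-unique m l)) (≈-sym (value-unique m l)) ≈-refl i in
        C∈ , D∈ , q , Pair-resp (≈-sym (value-unique m k))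
          (≈-sym (to (add-graph (value m D) (value m D) (z , z∈) p i′) a)) ≈-refl j , q∈)
      (λ (C∈ , D∈ , q , j , q∈) → graph⇐ r C∈ D∈
        (_ , _ , _ , _ , q , value-at m C∈ , value-at m D∈ , proj₂ (value m D +ᴿ value m D) ,
         ⟨⟩-isPair _ _ , from
          (add-graph (value m D) (value m D) (value m D +ᴿ value m D) _ (⟨⟩-isPair _ _)) ≈-refl , j , q∈))
      where
      r = relation
        (λ C D → ∃ λ x → ∃ λ y → ∃ λ z → ∃ λ p → ∃ λ q → μ [ C ]≔ x × μ [ D ]≔ y × z ∈ R ×
          Pair y y p × add [ p ]≔ z × Pair x z q × q ∈ le) 𝓑 𝓑
        λ C D → ∃ᵈ (∃ᵈ (∃ᵈ (∃ᵈ (∃ᵈ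
          ( con μ [ wk (wk (wk (wk (wk C)))) ]≔ᵈ v₄ ×ᵈ con μ [ wk (wk (wk (wk (wk D)))) ]≔ᵈ v₃
          ×ᵈ v₂ ∈ᵈ con R ×ᵈ Pairᵈ v₃ v₃ v₁ ×ᵈ con add [ v₁ ]≔ᵈ v₂ ×ᵈ Pairᵈ v₄ v₂ v₀
          ×ᵈ v₀ ∈ᵈ con le)))))

    null-set : ∀ {μ} (m : MeasureGraph μ) → ∃ λ Z → ∀ C → C ∈ Z ⇔ (C ∈ 𝓑 × value m C ≈ᴿ 0ᴿ)
    null-set {μ} m =
      case separate (λ C → μ [ C ]≔ proj₁ 0ᴿ) (λ C → con μ [ C ]≔ᵈ con (proj₁ 0ᴿ)) 𝓑 of
      λ (Z , Z-spec) → Z , λ C → mk⇔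
        (λ h → let C∈ , k = to (Z-spec C) h in C∈ , value-unique m k)
        (λ (C∈ , e) → from (Z-spec C) (C∈ , []≔-resp ≈-refl ≈-refl e (value-at m C∈)))

    toMeasure : ∀ {μ} → MeasureGraph μ → Measure S values
    toMeasure {μ} m = record
      { ⟪_⟫      = value m
      ; ⟪⟫-cong  = value-cong
      ; nonneg   = λ {A} a → nonneg A (value m A) (value-at m a)
      ; null-∅   = value-unique m (empty ∅ ∅-empty)
      ; whole    = value-unique m whole
      ; additive = λ {c} {U} i d u →
          case additive (value m ∘ c) i d u (λ k → value-at m (internal-∈ i k)) of λ (v , h , lub up low) →
          let e = value-unique m h in
          lub (λ n → ≤ᴿ-resp (sum (value m ∘ c) n) (sum (value m ∘ c) n) v (value m U) ≈-refl (≈-sym e) (up n))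
            λ {t} l → ≤ᴿ-resp v (value m U) t t (≈-sym e) ≈-refl (low {t} l)
      ; complete = λ {K} K⊆ (A , A∈) bound →
          -- The values attained on `K` form a set of V because the graph of the measure is one, so
          -- completeness of the reals of V applies.
          case separate (λ x → ∃ λ A → A ∈ K × μ [ A ]≔ x)
            (λ x → ∃ᵈ (v₀ ∈ᵈ con K ×ᵈ con μ [ v₀ ]≔ᵈ wk x)) R of λ (W , W-spec) →
          let
            attained : ∀ {t} → (∀ {A} → A ∈ K → value m A ≤ᴿ t) → ∀ x → proj₁ x ∈ W → x ≤ᴿ t
            attained {t} b x x∈ = case proj₂ (to (W-spec _) x∈) of λ (B , B∈ , h) →
              ≤ᴿ-resp (value m B) x t t (value-unique m h) ≈-refl (b B∈)
            value∈W : ∀ {A} → A ∈ K → proj₁ (value m A) ∈ W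
            value∈W {A} A∈ = from (W-spec _) (proj₂ (value m A) , A , A∈ , value-at m (K⊆ A A∈))
          in
          case RealLine.complete ℝ W (λ x → proj₁ ∘ to (W-spec x)) (proj₁ (value m A) , value∈W A∈)
            (1ᴿ , attained {1ᴿ} bound) of λ (s , up , low) →
          s , lub (λ (B , B∈) → up (value m B) (value∈W B∈))
            λ {t} l → low t (attained {t} λ {B} B∈ → l (B , B∈))
      ; twice    = doubles m
      }
      where open MeasureGraph m hiding (value; value-at; value-unique)

-- Conditions inside a set of full measure

module DenseSets {ℓ : Level} (Ob : Set (lsuc ℓ)) (_≈_ _∈_ : Ob → Ob → Set ℓ)
                 (em : ExcludedMiddle (lsuc ℓ)) (ax : Language.Axioms Ob _≈_ _∈_) where

  open Language Ob _≈_ _∈_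
  open Axioms ax
  open Theory em ax
  open MeasureTheory Ob _≈_ _∈_ em ax
  open Coding Ob _≈_ _∈_ em ax

  module _ {κ Str 𝓑 𝔹 Int : Ob} (𝓘 : Interpretation κ Str 𝔹 Int) (S : MeasurableSpace Str 𝓑)
           (𝓥 : Values (lsuc ℓ) ℓ (lsuc ℓ)) (ν : Measure S 𝓥) where
    open Interpretation 𝓘 using (Below-code; restrict-code)
    open MeasurableSpace S
    open Values 𝓥 using (0#; 1#; +-cancelʳ-≈; comm; identityˡ; ∙-cong) renaming
      (_≈_ to _≈ᵛ_; ≈-sym to ≈ᵛ-sym; ≈-trans to ≈ᵛ-trans)
    open Measure ν

    full-∩ : ∀ {A C} → A ∈ 𝓑 → ⟪ A ⟫ ≈ᵛ 1# → C ∈ 𝓑 → ⟪ C ∩ A ⟫ ≈ᵛ 0# → ⟪ C ⟫ ≈ᵛ 0#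
    full-∩ {A} {C} a full c null = ≈ᵛ-trans (split c a) (≈ᵛ-trans
      (∙-cong null (null-⊆ (∖-measurable c a) (∁-measurable a)
        (λ z h → from ∈∖ (subset c z (∖⊆ z h) , proj₂ (to ∈∖ h))) ∁-null))
      (identityˡ _))
      where
      ∁-null : ⟪ Str ∖ A ⟫ ≈ᵛ 0#
      ∁-null = +-cancelʳ-≈ ⟪ A ⟫ (≈ᵛ-trans (comm _ _) (≈ᵛ-trans (complement-sum S 𝓥 ν a)
        (≈ᵛ-trans (≈ᵛ-sym full) (≈ᵛ-sym (identityˡ _)))))

    -- Intersecting a condition with a set of full measure costs only a null set, so it stays
    -- positive. Positivity is written as not belonging to the set `Z` of null sets, which makes `D`
    -- definable.
    dense-inside : ∀ {A δ Z} → (∀ C → C ∈ Z ⇔ (C ∈ 𝓑 × ⟪ C ⟫ ≈ᵛ 0#)) →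
                   A ∈ 𝓑 → ⟪ A ⟫ ≈ᵛ 1# → δ ∈ 𝔹 → Int [ δ ]≔ A →
                   ∃ λ D →
                   (∀ γ → γ ∈ D ⇔ (γ ∈ 𝔹 × ∃ λ C → Int [ γ ]≔ C × C ⊆ A × C ∈ 𝓑 × C ∉ Z)) ×
                   (∀ p C → p ∈ 𝔹 → Int [ p ]≔ C → C ∈ 𝓑 → C ∉ Z → ∃ λ q → q ∈ D × Below-code q p)
    dense-inside {A} {δ} {Z} null a full δ∈ δ-at =
      case separate (λ γ → ∃ λ C → Int [ γ ]≔ C × C ⊆ A × C ∈ 𝓑 × C ∉ Z)
        (λ γ → ∃ᵈ (con Int [ wk γ ]≔ᵈ v₀ ×ᵈ v₀ ⊆ᵈ con A ×ᵈ v₀ ∈ᵈ con 𝓑 ×ᵈ (¬ᵈ (v₀ ∈ᵈ con Z))))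
        𝔹 of λ (D , D-spec) →
      D , D-spec , λ p C p∈ p-at c C∉Z →
        case restrict-code p∈ δ∈ p-at δ-at of λ (q , q∈ , q-at , q≤p) →
        q , from (D-spec q) (q∈ , C ∩ A , q-at , ∩⊆ʳ , ∩-measurable c a ,
          λ h → C∉Z (from (null C) (c , full-∩ a full c (proj₂ (to (null _) h))))) , q≤p

-- Models of set theory

≈ᵁ-refl : ∀ {ℓ} (x : 𝕍 ℓ) → x ≈ᵁ x
≈ᵁ-refl (sup A f) = (λ a → a , ≈ᵁ-refl (f a)) , (λ a → a , ≈ᵁ-refl (f a))

≈ᵁ-sym : ∀ {ℓ} (x y : 𝕍 ℓ) → x ≈ᵁ y → y ≈ᵁ x
≈ᵁ-sym (sup A f) (sup B g) (h , k) =
  (λ b → let a , e = k b in a , ≈ᵁ-sym (f a) (g b) e) ,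
  (λ a → let b , e = h a in b , ≈ᵁ-sym (f a) (g b) e)

≈ᵁ-trans : ∀ {ℓ} (x y z : 𝕍 ℓ) → x ≈ᵁ y → y ≈ᵁ z → x ≈ᵁ z
≈ᵁ-trans (sup A f) (sup B g) (sup C h) (p , q) (p′ , q′) =
  (λ a → let b , e = p a ; c , e′ = p′ b in c , ≈ᵁ-trans (f a) (g b) (h c) e e′) ,
  (λ c → let b , e′ = q′ c ; a , e = q b in a , ≈ᵁ-trans (f a) (g b) (h c) e e′)

∈ᵁ-resp : ∀ {ℓ} (x x′ y y′ : 𝕍 ℓ) → x ≈ᵁ x′ → y ≈ᵁ y′ → x ∈ᵁ y → x′ ∈ᵁ y′
∈ᵁ-resp x x′ (sup A f) (sup B g) e (h , _) (a , e′) = let b , e″ = h a in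
  b , ≈ᵁ-trans x′ x (g b) (≈ᵁ-sym x x′ e) (≈ᵁ-trans x (f a) (g b) e′ e″)

∈ᵁ-wf : ∀ {ℓ} → WellFounded (_∈ᵁ_ {ℓ})
∈ᵁ-wf (sup A f) = acc λ {y} (a , e) → acc-resp e (∈ᵁ-wf (f a))
  where
  acc-resp : ∀ {x y} → y ≈ᵁ x → Acc _∈ᵁ_ x → Acc _∈ᵁ_ y
  acc-resp {x} {y} e (acc r) = acc λ {z} z∈ → r (∈ᵁ-resp z z y x (≈ᵁ-refl z) e z∈)

-- From formulas with constants to formulas with parameters

module Interpreting {ℓ : Level} (V : 𝕍 ℓ → Set (lsuc ℓ)) where
  open Relativised V using (Ob; _≈_; _∈_; ⟦_⟧)
  open Language Ob _≈_ _∈_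

  Selects : ∀ {m k} → Vec Ob k → (Fin m → Fin k) → Vec Ob m → Set (lsuc ℓ)
  Selects ρ c ps = ∀ i → lookup ρ (c i) ≡ lookup ps i

  Reads : ∀ {n k} → Vec Ob k → (Fin n → Fin k) → Env n → Set (lsuc ℓ)
  Reads {n} ρ v σ = ∀ i → lookup ρ (v i) ≡ look {n} i σ

  Selects-++ˡ : ∀ {m n k} (ρ : Vec Ob k) (c : Fin (m ℕ.+ n) → Fin k) (ps : Vec Ob m) (qs : Vec Ob n) →
                Selects ρ c (ps ++ qs) → Selects ρ (c ∘ (_↑ˡ n)) ps
  Selects-++ˡ _ _ ps qs h i = ≡.trans (h (i ↑ˡ _)) (lookup-++ˡ ps qs i)

  Selects-++ʳ : ∀ {m n k} (ρ : Vec Ob k) (c : Fin (m ℕ.+ n) → Fin k) (ps : Vec Ob m) (qs : Vec Ob n) →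
                Selects ρ c (ps ++ qs) → Selects ρ (c ∘ (m ↑ʳ_)) qs
  Selects-++ʳ {m} _ _ ps qs h i = ≡.trans (h (m ↑ʳ i)) (lookup-++ʳ ps qs i)

  under : ∀ {n k} → (Fin n → Fin k) → Fin (suc n) → Fin (suc k)
  under v zero    = zero
  under v (suc i) = suc (v i)

  Reads-under : ∀ {n k} {ρ : Vec Ob k} {v : Fin n → Fin k} {σ : Env n} x →
                Reads ρ v σ → Reads (x ∷ ρ) (under v) (x , σ)
  Reads-under x h zero    = refl
  Reads-under x h (suc i) = h i

  -- The formulas of the separation scheme have no constants. A translation lists the constants it
  -- needs and is told where in the environment they (`c`) and the variables (`v`) are found;
  -- leaving these positions open lets lists of constants be concatenated.
  record TermTranslation {n : ℕ} (f : Env n → Ob) : Set (lsuc ℓ) where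
    field
      {size}    : ℕ
      constants : Vec Ob size
      translate : ∀ {k} → (Fin size → Fin k) → (Fin n → Fin k) → Fin k
      correct   : ∀ {k} c v (ρ : Vec Ob k) (σ : Env n) → Selects ρ c constants → Reads ρ v σ →
                  lookup ρ (translate c v) ≡ f σ

  translate-term : ∀ {n f} → Term {n} f → TermTranslation {n} f
  translate-term (var i) = record
    { constants = [] ; translate = λ _ v → v i ; correct = λ _ _ _ _ _ h → h i }
  translate-term (con x) = record
    { constants = x ∷ [] ; translate = λ c _ → c zero ; correct = λ _ _ _ _ h _ → h zero }

  record FormulaTranslation {n : ℕ} (P : Env n → Set (lsuc ℓ)) : Set (lsuc ℓ) where
    field
      {size}    : ℕ
      constants : Vec Ob size
      translate : ∀ {k} → (Fin size → Fin k) → (Fin n → Fin k) → Formula k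
      correct   : ∀ {k} c v (ρ : Vec Ob k) (σ : Env n) → Selects ρ c constants → Reads ρ v σ →
                  ⟦ translate c v ⟧ ρ ⇔ P σ

  atom : ∀ {n f g} (_~_ : Ob → Ob → Set ℓ) (φ : ∀ {k} → Fin k → Fin k → Formula k) →
         (∀ {k} i j {ρ : Vec Ob k} → ⟦ φ i j ⟧ ρ ≡ Lift (lsuc ℓ) (lookup ρ i ~ lookup ρ j)) →
         TermTranslation {n} f → TermTranslation {n} g →
         FormulaTranslation {n} (λ σ → Lift (lsuc ℓ) (f σ ~ g σ))
  atom _~_ φ φ-sat s t = record
    { constants = S.constants ++ T.constants
    ; translate = λ c v → φ (S.translate (c ∘ (_↑ˡ T.size)) v) (T.translate (c ∘ (S.size ↑ʳ_)) v)
    ; correct   = λ c v ρ σ h r → ⇔-reflexive (≡.trans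
        (φ-sat (S.translate (c ∘ (_↑ˡ T.size)) v) (T.translate (c ∘ (S.size ↑ʳ_)) v))
        (≡.cong₂ (λ x y → Lift (lsuc ℓ) (x ~ y))
          (S.correct (c ∘ (_↑ˡ T.size)) v ρ σ (Selects-++ˡ ρ c S.constants T.constants h) r)
          (T.correct (c ∘ (S.size ↑ʳ_)) v ρ σ (Selects-++ʳ ρ c S.constants T.constants h) r)))
    }
    where
    module S = TermTranslation s
    module T = TermTranslation t
    ⇔-reflexive : ∀ {A B : Set (lsuc ℓ)} → A ≡ B → A ⇔ B
    ⇔-reflexive refl = mk⇔ id id

  connective : ∀ {n} {P Q : Env n → Set (lsuc ℓ)} (_⊙_ : Set (lsuc ℓ) → Set (lsuc ℓ) → Set (lsuc ℓ))
               (φ : ∀ {k} → Formula k → Formula k → Formula k) →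
               (∀ {k} α β {ρ : Vec Ob k} {A B} → ⟦ α ⟧ ρ ⇔ A → ⟦ β ⟧ ρ ⇔ B → ⟦ φ α β ⟧ ρ ⇔ (A ⊙ B)) →
               FormulaTranslation {n} P → FormulaTranslation {n} Q →
               FormulaTranslation {n} (λ σ → P σ ⊙ Q σ)
  connective _⊙_ φ φ-sat s t = record
    { constants = S.constants ++ T.constants
    ; translate = λ c v → φ (S.translate (c ∘ (_↑ˡ T.size)) v) (T.translate (c ∘ (S.size ↑ʳ_)) v)
    ; correct   = λ c v ρ σ h r → φ-sat _ _
          (S.correct (c ∘ (_↑ˡ T.size)) v ρ σ (Selects-++ˡ ρ c S.constants T.constants h) r)
          (T.correct (c ∘ (S.size ↑ʳ_)) v ρ σ (Selects-++ʳ ρ c S.constants T.constants h) r)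
    }
    where
    module S = FormulaTranslation s
    module T = FormulaTranslation t

  translate-formula : ∀ {n} (φ : Fm n) → FormulaTranslation {n} (Sat φ)
  translate-formula (mem s t) = atom _∈_ _∈′_ (λ _ _ → refl) (translate-term s) (translate-term t)
  translate-formula (eq s t)  = atom _≈_ _≈′_ (λ _ _ → refl) (translate-term s) (translate-term t)
  translate-formula bot       = record
    { constants = [] ; translate = λ _ _ → ⊥′ ; correct = λ _ _ _ _ _ _ → mk⇔ id id }
  translate-formula (and φ ψ) = connective _×_ _∧′_
    (λ _ _ e e′ → mk⇔ (λ (x , y) → to e x , to e′ y) (λ (x , y) → from e x , from e′ y))
    (translate-formula φ) (translate-formula ψ)
  translate-formula (or φ ψ)  = connective _⊎_ _∨′_
    (λ _ _ e e′ → mk⇔ [ inj₁ ∘ to e , inj₂ ∘ to e′ ]′ [ inj₁ ∘ from e , inj₂ ∘ from e′ ]′)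
    (translate-formula φ) (translate-formula ψ)
  translate-formula (imp φ ψ) = connective (λ A B → A → B) _⇒′_
    (λ _ _ e e′ → mk⇔ (λ h → to e′ ∘ h ∘ from e) (λ h → from e′ ∘ h ∘ to e))
    (translate-formula φ) (translate-formula ψ)
  translate-formula {n} (all φ) = record
    { constants = F.constants
    ; translate = λ c v → ∀′ (F.translate (suc ∘ c) (under v))
    ; correct   = λ c v ρ σ h r → mk⇔
        (λ s x → to (F.correct (suc ∘ c) (under v) (x ∷ ρ) (x , σ) h (Reads-under {n} {σ = σ} x r)) (s x))
        (λ s x → from (F.correct (suc ∘ c) (under v) (x ∷ ρ) (x , σ) h (Reads-under {n} {σ = σ} x r)) (s x))
    }
    where module F = FormulaTranslation (translate-formula φ)
  translate-formula {n} (ex φ) = record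
    { constants = F.constants
    ; translate = λ c v → ∃′ (F.translate (suc ∘ c) (under v))
    ; correct   = λ c v ρ σ h r → mk⇔
        (λ (x , s) → x , to (F.correct (suc ∘ c) (under v) (x ∷ ρ) (x , σ) h (Reads-under {n} {σ = σ} x r)) s)
        (λ (x , s) → x , from (F.correct (suc ∘ c) (under v) (x ∷ ρ) (x , σ) h (Reads-under {n} {σ = σ} x r)) s)
    }
    where module F = FormulaTranslation (translate-formula φ)

  axioms : Relativised.IsTransitiveModelOfZFC V → Axioms
  axioms zfc = record
    { ≈-refl     = λ {x} → ≈ᵁ-refl (proj₁ x)
    ; ≈-sym      = λ {x} {y} → ≈ᵁ-sym (proj₁ x) (proj₁ y)
    ; ≈-trans    = λ {x} {y} {z} → ≈ᵁ-trans (proj₁ x) (proj₁ y) (proj₁ z)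
    ; ∈-resp     = λ {x} {x′} {y} {y′} → ∈ᵁ-resp (proj₁ x) (proj₁ x′) (proj₁ y) (proj₁ y′)
    ; ∈-wf       = On.wellFounded proj₁ ∈ᵁ-wf
    ; ext        = λ {x} {y} → extensionality x y
    ; pairing    = pairing
    ; union      = union
    ; power      = power
    ; infinity   = infinity
    ; separation = λ φ a →
        let module F = FormulaTranslation (translate-formula φ)
            -- The separated element stands at position zero and the parameters follow it, hence
            -- `suc` as the position of the constants.
            b , h = separation (F.translate suc (λ _ → zero)) F.constants a
            sat : ∀ x → ⟦ F.translate suc (λ _ → zero) ⟧ (x ∷ F.constants) ⇔ Sat φ (x , tt)
            sat x = F.correct suc (λ _ → zero) (x ∷ F.constants) (x , tt) (λ _ → refl) λ { zero → refl }
        in b , λ x → mk⇔ (λ k → proj₁ (to (h x) k) , to (sat x) (proj₂ (to (h x) k)))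
                          (λ (k , s) → from (h x) (k , from (sat x) s))
    ; choice     = choice
    }
    where open Relativised.IsTransitiveModelOfZFC zfc

-- Halves in an ordered field

module OrderedFields {a b c : Level} {A : Set a} {_≈_ : A → A → Set b} {_≤_ : A → A → Set c}
  {_+_ _*_ : A → A → A} { -_ : A → A } {0# 1# : A}
  (isCommutativeRing : IsCommutativeRing _≈_ _+_ _*_ -_ 0# 1#)
  (isTotalOrder : IsTotalOrder _≈_ _≤_)
  (+-monoˡ : ∀ x y z → x ≤ y → (x + z) ≤ (y + z))
  (*-nonneg : ∀ x y → 0# ≤ x → 0# ≤ y → 0# ≤ (x * y))
  (0≉1 : ¬ 0# ≈ 1#) (inverse : ∀ x → ¬ x ≈ 0# → ∃ λ y → (x * y) ≈ 1#) where

  private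
    ring : Ring a b
    ring = record { isRing = IsCommutativeRing.isRing isCommutativeRing }
  open IsCommutativeRing isCommutativeRing
    using (sym; trans; +-identityˡ; +-cong; -‿inverseʳ; *-identityˡ; *-identityʳ; *-congˡ;
           distribˡ; distribʳ)
    renaming (refl to ≈-refl)
  open IsTotalOrder isTotalOrder using (total; antisym; ≤-respˡ-≈; ≤-respʳ-≈)
  open RingProperties ring using (-1*x≈-x; -‿involutive)

  -- If 1 ≤ 0, then -1 is nonnegative, and so is its square, which is 1.
  0≤1 : 0# ≤ 1#
  0≤1 with total 0# 1#
  ... | inj₁ h = h
  ... | inj₂ h = ≤-respʳ-≈ (trans (-1*x≈-x (- 1#)) (-‿involutive 1#)) (*-nonneg _ _ 0≤-1 0≤-1)
    where
    0≤-1 : 0# ≤ (- 1#)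
    0≤-1 = ≤-respˡ-≈ (-‿inverseʳ 1#) (≤-respʳ-≈ (+-identityˡ _) (+-monoˡ _ _ (- 1#) h))

  2≉0 : ¬ (1# + 1#) ≈ 0#
  2≉0 e = 0≉1 (antisym 0≤1 (≤-respˡ-≈ (+-identityˡ 1#) (≤-respʳ-≈ e (+-monoˡ _ _ 1# 0≤1))))

  halve : ∀ x → ∃ λ h → (h + h) ≈ x
  halve x = let y , e = inverse _ 2≉0 in x * y ,
    trans (sym (distribˡ x y y)) (trans (*-congˡ (trans
      (+-cong (sym (*-identityˡ y)) (sym (*-identityˡ y))) (trans (sym (distribʳ y 1# 1#)) e)))
      (*-identityʳ x))

-- Ergodic measures and random generic filters

module Model {ℓ : Level} (em : ExcludedMiddle (lsuc ℓ)) (V : 𝕍 ℓ → Set (lsuc ℓ))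
             (zfc : Relativised.IsTransitiveModelOfZFC V) where

  module D = Relativised V
  open D using (Ob; _≈_; _∈_)
  open Language Ob _≈_ _∈_ hiding (Sat)

  abstract
    ax : Axioms
    ax = Interpreting.axioms V zfc

  open Axioms ax
  open Theory em ax
  open MeasureTheory Ob _≈_ _∈_ em ax
  open RealMeasures Ob _≈_ _∈_ em ax
  open Coding Ob _≈_ _∈_ em ax
  open Translations Ob _≈_ _∈_ em ax hiding (TranslateSet)
  open DenseSets Ob _≈_ _∈_ em ax

  fromD : ∀ {f A B} → D._∶_⟶_ f A B → Map f A B
  fromD m = record { graph = graph ; total = total ; functional = functional }
    where open D._∶_⟶_ m

  toD : ∀ {f A B} → Map f A B → D._∶_⟶_ f A B
  toD m = record { graph = graph ; total = total ; functional = functional }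
    where open Map m

  module _ (ℝ : D.Reals) where
    open D.Reals ℝ

    realLine : RealLine
    realLine = record
      { R = R ; add = add ; le = le ; _+ᴿ_ = _+ᴿ_ ; -ᴿ_ = -ᴿ_ ; 0ᴿ = 0ᴿ ; 1ᴿ = 1ᴿ
      ; add-graph = add-graph
      ; isAbelianGroup = IsCommutativeRing.+-isAbelianGroup isCommutativeRing
      ; isTotalOrder = isTotalOrder ; +-monoˡ = +-monoˡ
      ; half = OrderedFields.halve isCommutativeRing isTotalOrder +-monoˡ *-nonneg 0≉1 inverse
      ; complete = complete
      }

    open RealLine realLine using (values; ≤ᴿ-resp)
    private module 𝓥 = Values values

    -- Each entry of the list takes its own term out of `g`, leaving 0 behind; as the entries are
    -- distinct, no later one asks for that term again.
    finiteSum-≤ : ∀ {t : Ob → El → Set (lsuc ℓ)} n {is s} → FiniteSum t is s →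
                  (g : ℕ → El) → (∀ k → 0ᴿ ≤ᴿ g k) →
                  All (λ i → ∃ λ k → i ≈ num k × k ℕ.< n × (∀ r → t i r → r ≤ᴿ g k)) is →
                  AllPairs D._≉_ is → s ≤ᴿ 𝓥.sum g n
    finiteSum-≤ n {s = s} (nil e) g g≥0 [] [] =
      ≤ᴿ-resp 0ᴿ s (𝓥.sum g n) (𝓥.sum g n) (≈-sym {proj₁ s} {proj₁ 0ᴿ} e)
        (≈-refl {proj₁ (𝓥.sum g n)}) (𝓥.sum-nonneg {g} g≥0 n)
    finiteSum-≤ {t} n (cons {i} {is} {r} {s} {u} ti fs e) g g≥0 ((k , i≈ , k<n , bound) ∷ bounds) (i≉ ∷ distinct) =
      ≤ᴿ-resp (r +ᴿ s) u (g k +ᴿ 𝓥.sum g′ n) (𝓥.sum g n)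
        (≈-sym {proj₁ u} {proj₁ (r +ᴿ s)} e)
        (≈-sym {proj₁ (𝓥.sum g n)} {proj₁ (g k +ᴿ 𝓥.sum g′ n)} (𝓥.sum-without {g} {k} {n} k<n))
        (𝓥.+-mono {r} {g k} {s} {𝓥.sum g′ n} (bound r ti)
          (finiteSum-≤ n fs g′ (𝓥.without-nonneg {k} {g} g≥0) (zipWith shrink (i≉ , bounds)) distinct))
      where
      g′ = 𝓥.without k g
      shrink : ∀ {j} → (i D.≉ j) × (∃ λ l → j ≈ num l × l ℕ.< n × (∀ r → t j r → r ≤ᴿ g l)) →
               ∃ λ l → j ≈ num l × l ℕ.< n × (∀ r → t j r → r ≤ᴿ g′ l)
      shrink {j} (i≉j , l , j≈ , l<n , bound′) = l , j≈ , l<n , λ r tj →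
        ≤ᴿ-resp r r (g l) (g′ l) (≈-refl {proj₁ r})
          (≈-sym {proj₁ (g′ l)} {proj₁ (g l)} (𝓥.without-≢ {k} {g} {l} l≢k)) (bound′ r tj)
        where
        l≢k : ¬ l ≡ k
        l≢k refl = i≉j (≈-trans {i} {num k} {j} i≈ (≈-sym {j} {num k} j≈))

    numerals : ℕ → List Ob
    numerals zero    = []
    numerals (suc n) = num n ∷ numerals n

    numerals-All : ∀ {p} {P : Ob → Set p} → ∀ n → (∀ k → k ℕ.< n → P (num k)) → All P (numerals n)
    numerals-All zero    h = []
    numerals-All (suc n) h = h n ℕₚ.≤-refl ∷ numerals-All n λ k k<n → h k (ℕₚ.m<n⇒m<1+n k<n)

    numerals-distinct : ∀ n → AllPairs D._≉_ (numerals n)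
    numerals-distinct zero    = []
    numerals-distinct (suc n) = numerals-All n (λ k k<n e →
      ℕₚ.<⇒≢ k<n (≡.sym (num-injective {n} {k} e))) ∷ numerals-distinct n

    numerals-sum : ∀ {t : Ob → El → Set (lsuc ℓ)} (r : ℕ → El) → (∀ k → t (num k) (r k)) →
                   ∀ n → FiniteSum t (numerals n) (𝓥.sum r n)
    numerals-sum r h zero    = nil (≈-refl {proj₁ 0ᴿ})
    numerals-sum r h (suc n) = cons (h n) (numerals-sum r h n) (𝓥.comm (𝓥.sum r n) (r n))

  -- The measurable space of structures and its invariant measures

  module Structures (κ X L : Ob) (κ-ordinal : D.IsOrdinal κ) (κ-infinite : D.Infinite κ)
                    (𝓢 : D.BorelStructures κ X L) (ℝ : D.Reals) where
    open D.BorelStructures 𝓢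
    open D.Reals ℝ
    module M = D.Measures κ X L 𝓢 ℝ
    private
      module 𝓑-closed = D.SigmaClosed measurable
      line = realLine ℝ
    open RealLine line using (values; ≤ᴿ-resp)
    private module 𝓥 = Values values

    num∈κ : ∀ k → num k ∈ κ
    num∈κ = infinite-ordinal⊇ω {κ} (proj₁ κ-ordinal) (proj₂ κ-ordinal) λ k e →
      case identity-map {num k} {κ} e of λ (f , f-map , injective , surjective) →
      κ-infinite (num k , num-natural k , f , toD f-map , injective , surjective)

    space : MeasurableSpace Str 𝓑
    space = record
      { subset       = λ {A} → 𝓑-closed.subsets A
      ; ∅-measurable = 𝓑-closed.union ∅ ∅ (λ z h → contradiction h (∅-empty z))
          (∅ , toD ∅-map , λ a b c h → contradiction h (∅[]≔ {a} {c}))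
          (λ z → mk⇔ (λ h → contradiction h (∅-empty z))
            (λ (A , A∈ , _) → contradiction A∈ (∅-empty A)))
      ; ∁-measurable = λ {A} a → 𝓑-closed.complement A (Str ∖ A) a (λ z → ∈∖ {Str} {A} {z})
      ; ⋃-measurable = λ {c} i → case countable-range {c} {𝓑} {κ} i num∈κ of
          λ (C , C-spec , j , j-map , j-injective) → case union C of λ (U , U-spec) →
          U , 𝓑-closed.union C U
            (λ A A∈ → case to (C-spec A) A∈ of λ (k , e) →
              ∈-resp {c k} {A} {𝓑} {𝓑} (≈-sym {A} {c k} e) (≈-refl {𝓑}) (internal-∈ {c} {𝓑} i k))
            (j , toD j-map , j-injective) U-spec ,
            countable-union {c} {C} {U} C-spec U-spec
      }

    bounded : ∀ {is} → All (_∈ ω) is → ∃ λ N → All (λ i → ∃ λ k → i ≈ num k × k ℕ.< N) is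
    bounded []              = 0 , []
    bounded {i ∷ _} (i∈ ∷ is∈) =
      let k , e = ∈ω⇒num {i} i∈
          N , bounds = bounded is∈ in
      suc k ℕ.⊔ N ,
      (k , e , ℕₚ.m≤m⊔n (suc k) N) ∷
      All.map (λ (l , e′ , l<N) → l , e′ , ℕₚ.<-≤-trans l<N (ℕₚ.m≤n⊔m (suc k) N)) bounds

    -- The supremum over finite subsets of ω is the supremum of the partial sums: initial segments
    -- are finite subsets, and every finite subset lies below some N, where the terms it omits are
    -- nonnegative.
    measureGraph : ∀ {μ} → M.IsProbabilityMeasure μ → MeasureGraph space line μ
    measureGraph {μ} P = record
      { function = fromD function
      ; nonneg   = nonneg
      ; empty    = empty
      ; whole    = whole
      ; additive = λ {c} {U} r i disjoint U-spec c-at → case i of λ (f , f-map , f-at) →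
          case additive ω (proj₂ omega) f U (toD f-map)
            (Disjoint-values {f} {c} {𝓑} f-map f-at disjoint)
            (⋃-values {f} {c} {𝓑} f-map f-at {U} U-spec) of
          λ (v , v-at , upper , least) →
          let t : Ob → El → Set (lsuc ℓ)
              t = λ i r → ∃ λ B → f D.[ i ]≔ B × μ D.[ B ]≔ ⌊ r ⌋ in
          v , v-at , Values.lub
            (λ n → upper (𝓥.sum r n) (numerals ℝ n , numerals-All ℝ n (λ k _ → num∈ω k) ,
              numerals-distinct ℝ n , numerals-sum ℝ r (λ k → c k , f-at k , c-at k) n))
            (λ {x} h → least x λ s (is , is∈ , distinct , fs) → case bounded is∈ of λ (N , bounds) →
              𝓥.≤-trans {s} {𝓥.sum r N} {x}
                (finiteSum-≤ ℝ {t} N fs r (λ k → nonneg (c k) (r k) (c-at k))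
                  (All.map (λ {i} (k , e , k<N) → k , e , k<N , λ r′ (B , B-at , r′-at) →
                    𝓥.≤-reflexive {r′} {r k} (term-unique {f} {c} {𝓑} f-map f-at {μ} {𝓑} {R}
                      {i} {k} {B} {⌊ r′ ⌋} {⌊ r k ⌋} (fromD function) e B-at r′-at (c-at k))) bounds)
                  distinct)
                (h N))
      }
      where open M.IsProbabilityMeasure P

    structure : ∀ M → M ∈ Str →
      (∀ p → p ∈ M → ∃ λ S → ∃ λ n → ∃ λ P →
        L [ S ]≔ n × (∀ a → a ∈ P → Map a n X) × Pair S P p) ×
      (∀ S n → L [ S ]≔ n → ∃ λ P → M [ S ]≔ P) ×
      (∀ S P Q → M [ S ]≔ P → M [ S ]≔ Q → P ≈ Q)
    structure M M∈ =
      (λ p p∈ → case graph p p∈ of λ (S , n , P , S∈ , tuples , h) →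
        S , n , P , S∈ , (λ a a∈ → fromD (tuples a a∈)) , h) , total , functional
      where open D.IsStructure (to (structures M) M∈)

    private module T = Translations Ob _≈_ _∈_ em ax

    translate-set : ∀ {g A B} → M.TranslateSet g A B → T.TranslateSet X L Str structure g A B
    translate-set spec N = mk⇔
      (λ h → case to (spec N) h of λ (M , M∈ , N∈ , t) →
        M , M∈ , N∈ , λ S n a b S∈ a-map → t S n a b S∈ (toD a-map))
      (λ (M , M∈ , N∈ , t) → from (spec N)
        (M , M∈ , N∈ , λ S n a b S∈ a-map → t S n a b S∈ (fromD a-map)))

    translate-set⁻ : ∀ {g A B} → T.TranslateSet X L Str structure g A B → M.TranslateSet g A B
    translate-set⁻ spec N = mk⇔
      (λ h → case to (spec N) h of λ (M , M∈ , N∈ , t) →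
        M , M∈ , N∈ , λ S n a b S∈ a-map → t S n a b S∈ (fromD a-map))
      (λ (M , M∈ , N∈ , t) → from (spec N)
        (M , M∈ , N∈ , λ S n a b S∈ a-map → t S n a b S∈ (toD a-map)))

    bijection : ∀ {g} → D.IsBijection X X g → T.Bijection X X g
    bijection (g-map , h) = fromD g-map , h

    Translation : Ob → Ob → Set (lsuc ℓ)
    Translation A B = ∃ λ g → D.IsBijection X X g × M.TranslateSet g A B

    module _ {μ : Ob} (μ-ergodic : M.IsErgodicInvariantMeasure μ) where

      graph-of : MeasureGraph space line μ
      graph-of = measureGraph (proj₁ (proj₁ μ-ergodic))

      private module G = MeasureGraph graph-of

      measure : Measure space values
      measure = toMeasure space line graph-of

      private module μ = Measure measure

      -- Invariance assigns a value of μ to the translate, and μ is defined only on `𝓑`;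
      -- measurability of translates is thereby included.
      invariant : ∀ {A B} → Translation A B → A ∈ 𝓑 → B ∈ 𝓑 × μ.⟪ B ⟫ ≈ᴿ μ.⟪ A ⟫
      invariant {A} {B} (g , g-bij , spec) a =
        let h = proj₁ (proj₂ μ-ergodic) g A B ⌊ μ.⟪ A ⟫ ⌋ g-bij a spec (G.value-at {A} a) in
        proj₁ (Map-∈ {μ} {𝓑} {R} {B} {⌊ μ.⟪ A ⟫ ⌋} G.function h) , G.value-unique {B} {⌊ μ.⟪ A ⟫ ⌋} h

      ergodic : ∀ {A} → A ∈ 𝓑 →
                (∀ {B} → Translation A B → μ.⟪ (B ∖ A) ∪ (A ∖ B) ⟫ ≈ᴿ 0ᴿ) →
                μ.⟪ A ⟫ ≈ᴿ 0ᴿ ⊎ μ.⟪ A ⟫ ≈ᴿ 1ᴿ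
      ergodic {A} a h = case proj₂ (proj₂ μ-ergodic) A a null of λ
        { (inj₁ k) → inj₁ (G.value-unique {A} {⌊ 0ᴿ ⌋} k)
        ; (inj₂ k) → inj₂ (G.value-unique {A} {⌊ 1ᴿ ⌋} k) }
        where
        null : ∀ g B C → D.IsBijection X X g → M.TranslateSet g A B →
               D.SymmetricDifference B A C → μ D.[ C ]≔ ⌊ 0ᴿ ⌋
        null g B C g-bij spec sd =
          []≔-resp {μ} {μ} {S} {C} {⌊ μ.⟪ S ⟫ ⌋} {⌊ 0ᴿ ⌋} (≈-refl {μ})
            (ext {S} {C} λ z → mk⇔
              (λ k → from (sd z) ([ inj₁ ∘ to (∈∖ {B} {A} {z}) , inj₂ ∘ to (∈∖ {A} {B} {z}) ]′
                (to (∈∪ {B ∖ A} {A ∖ B} {z}) k)))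
              (λ k → from (∈∪ {B ∖ A} {A ∖ B} {z})
                ([ inj₁ ∘ from (∈∖ {B} {A} {z}) , inj₂ ∘ from (∈∖ {A} {B} {z}) ]′ (to (sd z) k))))
            (h {B} t) (G.value-at {S} S∈)
          where
          S = (B ∖ A) ∪ (A ∖ B)
          t : Translation A B
          t = g , g-bij , spec
          b = proj₁ (invariant {A} {B} t a)
          open MeasurableSpace space
          S∈ = ∪-measurable {B ∖ A} {A ∖ B} (∖-measurable {B} {A} b a) (∖-measurable {A} {B} a b)

    translate⁻¹ : ∀ {A B E} → Translation A B → A ∈ 𝓑 → E ⊆ B → ∃ λ C → C ⊆ A × Translation E C
    translate⁻¹ {A} {B} {E} (g , g-bij , spec) a E⊆ =
      case T.translate-back X L Str structure {g} {A} {B} {E} (bijection {g} g-bij)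
        (𝓑-closed.subsets A a) (translate-set {g} {A} {B} spec) E⊆ of
      λ (h , C , (h-map , h-rest) , C⊆ , spec′) →
      C , C⊆ , h , (toD h-map , h-rest) , translate-set⁻ {h} {E} {C} spec′

    singular-set : ∀ {μ ν B} (m : M.IsErgodicInvariantMeasure μ) (n : M.IsErgodicInvariantMeasure ν) →
                   let module μ = Measure (measure m)
                       module ν = Measure (measure n) in
                   B ∈ 𝓑 → ¬ ν.⟪ B ⟫ ≤ᴿ μ.⟪ B ⟫ →
                   ∃ λ A → A ∈ 𝓑 × μ.⟪ A ⟫ ≈ᴿ 0ᴿ × ν.⟪ A ⟫ ≈ᴿ 1ᴿ
    singular-set {μ} {ν} {B} m n b ν≰μ =
      case compare space line (graph-of m) (graph-of n) of λ (N , N-spec) →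
      case compare space line (graph-of n) (graph-of m) of λ (N′ , N′-spec) →
      singular space values (measure m) (measure n) Translation
        (λ {A} {B} t a → let b , e = invariant m {A} {B} t a in b , e , proj₂ (invariant n {A} {B} t a))
        (λ {A} {B} {E} t a e E⊆ → case translate⁻¹ {A} {B} {E} t a E⊆ of λ (C , C⊆ , t′) →
          let c , k = invariant m {E} {C} t′ e
              l = proj₂ (invariant n {E} {C} t′ e) in
          C , c , C⊆ ,
          ≈-sym {⌊ Measure.⟪_⟫ (measure m) C ⌋} {⌊ Measure.⟪_⟫ (measure m) E ⌋} k ,
          ≈-sym {⌊ Measure.⟪_⟫ (measure n) C ⌋} {⌊ Measure.⟪_⟫ (measure n) E ⌋} l)
        {N} {N′} {B} N-spec N′-spec (λ {A} → ergodic m {A}) (λ {A} → ergodic n {A}) b ν≰μ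

    -- Every measurable set has a code

    private
      module 𝓒 = D.CodeClosed codes
      module 𝓘 = D.IsInterpretation interpretation

    basic-code : ∀ {n s a} → D.Natural n → D.LiteralConjunction L n s → D._∶_⟶_ a n X →
      ∃ λ γ → γ ∈ 𝔹 × ∃ λ A → Int [ γ ]≔ A ×
        (∀ M → M ∈ A ⇔ (M ∈ Str × (∀ i φ → s [ i ]≔ φ → D._⊨_[_] X L Str Sat M φ a)))
    basic-code {n} {s} {a} n-natural literals a-map =
      case D._∶_⟶_.total (proj₂ (proj₂ 𝓘.function)) γ γ∈ of λ (A , h) →
      γ , γ∈ , A , h , 𝓘.basic n s a γ A n-natural literals a-map isBasic h
      where
      γ = tag 0 ⟨ s , a ⟩
      isBasic : D.BasicCode s a γ
      isBasic = ⟨ s , a ⟩ , ⟨⟩-isPair s a , tag-isTag 0 ⟨ s , a ⟩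
      γ∈ = 𝓒.basic n s a γ n-natural literals a-map isBasic

    codeInterpretation : Interpretation κ Str 𝔹 Int
    codeInterpretation = record
      { num∈κ      = num∈κ
      ; total      = D._∶_⟶_.total Int-map
      ; functional = D._∶_⟶_.functional Int-map
      ; subset     = λ {γ} {A} h → to (proj₁ (proj₂ 𝓘.function) A)
                       (proj₂ (Map-∈ {Int} {𝔹} {proj₁ 𝓘.function} {γ} {A} (fromD Int-map) h))
      -- The empty conjunction at the empty tuple holds in every structure, so it codes the whole
      -- space.
      ; top        = case basic-code {∅} {∅} {∅} (num-natural 0)
          (∅ , ∅ , num-natural 0 , toD ∅-map , λ i φ h → contradiction h (∅[]≔ {i} {φ})) (toD ∅-map) of
          λ (γ , γ∈ , A , h , spec) → γ , γ∈ ,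
            []≔-resp {Int} {Int} {γ} {γ} {A} {Str} (≈-refl {Int}) (≈-refl {γ})
              (ext {A} {Str} λ z → mk⇔ (proj₁ ∘ to (spec z))
                (λ z∈ → from (spec z) (z∈ , λ i φ k → contradiction k (∅[]≔ {i} {φ})))) h
      ; neg∈       = 𝓒.negation
      ; join∈      = λ f Γ δ f-map → 𝓒.join f Γ δ (toD f-map)
      ; meet∈      = λ f Γ δ f-map → 𝓒.meet f Γ δ (toD f-map)
      ; neg        = 𝓘.negation
      ; join       = 𝓘.join
      ; meet       = 𝓘.meet
      }
      where Int-map = proj₂ (proj₂ 𝓘.function)

    open Interpretation codeInterpretation using (Coded; neg-code; coded-⋃)

    literal-coded : ∀ {n φ a A} → D.Natural n → D.Literal L n φ → D._∶_⟶_ a n X →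
                    (∀ M → M ∈ A ⇔ (M ∈ Str × D._⊨_[_] X L Str Sat M φ a)) → Coded A
    literal-coded {n} {φ} {a} {A} n-natural φ-literal a-map A-spec =
      case singleton-map φ of λ (s , s-map , s-at , s-only) →
      case basic-code {n} {s} {a} n-natural
        (num 1 , ⦅ φ , φ ⦆ , num-natural 1 , toD s-map , λ i ψ h Λ Λ-closed →
          ∈-resp {φ} {ψ} {Λ} {Λ} (≈-sym {ψ} {φ} (s-only {i} {ψ} h)) (≈-refl {Λ})
            (φ-literal Λ Λ-closed)) a-map of
      λ (γ , γ∈ , B , h , spec) → γ , γ∈ ,
        []≔-resp {Int} {Int} {γ} {γ} {B} {A} (≈-refl {Int}) (≈-refl {γ})
          (ext {B} {A} λ M → mk⇔
            (λ M∈ → case to (spec M) M∈ of λ (M∈Str , k) → from (A-spec M) (M∈Str , k ∅ φ s-at))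
            (λ M∈ → case to (A-spec M) M∈ of λ (M∈Str , p , (q , t , t′) , p∈) →
              from (spec M) (M∈Str , λ i ψ k → p , (q , t ,
                Pair-resp {φ} {ψ} {q} {q} {p} {p} (≈-sym {ψ} {φ} (s-only {i} {ψ} k))
                  (≈-refl {q}) (≈-refl {p}) t′) , p∈)))
          h

    -- The measurable sets that possess a code form a set of V closed under the operations
    -- generating `𝓑`, so minimality of `𝓑` applies.
    measurable⇒coded : ∀ A → A ∈ 𝓑 → Coded A
    measurable⇒coded A a =
      case separate Coded (λ A → ∃ᵈ (v₀ ∈ᵈ con 𝔹 ×ᵈ con Int [ v₀ ]≔ᵈ wk A)) 𝓑 of λ (F , F-spec) →
      proj₂ (to (F-spec A) (measurable-least F record
        { subsets    = λ B → 𝓑-closed.subsets B ∘ proj₁ ∘ to (F-spec B)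
        ; literal    = λ n φ a B n-natural φ-literal a-map B-spec → from (F-spec B)
            ( 𝓑-closed.literal n φ a B n-natural φ-literal a-map B-spec
            , literal-coded {n} {φ} {a} {B} n-natural φ-literal a-map B-spec)
        ; complement = λ B C B∈ C-spec → case to (F-spec B) B∈ of λ (b , γ , γ∈ , h) →
            case neg-code {γ} {B} γ∈ h of λ (δ∈ , k) → from (F-spec C)
              ( 𝓑-closed.complement B C b C-spec
              , tag 1 γ , δ∈ , []≔-resp {Int} {Int} {tag 1 γ} {tag 1 γ} {Str ∖ B} {C}
                  (≈-refl {Int}) (≈-refl {tag 1 γ}) (ext {Str ∖ B} {C} λ z → mk⇔
                    (from (C-spec z) ∘ to (∈∖ {Str} {B} {z}))
                    (from (∈∖ {Str} {B} {z}) ∘ to (C-spec z))) k)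
        ; union      = λ { C U C⊆F (j , j-map , j-injective) U-spec → from (F-spec U)
            ( 𝓑-closed.union C U (λ B → proj₁ ∘ to (F-spec B) ∘ C⊆F B) (j , j-map , j-injective) U-spec
            , coded-⋃ {C} {j} {U} (λ B → proj₂ ∘ to (F-spec B) ∘ C⊆F B) (fromD j-map) j-injective
                U-spec) }
        } A a))

    -- A condition inside A is ν-positive and a member of both filters, so it
    -- would have to be μ-positive as well.
    singular⇒¬generic : ∀ {μ ν A G} (m : M.IsErgodicInvariantMeasure μ)
      (n : M.IsErgodicInvariantMeasure ν) → A ∈ 𝓑 →
      Measure.⟪_⟫ (measure m) A ≈ᴿ 0ᴿ → Measure.⟪_⟫ (measure n) A ≈ᴿ 1ᴿ →
      M.IsRandomGeneric μ G → ¬ M.IsRandomGeneric ν G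
    singular⇒¬generic {μ} {ν} {A} {G} m n a μ-null ν-full G-μ G-ν =
      case measurable⇒coded A a of λ (δ , δ∈ , δ-at) →
      case null-set space line (graph-of n) of λ (Z , Z-spec) →
      case dense-inside codeInterpretation space values (measure n) {A} {δ} {Z} Z-spec a ν-full δ∈ δ-at of
      λ (D′ , D-spec , D-dense) →
      case ν-generic.generic D′
        ( (λ q q∈ → case to (D-spec q) q∈ of λ (q∈𝔹 , C , h , _ , c , C∉Z) →
            q∈𝔹 , ν.⟪ C ⟫ , (C , h , ν-graph.value-at {C} c) , ν.nonneg {C} c ,
            λ e → C∉Z (from (Z-spec C) (c , ≈-sym {⌊ 0ᴿ ⌋} {⌊ ν.⟪ C ⟫ ⌋} e)))
        , λ { p (p∈ , r , (C , h , C-at) , (_ , 0≉r)) →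
            let c = proj₁ (Map-∈ {ν} {𝓑} {R} {C} {⌊ r ⌋} ν-graph.function C-at) in
            case D-dense p C p∈ h c (λ C∈Z → 0≉r (≈-trans {⌊ 0ᴿ ⌋} {⌊ ν.⟪ C ⟫ ⌋} {⌊ r ⌋}
              (≈-sym {⌊ ν.⟪ C ⟫ ⌋} {⌊ 0ᴿ ⌋} (proj₂ (to (Z-spec C) C∈Z)))
              (ν-graph.value-unique {C} {⌊ r ⌋} C-at))) of
            -- The difference of the two conditions is interpreted by the empty set, so its
            -- ν-measure is 0.
            λ (q , q∈ , (η , Γ , ε , η-neg , Γ-pair , ε-meet , E , E-at , E-empty)) →
            q , q∈ , η , Γ , ε , η-neg , Γ-pair , ε-meet , E , E-at , ν-graph.empty E E-empty }) of
      λ (p , p∈D , p∈G) →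
      case μ-generic.conditions (proj₁ p) p∈G of λ (p′ , p≈p′ , _ , r , (C′ , h′ , C′-at) , (_ , 0≉r)) →
      case to (D-spec p) p∈D of λ (_ , C , h , C⊆A , c , _) →
      let C≈C′ : C ≈ C′
          C≈C′ = Interpretation.functional codeInterpretation p′ C C′
            ([]≔-resp {Int} {Int} {p} {p′} {C} {C} (≈-refl {Int}) p≈p′ (≈-refl {C}) h) h′
          C-null : μ.⟪ C ⟫ ≈ᴿ 0ᴿ
          C-null = μ.null-⊆ {C} {A} c a C⊆A μ-null
          C≈r : μ.⟪ C ⟫ ≈ᴿ r
          C≈r = μ-graph.value-unique {C} {⌊ r ⌋} ([]≔-resp {μ} {μ} {C′} {C} {⌊ r ⌋} {⌊ r ⌋}
            (≈-refl {μ}) (≈-sym {C} {C′} C≈C′) (≈-refl {⌊ r ⌋}) C′-at)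
      in 0≉r (≈-trans {⌊ 0ᴿ ⌋} {⌊ μ.⟪ C ⟫ ⌋} {⌊ r ⌋} (≈-sym {⌊ μ.⟪ C ⟫ ⌋} {⌊ 0ᴿ ⌋} C-null) C≈r)
      where
      module μ = Measure (measure m)
      module ν = Measure (measure n)
      module μ-graph = MeasureGraph (graph-of m)
      module ν-graph = MeasureGraph (graph-of n)
      module μ-generic = D.Forcing.IsGenericFilter G-μ
      module ν-generic = D.Forcing.IsGenericFilter G-ν

    -- If `G` were generic for both measures, no inequality between their values at a measurable set
    -- could fail in either direction, since a failure makes the measures singular. The measures
    -- would then agree everywhere, and their graphs would be equal.
    distinct⇒¬generic : ∀ {μ ν G} → M.IsErgodicInvariantMeasure μ → M.IsErgodicInvariantMeasure ν →
                        D._≉_ μ ν → M.IsRandomGeneric μ G → ¬ M.IsRandomGeneric ν G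
    distinct⇒¬generic {μ} {ν} {G} m n μ≉ν G-μ G-ν =
      μ≉ν (Map-ext {μ} {ν} {𝓑} {R} μ-graph.function ν-graph.function λ {A} {x} {y} h k →
        let a = proj₁ (Map-∈ {μ} {𝓑} {R} {A} {x} μ-graph.function h) in
        ≈-trans {x} {⌊ μ.⟪ A ⟫ ⌋} {y}
          (≈-sym {⌊ μ.⟪ A ⟫ ⌋} {x} (μ-graph.value-unique {A} {x} h))
          (≈-trans {⌊ μ.⟪ A ⟫ ⌋} {⌊ ν.⟪ A ⟫ ⌋} {y}
            (𝓥.antisym {μ.⟪ A ⟫} {ν.⟪ A ⟫}
              (decidable-stable em λ μ≰ν → case singular-set n m a μ≰ν of λ (S , s , null , full) →
                singular⇒¬generic {ν} {μ} {S} {G} n m s null full G-ν G-μ)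
              (decidable-stable em λ ν≰μ → case singular-set m n a ν≰μ of λ (S , s , null , full) →
                singular⇒¬generic {μ} {ν} {S} {G} m n s null full G-μ G-ν))
            (ν-graph.value-unique {A} {y} k)))
      where
      module μ = Measure (measure m)
      module ν = Measure (measure n)
      module μ-graph = MeasureGraph (graph-of m)
      module ν-graph = MeasureGraph (graph-of n)

corollary7p7 : ∀ {ℓ} → ExcludedMiddle (lsuc ℓ) →
    (V : 𝕍 ℓ → Set (lsuc ℓ)) →
    let open Relativised V in
    IsTransitiveModelOfZFC →
    (κ X L : Ob) → IsOrdinal κ → Infinite κ → Infinite X → IsLanguage L →
    (𝓢 : BorelStructures κ X L) (ℝ : Reals) →
    let open Measures κ X L 𝓢 ℝ in
    (μ₀ μ₁ : Ob) →
    IsErgodicInvariantMeasure μ₀ → IsErgodicInvariantMeasure μ₁ → μ₀ ≉ μ₁ →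
    (G : 𝕍 ℓ) → IsRandomGeneric μ₀ G → ¬ IsRandomGeneric μ₁ G
corollary7p7 em V zfc κ X L κ-ordinal κ-infinite _ _ 𝓢 ℝ μ₀ μ₁ m₀ m₁ μ₀≉μ₁ G =
  Model.Structures.distinct⇒¬generic em V zfc κ X L κ-ordinal κ-infinite 𝓢 ℝ
    {μ₀} {μ₁} {G} m₀ m₁ μ₀≉μ₁
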